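{- Let $(R,\oplus,I_0)$ be a commutative monoid such that: (1) $R$ is a subset of the reals $\mathbb{R}$; (2) the operator $\oplus$ can be computed in polynomial time; (3) $\oplus$ introduces no error; (4) $\oplus$ is repeatable. Then there is a Relational Approximation Scheme (RAS) for computing SumSum FAQ-AI(1) queries over $(R,\oplus,I_0)$. That is, for each real $\epsilon>0$ there is a relational algorithm $A_\epsilon$ which, given tables $T_1,\dots,T_m$ with design matrix $J$, functions $F_1,\dots,F_d$ with range $R$, and one additive inequality $\sum_{j=1}^d g_j(x_j)\le L$, outputs the value of $$\bigoplus_{x\in J,\ \sum_{j=1}^d g_j(x_j)\le L}\ \bigoplus_{i=1}^d F_i(x_i)$$ with relative error at most $\epsilon$.
   Context: Tables and design matrix: the input contains relational tables $T_1,\dots,T_m$ with real-valued entries, where each table $T_i$ is a finite set of rows (tuples) over a set $C_i$ of columns (features). The design matrix $J=T_1\Join\cdots\Join T_m$ is the inner (natural) join: the set of all tuples $x$ over the columns $\bigcup_i C_i$ whose projection onto $C_i$ is a row of $T_i$ for every $i$. Let $n$ be an upper bound on the number of rows in any table $T_i$, and $d=|\bigcup_i C_i|$ the number of columns of $J$, indexed $1,\dots,d$; $x_i$ is the entry of row $x$ in column $i$. FAQ-AI(1): the input also contains one additive inequality $\sum_{j=1}^d g_j(x_j)\le L$, where each $g_j$ is an (easy to compute) function from the domain of column $j$ to the reals and $L\in\mathbb{R}$. A SumSum query is given by (easy to compute) functions $F_i$ from the domain of column $i$ to $R$, $i=1,\dots,d$. Its value is the $\oplus$-sum over rows $x\in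 J$ satisfying the inequality of $\bigoplus_{i=1}^d F_i(x_i)$; empty sums are $I_0$. Acyclic join: $J$ is acyclic if there is a tree with vertices $v_1,\dots,v_m$ such that for every column $c$ the set $\{v_i : c\in C_i\}$ is connected in the tree. Relational algorithm: an algorithm whose running time is polynomially bounded in $n$, $m$ and $d$ if the join is acyclic. Relational Approximation Scheme (RAS): a collection $\{A_\epsilon\}$ of relational algorithms, one for each real $\epsilon>0$, such that $A_\epsilon$ outputs a solution with relative error at most $\epsilon$, meaning that if the true value is $Q$ then the output $Q'$ satisfies $Q/(1+\epsilon)\le Q'\le(1+\epsilon)Q$. Introduces no error: an operator $\odot$ introduces no error if whenever $x/(1+\delta_1)\le x'\le(1+\delta_1)x$ and $y/(1+\delta_2)\le y'\le(1+\delta_2)y$ (with $\delta_1,\delta_2\geq 0$), then $(x\odot y)/(1+\max(\delta_1,\delta_2))\le x'\odot y'\le(1+\max(\delta_1,\delta_2))(x\odot y)$. Repeatable: an operator $\odot$ on $R$ is repeatable if for any two non-negative integers $k,j$ and any non-negative real $\delta$ with $k/(1+\delta)\le j\le(1+\delta)k$, it is the case that for every $x\in R$, $(\bigodot^k x)/(1+\delta)\le\bigodot^j x\le(1+\delta)\bigodot^k x$, where $\bigodot^k x$ denotes the $\odot$-combination of $k$ copies of $x$. -}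

module Defs where

open import Algebra.Bundles using (CommutativeRing; CommutativeMonoid)
open import Algebra.Core using (Op₁; Op₂)
open import Algebra.Structures using (IsCommutativeRing; IsCommutativeMonoid)
import Algebra.Construct.NaturalChoice.Max as Maximum
import Algebra.Definitions.RawMonoid as RawMonoidDefinitions
open import Data.Bool using (Bool; true; false)
open import Data.Fin using (Fin; zero; suc)
import Data.Fin.Properties as Fin
open import Data.Fin.Subset using (Subset; inside; outside; ∣_∣) renaming (_∈_ to _∈ˢ_)
open import Data.List using (List; []; _∷_; _∷ʳ_; length; foldr; map; filter; concat; concatMap; tabulate; allFin; deduplicate; cartesianProductWith)
open import Data.List.Membership.Propositional using (_∈_; lose)
open import Data.List.Membership.Propositional.Properties using (∈-filter⁺; ∈-filter⁻; ∈-deduplicate⁺; ∈-cartesianProductWith⁺; ∈-concatMap⁺; ∈-concat⁺′; ∈-tabulate⁺)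
import Data.List.Membership.DecPropositional as DecMembership
open import Data.List.Relation.Unary.All using ([])
import Data.List.Relation.Unary.Any as Any
open import Data.List.Relation.Unary.AllPairs using ([]; _∷_)
open import Data.List.Relation.Unary.Linked using (Linked)
open import Data.List.Relation.Unary.Unique.Propositional using (Unique)
import Data.List.Relation.Unary.Unique.Propositional.Properties as Unique
import Data.List.Relation.Unary.Unique.DecPropositional.Properties as DecUnique
open import Data.Nat as ℕ using (ℕ; zero; suc)
open import Data.Product using (Σ; ∃; ∃-syntax; _×_; _,_; proj₁; proj₂)
open import Data.Vec as Vec using (Vec; []; _∷_; lookup; toList; here; there)
import Data.Vec.Properties as Vec
open import Data.Vec.Membership.Propositional using () renaming (_∈_ to _∈ᵛ_)
open import Data.Vec.Membership.Propositional.Properties using (∈-toList⁺)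
import Data.Vec.Relation.Unary.Any as VecAny
open import Function using (_∘_)
open import Function.Bundles using (_⇔_; mk⇔)
open import Level using (0ℓ)
open import Relation.Binary.Bundles using (DecTotalOrder)
open import Relation.Binary.Construct.Closure.ReflexiveTransitive using (Star)
open import Relation.Binary.Core using (Rel)
open import Relation.Binary.Definitions using (Symmetric; Irreflexive)
open import Relation.Binary.PropositionalEquality using (_≡_; _≢_; refl)
open import Relation.Binary.Structures using (IsDecTotalOrder)
open import Relation.Nullary using (¬_; Dec; contradiction)
open import Relation.Unary using (Pred)

-- The reals are given axiomatically.  Two choices concern constructive
-- content: the order is decidable (a real RAM compares reals in one step),
-- and the least upper bound is approached from below by members of P, which
-- is classically the same as being the least of the upper bounds.  The value
-- of 0# ⁻¹ is unconstrained.
record CompleteOrderedField : Set₁ where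
  infix  8 _⁻¹
  infixl 7 _*_ _/_
  infixl 6 _+_ _-_
  infix  8 -_
  infix  4 _≤_ _<_ _≈[_]_
  field
    ℝ    : Set
    _≤_  : Rel ℝ 0ℓ
    _+_  : Op₂ ℝ
    _*_  : Op₂ ℝ
    -_   : Op₁ ℝ
    _⁻¹  : Op₁ ℝ
    0#   : ℝ
    1#   : ℝ
    isCommutativeRing : IsCommutativeRing _≡_ _+_ _*_ -_ 0# 1#
    isDecTotalOrder   : IsDecTotalOrder _≡_ _≤_
    0≢1               : 0# ≢ 1#
    *-inverseʳ        : ∀ x → x ≢ 0# → x * x ⁻¹ ≡ 1#
    +-monoˡ-≤         : ∀ {x y} z → x ≤ y → x + z ≤ y + z
    *-nonneg          : ∀ {x y} → 0# ≤ x → 0# ≤ y → 0# ≤ x * y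

  _<_ : Rel ℝ 0ℓ
  x < y = ¬ (y ≤ x)

  UpperBound : Pred ℝ 0ℓ → Pred ℝ 0ℓ
  UpperBound P b = ∀ x → P x → x ≤ b

  Supremum : Pred ℝ 0ℓ → Pred ℝ 0ℓ
  Supremum P s = UpperBound P s × (∀ y → y < s → ∃[ x ] P x × y < x)

  field
    complete : (P : Pred ℝ 0ℓ) → ∃ P → ∃ (UpperBound P) → ∃ (Supremum P)

  commutativeRing : CommutativeRing 0ℓ 0ℓ
  commutativeRing = record { isCommutativeRing = isCommutativeRing }

  decTotalOrder : DecTotalOrder 0ℓ 0ℓ 0ℓ
  decTotalOrder = record { isDecTotalOrder = isDecTotalOrder }

  open IsDecTotalOrder isDecTotalOrder public using (_≟_; _≤?_)
  open Maximum (DecTotalOrder.totalOrder decTotalOrder) public using (_⊔_)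

  _-_ : Op₂ ℝ
  x - y = x + (- y)

  _/_ : Op₂ ℝ
  x / y = x * y ⁻¹

  fromℕ : ℕ → ℝ
  fromℕ k = k ×ℝ 1#
    where
    open RawMonoidDefinitions (CommutativeRing.+-rawMonoid commutativeRing)
      renaming (_×_ to _×ℝ_)

  _≈[_]_ : ℝ → ℝ → ℝ → Set
  x ≈[ δ ] x′ = (x / (1# + δ) ≤ x′) × (x′ ≤ (1# + δ) * x)

module _ (ℜ : CompleteOrderedField) where
  open CompleteOrderedField ℜ

  -- ⊕ is defined on the members of R only.  Two elements of ∃ R are equal
  -- when they are the same real.
  record RealCommutativeMonoid : Set₁ where
    infixl 6 _⊕_
    field
      R   : Pred ℝ 0ℓ
      _⊕_ : Op₂ (∃ R)
      I₀  : ∃ R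
      isCommutativeMonoid :
        IsCommutativeMonoid (λ x y → proj₁ x ≡ proj₁ y) _⊕_ I₀

    commutativeMonoid : CommutativeMonoid 0ℓ 0ℓ
    commutativeMonoid = record { isCommutativeMonoid = isCommutativeMonoid }

    open RawMonoidDefinitions (CommutativeMonoid.rawMonoid commutativeMonoid) public
      using () renaming (sum to ⨁; _×_ to _copiesOf_)

module _ {ℜ : CompleteOrderedField} (M : RealCommutativeMonoid ℜ) where
  open CompleteOrderedField ℜ
  open RealCommutativeMonoid M

  IntroducesNoError : Set
  IntroducesNoError =
    ∀ (x x′ y y′ : ∃ R) (δ₁ δ₂ : ℝ) → 0# ≤ δ₁ → 0# ≤ δ₂ →
    proj₁ x ≈[ δ₁ ] proj₁ x′ →
    proj₁ y ≈[ δ₂ ] proj₁ y′ →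
    proj₁ (x ⊕ y) ≈[ δ₁ ⊔ δ₂ ] proj₁ (x′ ⊕ y′)

  Repeatable : Set
  Repeatable =
    ∀ (k j : ℕ) (δ : ℝ) → 0# ≤ δ → fromℕ k ≈[ δ ] fromℕ j →
    ∀ (x : ∃ R) → proj₁ (k copiesOf x) ≈[ δ ] proj₁ (j copiesOf x)

infixl 6 _:+_
infixl 7 _:*_

data Polynomial (k : ℕ) : Set where
  con  : ℕ → Polynomial k
  var  : Fin k → Polynomial k
  _:+_ : Polynomial k → Polynomial k → Polynomial k
  _:*_ : Polynomial k → Polynomial k → Polynomial k

evaluate : ∀ {k} → Polynomial k → Vec ℕ k → ℕ
evaluate (con c)  ρ = c
evaluate (var i)  ρ = lookup ρ i
evaluate (p :+ q) ρ = evaluate p ρ ℕ.+ evaluate q ρ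
evaluate (p :* q) ρ = evaluate p ρ ℕ.* evaluate q ρ

-- Binary functions on ℝ that the machine may evaluate in one step in
-- addition to field arithmetic and comparison (e.g. roots).
-- Op may be empty, which gives the plain arithmetic real RAM.
record BasicFunctions (ℜ : CompleteOrderedField) : Set₁ where
  open CompleteOrderedField ℜ
  field
    Op  : Set
    ⟦_⟧ : Op → ℝ → ℝ → ℝ

module _ {ℜ : CompleteOrderedField} (B : BasicFunctions ℜ) where
  open CompleteOrderedField ℜ
  open BasicFunctions B

  -- Jones's WHILE language on binary trees, with reals and black-box
  -- functions on reals as additional leaves.
  data Value : Set where
    nil  : Value
    num  : ℝ → Value
    fun  : (ℝ → ℝ) → Value
    pair : Value → Value → Value

  size : Value → ℕ
  size nil        = 1
  size (num _)    = 1
  size (fun _)    = 1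
  size (pair u v) = suc (size u ℕ.+ size v)

  infixr 5 _⨾_

  -- A program transforms one value, its whole store, into another.  As in a
  -- Blum–Shub–Smale machine, finitely many real constants may occur in it.
  data Program : Set where
    skip         : Program
    _⨾_          : Program → Program → Program
    mkNil        : Program
    mkNum        : ℝ → Program
    ⟨_,_⟩        : Program → Program → Program
    left right   : Program
    add sub      : Program
    mul div      : Program
    leq          : Program
    basic        : Op → Program
    apply        : Program
    ifte         : Program → Program → Program → Program
    while        : Program → Program → Program

  truth : Bool → Value
  truth false = nil
  truth true  = pair nil nil

  -- p ∶ v ⇓ w ∣ t : started on v, the program p halts with w after t steps.
  -- Trees are never copied or compared by an instruction (an implementation
  -- shares them through pointers), so every instruction has unit cost.
  -- A program is stuck on operands of the wrong shape.
  infix 4 _∶_⇓_∣_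

  data _∶_⇓_∣_ : Program → Value → Value → ℕ → Set where
    skip  : ∀ {v} → skip ∶ v ⇓ v ∣ 1
    seq   : ∀ {p q u v w s t} → p ∶ u ⇓ v ∣ s → q ∶ v ⇓ w ∣ t →
            (p ⨾ q) ∶ u ⇓ w ∣ suc (s ℕ.+ t)
    mkNil : ∀ {v} → mkNil ∶ v ⇓ nil ∣ 1
    mkNum : ∀ {v r} → mkNum r ∶ v ⇓ num r ∣ 1
    both  : ∀ {p q v u w s t} → p ∶ v ⇓ u ∣ s → q ∶ v ⇓ w ∣ t →
            ⟨ p , q ⟩ ∶ v ⇓ pair u w ∣ suc (s ℕ.+ t)
    left  : ∀ {u v} → left ∶ pair u v ⇓ u ∣ 1
    right : ∀ {u v} → right ∶ pair u v ⇓ v ∣ 1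
    add   : ∀ {x y} → add ∶ pair (num x) (num y) ⇓ num (x + y) ∣ 1
    sub   : ∀ {x y} → sub ∶ pair (num x) (num y) ⇓ num (x - y) ∣ 1
    mul   : ∀ {x y} → mul ∶ pair (num x) (num y) ⇓ num (x * y) ∣ 1
    div   : ∀ {x y} → y ≢ 0# → div ∶ pair (num x) (num y) ⇓ num (x / y) ∣ 1
    leq   : ∀ {x y} → leq ∶ pair (num x) (num y) ⇓ truth (Dec.does (x ≤? y)) ∣ 1
    basic : ∀ {o x y} → basic o ∶ pair (num x) (num y) ⇓ num (⟦ o ⟧ x y) ∣ 1
    apply : ∀ {f x} → apply ∶ pair (fun f) (num x) ⇓ num (f x) ∣ 1
    then′ : ∀ {p q r v b w s t} → p ∶ v ⇓ b ∣ s → b ≢ nil → q ∶ v ⇓ w ∣ t →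
            ifte p q r ∶ v ⇓ w ∣ suc (s ℕ.+ t)
    else′ : ∀ {p q r v w s t} → p ∶ v ⇓ nil ∣ s → r ∶ v ⇓ w ∣ t →
            ifte p q r ∶ v ⇓ w ∣ suc (s ℕ.+ t)
    stop  : ∀ {p q v s} → p ∶ v ⇓ nil ∣ s → while p q ∶ v ⇓ v ∣ suc s
    loop  : ∀ {p q u b v w r s t} → p ∶ u ⇓ b ∣ r → b ≢ nil → q ∶ u ⇓ v ∣ s →
            while p q ∶ v ⇓ w ∣ t →
            while p q ∶ u ⇓ w ∣ suc (r ℕ.+ s ℕ.+ t)

  deterministic : ∀ {p v w w′ t t′} → p ∶ v ⇓ w ∣ t → p ∶ v ⇓ w′ ∣ t′ →
                  w ≡ w′ × t ≡ t′
  deterministic skip skip = refl , refl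
  deterministic (seq a b) (seq a′ b′) with deterministic a a′
  ... | refl , refl with deterministic b b′
  ... | refl , refl = refl , refl
  deterministic mkNil mkNil = refl , refl
  deterministic mkNum mkNum = refl , refl
  deterministic (both a b) (both a′ b′) with deterministic a a′ | deterministic b b′
  ... | refl , refl | refl , refl = refl , refl
  deterministic left left = refl , refl
  deterministic right right = refl , refl
  deterministic add add = refl , refl
  deterministic sub sub = refl , refl
  deterministic mul mul = refl , refl
  deterministic (div _) (div _) = refl , refl
  deterministic leq leq = refl , refl
  deterministic basic basic = refl , refl
  deterministic apply apply = refl , refl
  deterministic (then′ a _ b) (then′ a′ _ b′) with deterministic a a′ | deterministic b b′
  ... | refl , refl | refl , refl = refl , refl
  deterministic (then′ a n _) (else′ a′ _) = contradiction (proj₁ (deterministic a a′)) n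
  deterministic (else′ a _) (then′ a′ n _) = contradiction (proj₁ (deterministic a′ a)) n
  deterministic (else′ a b) (else′ a′ b′) with deterministic a a′ | deterministic b b′
  ... | refl , refl | refl , refl = refl , refl
  deterministic (stop a) (stop a′) with deterministic a a′
  ... | refl , refl = refl , refl
  deterministic (stop a) (loop a′ n _ _) = contradiction (proj₁ (deterministic a′ a)) n
  deterministic (loop a n _ _) (stop a′) = contradiction (proj₁ (deterministic a a′)) n
  deterministic (loop a _ b c) (loop a′ _ b′ c′) with deterministic a a′ | deterministic b b′
  ... | refl , refl | refl , refl with deterministic c c′
  ... | refl , refl = refl , refl

  PolynomialTimeOperator : RealCommutativeMonoid ℜ → Set
  PolynomialTimeOperator M =
    Σ Program λ p → Σ (Polynomial 1) λ bound →
    ∀ (x y : ∃ R) → let input = pair (num (proj₁ x)) (num (proj₁ y)) in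
    ∃[ t ] (p ∶ input ⇓ num (proj₁ (x ⊕ y)) ∣ t) ×
           t ℕ.≤ evaluate bound (size input ∷ [])
    where open RealCommutativeMonoid M

project : ∀ {a} {A : Set a} {d} (C : Subset d) → Vec A d → Vec A ∣ C ∣
project []            []       = []
project (inside  ∷ C) (x ∷ xs) = x ∷ project C xs
project (outside ∷ C) (x ∷ xs) = project C xs

∈-project : ∀ {a} {A : Set a} {d} (C : Subset d) (x : Vec A d) {c} →
            c ∈ˢ C → lookup x c ∈ᵛ project C x
∈-project (inside  ∷ C) (x ∷ xs) here      = VecAny.here refl
∈-project (inside  ∷ C) (x ∷ xs) (there p) = VecAny.there (∈-project C xs p)
∈-project (outside ∷ C) (x ∷ xs) (there p) = ∈-project C xs p

module _ (ℜ : CompleteOrderedField) where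
  open CompleteOrderedField ℜ

  -- The entries of a row are listed in increasing order of column index.
  record Table (d : ℕ) : Set where
    field
      columns : Subset d
      rows    : List (Vec ℝ ∣ columns ∣)
      unique  : Unique rows

  record Database : Set where
    field
      m d     : ℕ
      table   : Fin m → Table d
      covered : ∀ (c : Fin d) → ∃[ i ] c ∈ˢ Table.columns (table i)

module _ {ℜ : CompleteOrderedField} (D : Database ℜ) where
  open CompleteOrderedField ℜ
  open Database D

  InJoin : Vec ℝ d → Set
  InJoin x = ∀ i → project (Table.columns (table i)) x ∈ Table.rows (table i)

  inJoin? : ∀ x → Dec (InJoin x)
  inJoin? x = Fin.all? λ i →
    DecMembership._∈?_ (Vec.≡-dec _≟_) (project (Table.columns (table i)) x) (Table.rows (table i))

  -- The join is enumerated by filtering all d-tuples of reals that occur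
  -- somewhere in the database; ∈-join and join-unique say that this lists
  -- each tuple of the join exactly once.
  tableEntries : Fin m → List ℝ
  tableEntries i = concatMap toList (Table.rows (table i))

  entries : List ℝ
  entries = deduplicate _≟_ (concat (tabulate tableEntries))

  tuples : ∀ k → List (Vec ℝ k)
  tuples zero    = [] ∷ []
  tuples (suc k) = cartesianProductWith _∷_ entries (tuples k)

  join : List (Vec ℝ d)
  join = filter inJoin? (tuples d)

module _ {ℜ : CompleteOrderedField} (D : Database ℜ) where
  open CompleteOrderedField ℜ
  open Database D

  join-unique : Unique (join D)
  join-unique = Unique.filter⁺ (inJoin? D) (tuples-unique d)
    where
    tuples-unique : ∀ k → Unique (tuples D k)
    tuples-unique zero    = [] ∷ []
    tuples-unique (suc k) =
      Unique.cartesianProductWith⁺ _∷_ Vec.∷-injective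
        (DecUnique.deduplicate-! _≟_ (concat (tabulate (tableEntries D)))) (tuples-unique k)

  ∈-join : ∀ x → x ∈ join D ⇔ InJoin D x
  ∈-join x = mk⇔ (λ p → proj₂ (∈-filter⁻ (inJoin? D) {xs = tuples D d} p))
                 (λ x∈J → ∈-filter⁺ (inJoin? D) (∈-tuples x (entry x∈J)) x∈J)
    where
    ∈-tuples : ∀ {k} (y : Vec ℝ k) → (∀ c → lookup y c ∈ entries D) → y ∈ tuples D k
    ∈-tuples []       h = Any.here refl
    ∈-tuples (a ∷ as) h = ∈-cartesianProductWith⁺ _∷_ (h zero) (∈-tuples as (h ∘ suc))

    entry : InJoin D x → ∀ c → lookup x c ∈ entries D
    entry x∈J c with covered c
    ... | i , c∈Cᵢ = ∈-deduplicate⁺ _≟_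
      (∈-concat⁺′ (∈-concatMap⁺ toList (lose (x∈J i) (∈-toList⁺ (∈-project _ x c∈Cᵢ))))
                  (∈-tabulate⁺ {f = tableEntries D} i))

module _ {m : ℕ} (Adj : Rel (Fin m) 0ℓ) where

  IsCycle : List (Fin m) → Set
  IsCycle vs = ∃[ u ] ∃[ us ] ∃[ w ]
    vs ≡ u ∷ (us ∷ʳ w) × us ≢ [] × Unique vs × Linked Adj vs × Adj w u

  -- The subgraph induced on the vertices satisfying S is connected.
  ConnectedOn : Pred (Fin m) 0ℓ → Set
  ConnectedOn S = ∀ i j → S i → S j → Star (λ u v → S u × S v × Adj u v) i j

  record IsTree : Set where
    field
      symmetric   : Symmetric Adj
      irreflexive : Irreflexive _≡_ Adj
      connected   : ∀ i j → Star Adj i j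
      acyclic     : ∀ vs → ¬ IsCycle vs

module _ {ℜ : CompleteOrderedField} (D : Database ℜ) where
  open Database D

  Acyclic : Set₁
  Acyclic = Σ (Rel (Fin m) 0ℓ) λ Adj → IsTree Adj ×
    (∀ c → ConnectedOn Adj (λ i → c ∈ˢ Table.columns (table i)))

module _ {ℜ : CompleteOrderedField} (M : RealCommutativeMonoid ℜ) where
  open CompleteOrderedField ℜ
  open RealCommutativeMonoid M
  open RawMonoidDefinitions (CommutativeRing.+-rawMonoid commutativeRing)
    using () renaming (sum to ∑)

  record Query : Set where
    field
      database : Database ℜ
    open Database database public
    field
      g : Fin d → ℝ → ℝ
      L : ℝ
      F : Fin d → ℝ → ∃ R

  module _ (q : Query) where
    open Query q

    satisfying : List (Vec ℝ d)
    satisfying = filter (λ x → ∑ (λ j → g j (lookup x j)) ≤? L) (join database)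

    sumSum : ∃ R
    sumSum = foldr _⊕_ I₀ (map (λ x → ⨁ (λ i → F i (lookup x i))) satisfying)

module _ {ℜ : CompleteOrderedField} (B : BasicFunctions ℜ)
         (M : RealCommutativeMonoid ℜ) where
  open CompleteOrderedField ℜ

  encodeList : ∀ {a} {A : Set a} → (A → Value B) → List A → Value B
  encodeList e []       = nil
  encodeList e (x ∷ xs) = pair (e x) (encodeList e xs)

  encodeTable : ∀ {d} → Table ℜ d → Value B
  encodeTable T = pair (encodeList (truth B) (toList columns))
                       (encodeList (encodeList num ∘ toList) rows)
    where open Table T

  -- The functions g j and F j are handed over as black boxes that are
  -- evaluated in one step: "easy to compute".
  encode : Query M → Value B
  encode q = pair (num L)
            (pair (encodeList (λ j → pair (fun (g j)) (fun (proj₁ ∘ F j))) (allFin d))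
                  (encodeList encodeTable (tabulate table)))
    where open Query q

  IsRelational : Program B → Set₁
  IsRelational A = Σ (Polynomial 3) λ bound →
    ∀ (q : Query M) → let open Query q in
    Acyclic database →
    ∀ n → (∀ i → length (Table.rows (table i)) ℕ.≤ n) →
    ∃[ w ] ∃[ t ] (_∶_⇓_∣_ B A (encode q) w t) ×
                  t ℕ.≤ evaluate bound (n ∷ m ∷ d ∷ [])

  HasRelativeError : Program B → ℝ → Set
  HasRelativeError A ε = ∀ (q : Query M) →
    ∃[ Q′ ] ∃[ t ] (_∶_⇓_∣_ B A (encode q) (num Q′) t) ×
                   proj₁ (sumSum M q) ≈[ ε ] Q′

  SumSumRAS : Set₁
  SumSumRAS = ∀ ε → 0# < ε →
    Σ (Program B) λ A → IsRelational A × HasRelativeError A ε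

{-# OPTIONS --safe #-}

-- Grouped by tables, the query value is a ⊕-sum over all tables and all their
-- rows r of k copies of an element of R that depends on r only, where k is the
-- number of satisfying rows of the join that extend r.  As ⊕ is repeatable and
-- introduces no error, it suffices to find an integer within a factor 1 + ε of
-- each k; its copies are formed by repeated doubling.
--
-- For fixed r, every row of every table carries a multiset of reals, and k is
-- the mass on (-∞, L] of the multiset of all sums over consistent choices of
-- rows.  If x is an ear, that is, if one table y has all the columns that x
-- shares with other tables, then x can be absorbed into y: each row of y takes
-- the sums of its multiset with those of the consistent rows of x.  After
-- sorting, a multiset is thinned by keeping its cumulative mass only where this
-- has grown by a factor 1 + 1/N.  Masses are at most 2 ^ (n * m), so that few
-- entries remain, and with N = m * (e + 1) and 1 ≤ ε * e the at most m thinnings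
-- together cost a factor of at most 1 + ε.
--
-- In an acyclic join there is always an ear, and removing any ear leaves an
-- acyclic join.  Without an ear, two tables are joined outright, which is slow
-- but correct.

module Submission where

open import Defs

open import Algebra.Bundles using (CommutativeRing; CommutativeMonoid)
import Algebra.Construct.NaturalChoice.Max as Maximum
import Algebra.Definitions.RawMonoid as RawMonoidDefinitions
import Algebra.Properties.CommutativeSemigroup as CommutativeSemigroupProperties
import Algebra.Properties.Monoid.Mult as MonoidMult
import Algebra.Properties.Ring as RingProperties
open import Data.Bool using (Bool; true; false; if_then_else_; T)
open import Data.Empty using (⊥; ⊥-elim)
open import Data.Fin using (Fin; zero; suc)
open import Data.Fin.Subset using (Subset; inside; outside; ∣_∣) renaming (_∈_ to _∈ˢ_)
open import Data.List using (List; []; _∷_; _++_; _∷ʳ_; _ʳ++_; length; foldr; foldl; map; filter; reverse; tabulate; allFin; zip)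
import Data.Fin.Properties as Fin
import Data.List.Properties as List
import Data.List.Relation.Unary.Unique.Propositional.Properties as Unique
open import Data.List.Membership.Propositional using (_∈_; _∉_)
open import Data.List.Membership.Propositional.Properties using (∈-++⁺ˡ; ∈-++⁺ʳ; ∈-++⁻; ∈-map⁺; ∈-map⁻; ∈-tabulate⁺; ∈-∃++)
open import Data.List.Relation.Binary.Permutation.Propositional using (_↭_; prep; swap; ↭-refl; ↭-reflexive; ↭-sym; ↭-trans) renaming (refl to reflᵖ; trans to transᵖ)
import Data.List.Relation.Binary.Permutation.Propositional.Properties as Perm
open import Data.List.Relation.Unary.All as All using (All; []; _∷_)
import Data.List.Relation.Unary.All.Properties as All
open import Data.List.Relation.Unary.AllPairs using (AllPairs; []; _∷_)
open import Data.List.Relation.Unary.Any as Any using (Any; here; there)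
open import Data.List.Relation.Unary.Linked using (Linked; []; [-]; _∷_)
open import Data.List.Relation.Unary.Unique.Propositional using (Unique)
open import Data.Nat as ℕ using (ℕ; zero; suc; z≤n; s≤s)
import Data.Nat.Properties as ℕ
open import Data.Nat.Tactic.RingSolver using (solve-∀)
open import Data.Product using (Σ; ∃; ∃-syntax; _×_; _,_; proj₁; proj₂)
open import Data.Sum using (_⊎_; inj₁; inj₂; [_,_]′)
open import Data.Unit using (⊤; tt)
open import Data.Vec as Vec using (Vec; []; _∷_; lookup; toList; here; there)
import Data.Vec.Properties as Vec
open import Function using (_∘_; id; flip; case_of_)
open import Function.Bundles using (_⇔_; mk⇔; Equivalence)
open import Level using (0ℓ)
open import Relation.Binary.Bundles using (DecTotalOrder)
open import Relation.Binary.Construct.Closure.ReflexiveTransitive using (Star; _◅_) renaming (ε to stay)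
open import Relation.Binary.Core using (Rel)
open import Relation.Binary.PropositionalEquality using (_≡_; _≢_; refl; sym; trans; cong; cong₂; subst; subst₂; module ≡-Reasoning)
import Relation.Binary.Reasoning.Setoid as SetoidReasoning
open import Relation.Binary.Structures using (IsDecTotalOrder)
open import Relation.Nullary using (¬_; Dec; yes; no; contradiction)
open import Relation.Nullary.Decidable using (dec-true; dec-false)

-- Lists and finite sums

-- `HasRelativeError` demands an answer on every query, whereas `IsRelational` bounds the time on
-- acyclic ones only. Halting and correctness are therefore unconditional, and cost is a separate,
-- conditional statement about the same program. The algorithm exists twice: as functions, about
-- which the mathematics is proved, and as terms of a small language that denote them.
--
-- Copies of elements of R can be neither cancelled nor divided, so they are counted before ⊕ is
-- applied, and every column must contribute through exactly one of the tables that contain it.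
--
-- Thinning preserves only the masses of half-lines, and these only up to a factor. It is harmless
-- because, with all other choices fixed, the final count is a nonnegative combination of such
-- masses of a single sketch, for shifted L. Every estimate is a lower bound; hence the factors
-- multiply, and the number of copies stays within reach of the powers of two. For N = m * (e + 1),
-- the factor (1 + 1/N) ^ m is at most N / (N - m) = 1 + 1/e.

infixr 4 _>>=′_

-- These combinators are literal `foldr`s because folds are the only loops of the language below;
-- most denotations of its terms then agree with the intended functions by `refl`.
mapᶠ : {A B : Set} → List A → (A → B) → List B
mapᶠ xs f = foldr (λ x ys → f x ∷ ys) [] xs

append : {A : Set} → List A → List A → List A
append xs ys = foldr _∷_ ys xs

_>>=′_ : {A B : Set} → List A → (A → List B) → List B
xs >>=′ f = foldr (λ x ys → append (f x) ys) [] xs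

caseList : ∀ {ℓ} {A : Set} {B : Set ℓ} → List A → B → (A → List A → B) → B
caseList []       n c = n
caseList (x ∷ xs) n c = c x xs

every some : {A : Set} → List A → (A → Bool) → Bool
every xs p = foldr (λ x b → if p x then b else false) true xs
some  xs p = foldr (λ x b → if p x then true else b) false xs

select : {A : Set} → List A → (A → Bool) → List A
select xs p = xs >>=′ λ x → if p x then x ∷ [] else []

private
  variable
    A B : Set

append≡++ : (xs ys : List A) → append xs ys ≡ xs ++ ys
append≡++ []       ys = refl
append≡++ (x ∷ xs) ys = cong (x ∷_) (append≡++ xs ys)

mapᶠ≡map : (xs : List A) (f : A → B) → mapᶠ xs f ≡ map f xs
mapᶠ≡map []       f = refl
mapᶠ≡map (x ∷ xs) f = cong (f x ∷_) (mapᶠ≡map xs f)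

length-mapᶠ : (xs : List A) (f : A → B) → length (mapᶠ xs f) ≡ length xs
length-mapᶠ []       f = refl
length-mapᶠ (x ∷ xs) f = cong suc (length-mapᶠ xs f)

length-append : (xs ys : List A) → length (append xs ys) ≡ length xs ℕ.+ length ys
length-append []       ys = refl
length-append (x ∷ xs) ys = cong suc (length-append xs ys)

length->>= : (xs : List A) (f : A → List B) (k : ℕ) → (∀ x → x ∈ xs → length (f x) ℕ.≤ k) →
             length (xs >>=′ f) ℕ.≤ length xs ℕ.* k
length->>= []       f k h = z≤n
length->>= (x ∷ xs) f k h = subst (ℕ._≤ _) (sym (length-append (f x) (xs >>=′ f)))
  (ℕ.+-mono-≤ (h x (here refl)) (length->>= xs f k λ y y∈ → h y (there y∈)))

∈-mapᶠ⁻ : (xs : List A) (f : A → B) {y : B} → y ∈ mapᶠ xs f → ∃[ x ] x ∈ xs × y ≡ f x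
∈-mapᶠ⁻ xs f y∈ = ∈-map⁻ f (subst (_ ∈_) (mapᶠ≡map xs f) y∈)

∈-mapᶠ⁺ : (xs : List A) (f : A → B) {x : A} → x ∈ xs → f x ∈ mapᶠ xs f
∈-mapᶠ⁺ xs f x∈ = subst (_ ∈_) (sym (mapᶠ≡map xs f)) (∈-map⁺ f x∈)

∈->>=⁻ : (xs : List A) (f : A → List B) {y : B} → y ∈ (xs >>=′ f) → ∃[ x ] x ∈ xs × y ∈ f x
∈->>=⁻ (x ∷ xs) f y∈ with ∈-++⁻ (f x) (subst (_ ∈_) (append≡++ (f x) (xs >>=′ f)) y∈)
... | inj₁ p = x , here refl , p
... | inj₂ p with ∈->>=⁻ xs f p
...   | z , z∈ , q = z , there z∈ , q

∈->>=⁺ : (xs : List A) (f : A → List B) {x : A} {y : B} → x ∈ xs → y ∈ f x → y ∈ (xs >>=′ f)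
∈->>=⁺ (x ∷ xs) f (here refl) q = subst (_ ∈_) (sym (append≡++ (f x) (xs >>=′ f))) (∈-++⁺ˡ q)
∈->>=⁺ (x ∷ xs) f (there p)   q = subst (_ ∈_) (sym (append≡++ (f x) (xs >>=′ f))) (∈-++⁺ʳ (f x) (∈->>=⁺ xs f p q))

∈-select⁻ : (xs : List A) (p : A → Bool) {y : A} → y ∈ select xs p → y ∈ xs × p y ≡ true
∈-select⁻ xs p y∈ with ∈->>=⁻ xs (λ x → if p x then x ∷ [] else []) y∈
... | x , x∈ , q with p x in eq
∈-select⁻ xs p y∈ | x , x∈ , here refl | true = x∈ , eq

∈-select⁺ : (xs : List A) (p : A → Bool) {y : A} → y ∈ xs → p y ≡ true → y ∈ select xs p
∈-select⁺ xs p {y} y∈ py = ∈->>=⁺ xs (λ x → if p x then x ∷ [] else []) y∈ (subst (λ b → y ∈ (if b then y ∷ [] else [])) (sym py) (here refl))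

every⁻ : (xs : List A) (p : A → Bool) → every xs p ≡ true → ∀ {x} → x ∈ xs → p x ≡ true
every⁻ (x ∷ xs) p h q with p x in eq
every⁻ (x ∷ xs) p h (here refl) | true = eq
every⁻ (x ∷ xs) p h (there q)   | true = every⁻ xs p h q

every⁺ : (xs : List A) (p : A → Bool) → (∀ {x} → x ∈ xs → p x ≡ true) → every xs p ≡ true
every⁺ []       p h = refl
every⁺ (x ∷ xs) p h rewrite h (here refl) = every⁺ xs p (h ∘ there)

some⁻ : (xs : List A) (p : A → Bool) → some xs p ≡ true → ∃[ x ] x ∈ xs × p x ≡ true
some⁻ (x ∷ xs) p h with p x in eq
... | true  = x , here refl , eq
... | false with some⁻ xs p h
...   | y , y∈ , q = y , there y∈ , q

some⁺ : (xs : List A) (p : A → Bool) {x : A} → x ∈ xs → p x ≡ true → some xs p ≡ true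
some⁺ (x ∷ xs) p (here refl) q rewrite q = refl
some⁺ (x ∷ xs) p (there x∈)  q with p x
... | true  = refl
... | false = some⁺ xs p x∈ q

if-true : {b : Bool} {x y : A} → b ≡ true → (if b then x else y) ≡ x
if-true refl = refl

if-same : (b : Bool) {x : A} → (if b then x else x) ≡ x
if-same true  = refl
if-same false = refl

⇔→≡ : {b c : Bool} → (b ≡ true → c ≡ true) → (c ≡ true → b ≡ true) → b ≡ c
⇔→≡ {true}  {c}     f g = sym (f refl)
⇔→≡ {false} {true}  f g = g refl
⇔→≡ {false} {false} f g = refl

*-exchange : ∀ x y z → x ℕ.* (y ℕ.* z) ≡ y ℕ.* (x ℕ.* z)
*-exchange = solve-∀

module BigSum (𝓒 : CommutativeMonoid 0ℓ 0ℓ) where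
  open CommutativeMonoid 𝓒 renaming (ε to 𝟘; refl to ≈-refl; sym to ≈-sym; trans to ≈-trans)
  open CommutativeSemigroupProperties commutativeSemigroup using (interchange; x∙yz≈y∙xz)
  open SetoidReasoning setoid

  ∑ : {A : Set} → List A → (A → Carrier) → Carrier
  ∑ xs f = foldr (λ x s → f x ∙ s) 𝟘 xs

  ∑-cong : (xs : List A) {f g : A → Carrier} → (∀ x → x ∈ xs → f x ≈ g x) → ∑ xs f ≈ ∑ xs g
  ∑-cong []       h = ≈-refl
  ∑-cong (x ∷ xs) h = ∙-cong (h x (here refl)) (∑-cong xs λ y y∈ → h y (there y∈))

  ∑-𝟘 : (xs : List A) {f : A → Carrier} → (∀ x → x ∈ xs → f x ≈ 𝟘) → ∑ xs f ≈ 𝟘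
  ∑-𝟘 []       h = ≈-refl
  ∑-𝟘 (x ∷ xs) h = ≈-trans (∙-cong (h x (here refl)) (∑-𝟘 xs λ y y∈ → h y (there y∈))) (identityˡ 𝟘)

  ∑-∙ : (xs : List A) (f g : A → Carrier) → ∑ xs (λ x → f x ∙ g x) ≈ ∑ xs f ∙ ∑ xs g
  ∑-∙ []       f g = ≈-sym (identityˡ 𝟘)
  ∑-∙ (x ∷ xs) f g = ≈-trans (∙-cong ≈-refl (∑-∙ xs f g)) (interchange _ _ _ _)

  ∑-swap : (xs : List A) (ys : List B) (f : A → B → Carrier) →
           ∑ xs (λ x → ∑ ys (f x)) ≈ ∑ ys (λ y → ∑ xs (λ x → f x y))
  ∑-swap []       ys f = ≈-sym (∑-𝟘 ys λ _ _ → ≈-refl)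
  ∑-swap (x ∷ xs) ys f = ≈-trans (∙-cong ≈-refl (∑-swap xs ys f)) (≈-sym (∑-∙ ys (f x) _))

  ∑-append : (xs ys : List A) (f : A → Carrier) → ∑ (append xs ys) f ≈ ∑ xs f ∙ ∑ ys f
  ∑-append []       ys f = ≈-sym (identityˡ _)
  ∑-append (x ∷ xs) ys f = ≈-trans (∙-cong ≈-refl (∑-append xs ys f)) (≈-sym (assoc _ _ _))

  ∑->>= : (xs : List A) (k : A → List B) (f : B → Carrier) → ∑ (xs >>=′ k) f ≈ ∑ xs (λ x → ∑ (k x) f)
  ∑->>= []       k f = ≈-refl
  ∑->>= (x ∷ xs) k f = ≈-trans (∑-append (k x) _ f) (∙-cong ≈-refl (∑->>= xs k f))

  ∑-mapᶠ : (xs : List A) (k : A → B) (f : B → Carrier) → ∑ (mapᶠ xs k) f ≈ ∑ xs (f ∘ k)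
  ∑-mapᶠ []       k f = ≈-refl
  ∑-mapᶠ (x ∷ xs) k f = ∙-cong ≈-refl (∑-mapᶠ xs k f)

  ∑-if : (xs : List A) (b : Bool) (f : A → Carrier) →
         ∑ xs (λ x → if b then f x else 𝟘) ≈ (if b then ∑ xs f else 𝟘)
  ∑-if xs true  f = ≈-refl
  ∑-if xs false f = ∑-𝟘 xs λ _ _ → ≈-refl

  ∑-filter : {P : A → Set} (P? : ∀ x → Dec (P x)) (xs : List A) (f : A → Carrier) →
             ∑ (filter P? xs) f ≈ ∑ xs (λ x → if Dec.does (P? x) then f x else 𝟘)
  ∑-filter P? []       f = ≈-refl
  ∑-filter P? (x ∷ xs) f with Dec.does (P? x)
  ... | true  = ∙-cong ≈-refl (∑-filter P? xs f)
  ... | false = ≈-trans (∑-filter P? xs f) (≈-sym (identityˡ _))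

  ∑-↭ : {xs ys : List A} (f : A → Carrier) → xs ↭ ys → ∑ xs f ≈ ∑ ys f
  ∑-↭ f reflᵖ        = ≈-refl
  ∑-↭ f (prep x p)   = ∙-cong ≈-refl (∑-↭ f p)
  ∑-↭ f (swap x y p) = ≈-trans (x∙yz≈y∙xz (f x) (f y) _) (∙-cong ≈-refl (∙-cong ≈-refl (∑-↭ f p)))
  ∑-↭ f (transᵖ p q) = ≈-trans (∑-↭ f p) (∑-↭ f q)

  ∑-indicator : (xs : List A) → Unique xs → {x : A} → x ∈ xs → (p : A → Bool) → p x ≡ true →
                (∀ {y} → y ∈ xs → p y ≡ true → y ≡ x) → (f : A → Carrier) →
                ∑ xs (λ y → if p y then f y else 𝟘) ≈ f x
  ∑-indicator (x ∷ xs) (x∉ ∷ u) (here refl) p px only f rewrite px =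
    ≈-trans (∙-cong ≈-refl (∑-𝟘 xs λ y y∈ → off y y∈)) (identityʳ _)
    where
    off : ∀ y → y ∈ xs → (if p y then f y else 𝟘) ≈ 𝟘
    off y y∈ with p y in eq
    ... | false = ≈-refl
    ... | true  = contradiction (sym (only (there y∈) eq)) (All.lookup x∉ y∈)
  ∑-indicator (z ∷ xs) (z∉ ∷ u) (there x∈) p px only f with p z in eq
  ... | true  = contradiction (only (here refl) eq) (All.lookup z∉ x∈)
  ... | false = ≈-trans (identityˡ _) (∑-indicator xs u x∈ p px (only ∘ there) f)

module _ where
  open BigSum ℕ.+-0-commutativeMonoid

  ∑-mono : (xs : List A) {f g : A → ℕ} → (∀ x → x ∈ xs → f x ℕ.≤ g x) → ∑ xs f ℕ.≤ ∑ xs g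
  ∑-mono []       h = z≤n
  ∑-mono (x ∷ xs) h = ℕ.+-mono-≤ (h x (here refl)) (∑-mono xs λ y y∈ → h y (there y∈))

  *-∑ : (k : ℕ) (xs : List A) (f : A → ℕ) → k ℕ.* ∑ xs f ≡ ∑ xs (λ x → k ℕ.* f x)
  *-∑ k []       f = ℕ.*-zeroʳ k
  *-∑ k (x ∷ xs) f = trans (ℕ.*-distribˡ-+ k (f x) _) (cong (k ℕ.* f x ℕ.+_) (*-∑ k xs f))

  ∑-∈ : (xs : List A) (f : A → ℕ) {x : A} → x ∈ xs → f x ℕ.≤ ∑ xs f
  ∑-∈ (x ∷ xs) f (here refl) = ℕ.m≤m+n (f x) _
  ∑-∈ (x ∷ xs) f (there x∈)  = ℕ.≤-trans (∑-∈ xs f x∈) (ℕ.m≤n+m _ (f x))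

  ∑-const : (xs : List A) (k : ℕ) → ∑ xs (λ _ → k) ≡ length xs ℕ.* k
  ∑-const []       k = refl
  ∑-const (x ∷ xs) k = cong (k ℕ.+_) (∑-const xs k)

-- A timed first-order language

infixr 6 _⊗_

data Type : Set where
  bool real nat mon realFun monFun : Type
  _⊗_  : Type → Type → Type
  list : Type → Type

-- The body of a loop may be cheap only on the accumulators that really occur, so the side condition
-- `P` follows the run of the fold instead of ranging over all accumulators.
data Step {A B : Set} (f : B → A → B) (P : A → B → Set) : List A → B → Set where
  []  : ∀ {y} → Step f P [] y
  _∷_ : ∀ {x xs y} → P x y → Step f P xs (f y x) → Step f P (x ∷ xs) y

Stepʳ : {A B : Set} (f : A → B → B) (P : A → B → Set) (z : B) → List A → Set
Stepʳ f P z []       = ⊤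
Stepʳ f P z (x ∷ xs) = P x (foldr f z xs) × Stepʳ f P z xs

-- Right folds are executed as left folds over the reversed list, but their side conditions are
-- stated along the right fold. This transports the latter to the former.
reverse-Step : {A B : Set} {f : A → B → B} {P : A → B → Set} {z : B} (xs : List A) → Stepʳ f P z xs →
               Step (λ y x → f x y) P (reverse xs) z
reverse-Step {f = f} {P} {z} xs h = go xs [] h []
  where
  go : ∀ xs ys → Stepʳ f P z xs → Step (λ y x → f x y) P ys (foldr f z xs) →
       Step (λ y x → f x y) P (xs ʳ++ ys) z
  go []       ys h       k = k
  go (x ∷ xs) ys (p , h) k = go xs (x ∷ ys) h (p ∷ k)

-- A first-order language of total functions whose only loops are folds.  A
-- program obtained from it is timed by a polynomial in any bound on the
-- lengths of the lists over which it folds.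
module Language {ℜ : CompleteOrderedField} (B : BasicFunctions ℜ) (M : RealCommutativeMonoid ℜ) where
  open CompleteOrderedField ℜ
  open RealCommutativeMonoid M

  Val : Type → Set
  Val bool     = Bool
  Val real     = ℝ
  Val nat      = ℕ
  Val mon      = ∃ R
  Val realFun  = ℝ → ℝ
  Val monFun   = ℝ → ∃ R
  Val (a ⊗ b)  = Val a × Val b
  Val (list a) = List (Val a)

  enc : ∀ a → Val a → Value B
  enc bool     b       = truth B b
  enc real     x       = num x
  enc nat      k       = num (fromℕ k)
  enc mon      x       = num (proj₁ x)
  enc realFun  f       = fun f
  enc monFun   f       = fun (proj₁ ∘ f)
  enc (a ⊗ b)  (x , y) = pair (enc a x) (enc b y)
  enc (list a) xs      = encodeList B M (enc a) xs

  ⟦_⟧ᵀ : Polynomial 1 → ℕ → ℕ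
  ⟦ p ⟧ᵀ s = evaluate p (s ∷ [])

  -- Halting is unconditional; only the bound on the number of steps depends on the condition `C` on
  -- `s`. A program can thus be correct on inputs for which no time bound is claimed.
  record Runs (p : Program B) (v w : Value B) (C : ℕ → Set) (τ : Polynomial 1) : Set where
    constructor runs
    field
      {steps} : ℕ
      halts   : _∶_⇓_∣_ B p v w steps
      bound   : ∀ s → C s → steps ℕ.≤ ⟦ τ ⟧ᵀ s

  Always : ℕ → Set
  Always _ = ⊤

  unit : ∀ {p v w} → _∶_⇓_∣_ B p v w 1 → Runs p v w Always (con 1)
  unit h = runs h λ _ _ → s≤s z≤n

  weaken : ∀ {p v w C D τ} → (∀ s → D s → C s) → Runs p v w C τ → Runs p v w D τ
  weaken f (runs h b) = runs h λ s d → b s (f s d)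

  infixr 5 _⨾ᴿ_

  _⨾ᴿ_ : ∀ {p q u v w C D σ τ} → Runs p u v C σ → Runs q v w D τ →
         Runs (p ⨾ q) u w (λ s → C s × D s) (con 1 :+ (σ :+ τ))
  runs h b ⨾ᴿ runs h′ b′ = runs (seq h h′) λ s (c , d) → s≤s (ℕ.+-mono-≤ (b s c) (b′ s d))

  ⟨_,_⟩ᴿ : ∀ {p q v u w C D σ τ} → Runs p v u C σ → Runs q v w D τ →
           Runs ⟨ p , q ⟩ v (pair u w) (λ s → C s × D s) (con 1 :+ (σ :+ τ))
  ⟨ runs h b , runs h′ b′ ⟩ᴿ = runs (both h h′) λ s (c , d) → s≤s (ℕ.+-mono-≤ (b s c) (b′ s d))

  thenᴿ : ∀ {p q r v c w C D σ τ τ′} → Runs p v c C σ → c ≢ nil → Runs q v w D τ →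
          Runs (ifte p q r) v w (λ s → C s × D s) (con 1 :+ (σ :+ (τ :+ τ′)))
  thenᴿ (runs h b) n (runs h′ b′) = runs (then′ h n h′)
    λ s (c , d) → s≤s (ℕ.+-mono-≤ (b s c) (ℕ.≤-trans (b′ s d) (ℕ.m≤m+n _ _)))

  elseᴿ : ∀ {p q r v w C D σ τ τ′} → Runs p v nil C σ → Runs r v w D τ′ →
          Runs (ifte p q r) v w (λ s → C s × D s) (con 1 :+ (σ :+ (τ :+ τ′)))
  elseᴿ {τ = τ} (runs h b) (runs h′ b′) = runs (else′ h h′)
    λ s (c , d) → s≤s (ℕ.+-mono-≤ (b s c) (ℕ.≤-trans (b′ s d) (ℕ.m≤n+m _ (⟦ τ ⟧ᵀ s))))

  record Routine (a b : Type) : Set₁ where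
    field
      program : Program B
      spec    : Val a → Val b
      Fits    : ℕ → Val a → Set
      time    : Polynomial 1
      correct : ∀ x → Runs program (enc a x) (enc b (spec x)) (λ s → Fits s x) time

  record Literal (b : Type) : Set where
    field
      program : Program B
      val     : Val b
      correct : ∀ v → Runs program v (enc b val) Always (con 3)

  Context : Set
  Context = List Type

  Env : Context → Set
  Env []      = ⊤
  Env (a ∷ Γ) = Val a × Env Γ

  encEnv : ∀ Γ → Env Γ → Value B
  encEnv []      _       = nil
  encEnv (a ∷ Γ) (x , ρ) = pair (enc a x) (encEnv Γ ρ)

  data Term : Context → Type → Set₁ where
    var′   : ∀ {Γ a} → a ∈ Γ → Term Γ a
    lit    : ∀ {Γ a} → Literal a → Term Γ a
    let′   : ∀ {Γ a b} → Term Γ a → Term (a ∷ Γ) b → Term Γ b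
    _,′_   : ∀ {Γ a b} → Term Γ a → Term Γ b → Term Γ (a ⊗ b)
    split  : ∀ {Γ a b c} → Term Γ (a ⊗ b) → Term (a ∷ b ∷ Γ) c → Term Γ c
    call   : ∀ {Γ a b} → Routine a b → Term Γ a → Term Γ b
    if′    : ∀ {Γ a} → Term Γ bool → Term Γ a → Term Γ a → Term Γ a
    case′  : ∀ {Γ a b} → Term Γ (list a) → Term Γ b → Term (a ∷ list a ∷ Γ) b → Term Γ b
    foldl′ : ∀ {Γ a b} → Term (a ∷ b ∷ Γ) b → Term Γ b → Term Γ (list a) → Term Γ b
    foldr′ : ∀ {Γ a b} → Term (a ∷ b ∷ Γ) b → Term Γ b → Term Γ (list a) → Term Γ b
    -- The dropped variable is the accumulator of an enclosing fold; bodies of derived loops such as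
    -- `map′` then need not account for it.
    omit₁  : ∀ {Γ a b c} → Term (a ∷ Γ) c → Term (a ∷ b ∷ Γ) c

  infixr 4 _,′_

  valueOf : ∀ {Γ a} → a ∈ Γ → Env Γ → Val a
  valueOf (here refl) (x , ρ) = x
  valueOf (there i)   (x , ρ) = valueOf i ρ

  eval : ∀ {Γ a} → Term Γ a → Env Γ → Val a
  eval (var′ i)       ρ = valueOf i ρ
  eval (lit l)        ρ = Literal.val l
  eval (let′ t u)     ρ = eval u (eval t ρ , ρ)
  eval (t ,′ u)       ρ = eval t ρ , eval u ρ
  eval (split t u)    ρ = eval u (proj₁ (eval t ρ) , proj₂ (eval t ρ) , ρ)
  eval (call f t)     ρ = Routine.spec f (eval t ρ)
  eval (if′ t u v)    ρ = if eval t ρ then eval u ρ else eval v ρ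
  eval (case′ t u v)  ρ = caseList (eval t ρ) (eval u ρ) (λ x xs → eval v (x , xs , ρ))
  eval (foldl′ t u v) ρ = foldl (λ y x → eval t (x , y , ρ)) (eval u ρ) (eval v ρ)
  eval (foldr′ t u v) ρ = foldr (λ x y → eval t (x , y , ρ)) (eval u ρ) (eval v ρ)
  eval (omit₁ t) (x , y , ρ) = eval t (x , ρ)

  -- One number `s` has to bound the length of every list over which a fold runs. Only branches that
  -- are actually taken impose conditions, which later excuses the slow branch of `reduceᴿ`.
  fits : ∀ {Γ a} → Term Γ a → ℕ → Env Γ → Set
  fits (var′ i)       s ρ = ⊤
  fits (lit l)        s ρ = ⊤
  fits (let′ t u)     s ρ = fits t s ρ × fits u s (eval t ρ , ρ)
  fits (t ,′ u)       s ρ = fits t s ρ × fits u s ρ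
  fits (split t u)    s ρ = fits t s ρ × fits u s (proj₁ (eval t ρ) , proj₂ (eval t ρ) , ρ)
  fits (call f t)     s ρ = fits t s ρ × Routine.Fits f s (eval t ρ)
  fits (if′ t u v)    s ρ = fits t s ρ × (if eval t ρ then fits u s ρ else fits v s ρ)
  fits (case′ t u v)  s ρ = fits t s ρ × caseList (eval t ρ) (fits u s ρ) (λ x xs → fits v s (x , xs , ρ))
  fits (foldl′ t u v) s ρ = fits u s ρ × fits v s ρ × length (eval v ρ) ℕ.≤ s ×
    Step (λ y x → eval t (x , y , ρ)) (λ x y → fits t s (x , y , ρ)) (eval v ρ) (eval u ρ)
  fits (foldr′ t u v) s ρ = fits u s ρ × fits v s ρ × length (eval v ρ) ℕ.≤ s ×
    Stepʳ (λ x y → eval t (x , y , ρ)) (λ x y → fits t s (x , y , ρ)) (eval u ρ) (eval v ρ)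
  fits (omit₁ t) s (x , y , ρ) = fits t s (x , ρ)

  position : ∀ {Γ} {a : Type} → a ∈ Γ → Program B
  position (here _)  = left
  position (there i) = right ⨾ position i

  -- The store is `((list, accumulator), environment)`. The code of a list is `nil` exactly when the
  -- list is empty, so `left ⨾ left` is the loop test.
  iterate : Program B → Program B
  iterate p = while (left ⨾ left)
    ⟨ ⟨ left ⨾ left ⨾ right , ⟨ left ⨾ left ⨾ left , ⟨ left ⨾ right , right ⟩ ⟩ ⨾ p ⟩ , right ⟩

  compile : ∀ {Γ a} → Term Γ a → Program B
  compile (var′ i)       = position i
  compile (lit l)        = Literal.program l
  compile (let′ t u)     = ⟨ compile t , skip ⟩ ⨾ compile u
  compile (t ,′ u)       = ⟨ compile t , compile u ⟩
  compile (split t u)    = ⟨ compile t , skip ⟩ ⨾ ⟨ left ⨾ left , ⟨ left ⨾ right , right ⟩ ⟩ ⨾ compile u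
  compile (call f t)     = compile t ⨾ Routine.program f
  compile (if′ t u v)    = ifte (compile t) (compile u) (compile v)
  compile (case′ t u v)  = ⟨ compile t , skip ⟩ ⨾
    ifte left (⟨ left ⨾ left , ⟨ left ⨾ right , right ⟩ ⟩ ⨾ compile v) (right ⨾ compile u)
  compile (foldl′ t u v) = ⟨ ⟨ compile v , compile u ⟩ , skip ⟩ ⨾ iterate (compile t) ⨾ left ⨾ right
  -- A list is accessible only at its head, so a first loop reverses it; the second loop is then a
  -- left fold.
  compile (foldr′ t u v) =
    ⟨ ⟨ ⟨ ⟨ compile v , mkNil ⟩ , mkNil ⟩ ⨾ iterate ⟨ left , right ⨾ left ⟩ ⨾ left ⨾ right , compile u ⟩ , skip ⟩ ⨾
    iterate (compile t) ⨾ left ⨾ right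
  compile (omit₁ t)      = ⟨ left , right ⨾ right ⟩ ⨾ compile t

  -- The last, failing test takes 4 steps. Each round spends 24 steps on testing and on repacking
  -- the store, besides the time `τ` of the body.
  loopTime : Polynomial 1 → Polynomial 1
  loopTime τ = con 4 :+ var zero :* (con 24 :+ τ)

  positionTime : ∀ {Γ} {a : Type} → a ∈ Γ → Polynomial 1
  positionTime (here _)  = con 1
  positionTime (there i) = con 1 :+ (con 1 :+ positionTime i)

  time : ∀ {Γ a} → Term Γ a → Polynomial 1
  time (var′ i)       = positionTime i
  time (lit l)        = con 3
  time (let′ t u)     = con 1 :+ ((con 1 :+ (time t :+ con 1)) :+ time u)
  time (t ,′ u)       = con 1 :+ (time t :+ time u)
  time (split t u)    = con 1 :+ ((con 1 :+ (time t :+ con 1)) :+ (con 1 :+ (con 9 :+ time u)))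
  time (call f t)     = con 1 :+ (time t :+ Routine.time f)
  time (if′ t u v)    = con 1 :+ (time t :+ (time u :+ time v))
  time (case′ t u v)  = con 1 :+ ((con 1 :+ (time t :+ con 1)) :+
    (con 1 :+ (con 1 :+ ((con 1 :+ (con 9 :+ time v)) :+ (con 1 :+ (con 1 :+ time u))))))
  time (foldl′ t u v) = con 1 :+ ((con 1 :+ ((con 1 :+ (time v :+ time u)) :+ con 1)) :+
    (con 1 :+ (loopTime (time t) :+ con 3)))
  time (foldr′ t u v) = con 1 :+ ((con 1 :+ ((con 1 :+
    ((con 1 :+ ((con 1 :+ ((con 1 :+ (time v :+ con 1)) :+ con 1)) :+ (con 1 :+ (loopTime (con 5) :+ con 3))))
      :+ time u)) :+ con 1)) :+
    (con 1 :+ (loopTime (time t) :+ con 3)))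
  time (omit₁ t)      = con 1 :+ (con 5 :+ time t)

  module _ {a b : Type} {p : Program B} {v : Value B} {τ : Polynomial 1}
           (f : Val b → Val a → Val b) (P : ℕ → Val a → Val b → Set)
           (body : ∀ x y → Runs p (pair (enc a x) (pair (enc b y) v)) (enc b (f y x)) (λ s → P s x y) τ)
           where

    private
      state : List (Val a) → Val b → Value B
      state xs y = pair (pair (enc (list a) xs) (enc b y)) v

      loop-steps : ∀ xs y → ∃[ t ] _∶_⇓_∣_ B (iterate p) (state xs y) (state [] (foldl f y xs)) t ×
                   (∀ s → Step f (P s) xs y → t ℕ.≤ 4 ℕ.+ length xs ℕ.* (24 ℕ.+ ⟦ τ ⟧ᵀ s))
      loop-steps []       y = _ , stop (seq left left) , λ _ _ → ℕ.≤-refl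
      loop-steps (x ∷ xs) y with body x y | loop-steps xs (f y x)
      ... | runs h b | t , h′ , b′ = _ ,
        loop (seq left left) (λ ())
          (both (both (seq left (seq left right))
                      (seq (both (seq left (seq left left)) (both (seq left right) right)) h)) right) h′ ,
        λ { s (q ∷ qs) → cost (b s q) (b′ s qs) }
        where
        collect : ∀ t u → suc (3 ℕ.+ suc (suc (5 ℕ.+ suc (11 ℕ.+ t)) ℕ.+ 1) ℕ.+ u) ≡ 24 ℕ.+ (t ℕ.+ u)
        collect = solve-∀

        redistribute : ∀ n l → 24 ℕ.+ (n ℕ.+ (4 ℕ.+ l)) ≡ 4 ℕ.+ (24 ℕ.+ n ℕ.+ l)
        redistribute = solve-∀

        cost : ∀ {t₁ t₂ n l} → t₁ ℕ.≤ n → t₂ ℕ.≤ 4 ℕ.+ l →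
               suc (3 ℕ.+ suc (suc (5 ℕ.+ suc (11 ℕ.+ t₁)) ℕ.+ 1) ℕ.+ t₂) ℕ.≤ 4 ℕ.+ (24 ℕ.+ n ℕ.+ l)
        cost {t₁} {t₂} {n} {l} p q = begin
          suc (3 ℕ.+ suc (suc (5 ℕ.+ suc (11 ℕ.+ t₁)) ℕ.+ 1) ℕ.+ t₂) ≡⟨ collect t₁ t₂ ⟩
          24 ℕ.+ (t₁ ℕ.+ t₂)        ≤⟨ ℕ.+-monoʳ-≤ 24 (ℕ.+-mono-≤ p q) ⟩
          24 ℕ.+ (n ℕ.+ (4 ℕ.+ l))  ≡⟨ redistribute n l ⟩
          4 ℕ.+ (24 ℕ.+ n ℕ.+ l)    ∎
          where open ℕ.≤-Reasoning

    loop-runs : ∀ xs y → Runs (iterate p) (state xs y) (state [] (foldl f y xs))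
                (λ s → length xs ℕ.≤ s × Step f (P s) xs y) (loopTime τ)
    loop-runs xs y with loop-steps xs y
    ... | t , h , b = runs h λ s (l , q) → ℕ.≤-trans (b s q) (ℕ.+-monoʳ-≤ 4 (ℕ.*-monoˡ-≤ _ l))

  private
    skipᴿ : ∀ {v} → Runs skip v v Always (con 1)
    skipᴿ = unit skip

    leftᴿ : ∀ {u v} → Runs left (pair u v) u Always (con 1)
    leftᴿ = unit left

    rightᴿ : ∀ {u v} → Runs right (pair u v) v Always (con 1)
    rightᴿ = unit right

    mkNilᴿ : ∀ {v} → Runs mkNil v nil Always (con 1)
    mkNilᴿ = unit mkNil

    unpackᴿ : ∀ {u v w} → Runs ⟨ left ⨾ left , ⟨ left ⨾ right , right ⟩ ⟩ (pair (pair u v) w) (pair u (pair v w))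
              Always (con 9)
    unpackᴿ = runs (both (seq left left) (both (seq left right) right)) λ _ _ → ℕ.≤-refl

    resultᴿ : ∀ {u v w} → Runs (left ⨾ right) (pair (pair u v) w) v Always (con 3)
    resultᴿ = runs (seq left right) λ _ _ → ℕ.≤-refl

    consᴿ : ∀ {u v w} → Runs ⟨ left , right ⨾ left ⟩ (pair u (pair v w)) (pair u v) Always (con 5)
    consᴿ = runs (both left (seq right left)) λ _ _ → ℕ.≤-refl

    position-runs : ∀ {Γ a} (i : a ∈ Γ) ρ → Runs (position i) (encEnv Γ ρ) (enc a (valueOf i ρ)) Always (positionTime i)
    position-runs (here refl) ρ = leftᴿ
    position-runs (there i)   ρ = weaken (λ _ _ → tt , tt) (rightᴿ ⨾ᴿ position-runs i (proj₂ ρ))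

    foldl-reverse : ∀ {X Y : Set} (f : X → Y → Y) z xs → foldl (λ y x → f x y) z (reverse xs) ≡ foldr f z xs
    foldl-reverse f z xs = List.reverse-foldl (λ y x → f x y) z xs

    steps-cons : ∀ {X : Set} (xs ys : List X) → Step (flip _∷_) (λ _ _ → ⊤) xs ys
    steps-cons []       ys = []
    steps-cons (x ∷ xs) ys = tt ∷ steps-cons xs (x ∷ ys)

  compile-runs : ∀ {Γ a} (t : Term Γ a) ρ →
                 Runs (compile t) (encEnv Γ ρ) (enc a (eval t ρ)) (λ s → fits t s ρ) (time t)
  compile-runs (var′ i)      ρ = position-runs i ρ
  compile-runs (lit l)       ρ = Literal.correct l _
  compile-runs (let′ t u)    ρ = weaken (λ _ (p , q) → (p , tt) , q)
    (⟨ compile-runs t ρ , skipᴿ ⟩ᴿ ⨾ᴿ compile-runs u _)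
  compile-runs (t ,′ u)      ρ = ⟨ compile-runs t ρ , compile-runs u ρ ⟩ᴿ
  compile-runs (split t u)   ρ = weaken (λ _ (p , q) → (p , tt) , tt , q)
    (⟨ compile-runs t ρ , skipᴿ ⟩ᴿ ⨾ᴿ unpackᴿ ⨾ᴿ compile-runs u _)
  compile-runs (call f t)    ρ = compile-runs t ρ ⨾ᴿ Routine.correct f _
  compile-runs (if′ t u v)   ρ with eval t ρ | compile-runs t ρ
  ... | true  | r = thenᴿ r (λ ()) (compile-runs u ρ)
  ... | false | r = elseᴿ {τ = time u} r (compile-runs v ρ)
  compile-runs (case′ t u v) ρ with eval t ρ | compile-runs t ρ
  ... | []     | r = weaken (λ _ (p , q) → (p , tt) , tt , tt , q)
    (⟨ r , skipᴿ ⟩ᴿ ⨾ᴿ elseᴿ {τ = con 1 :+ (con 9 :+ time v)} leftᴿ (rightᴿ ⨾ᴿ compile-runs u ρ))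
  ... | x ∷ xs | r = weaken (λ _ (p , q) → (p , tt) , tt , tt , q)
    (⟨ r , skipᴿ ⟩ᴿ ⨾ᴿ thenᴿ {τ′ = con 1 :+ (con 1 :+ time u)} leftᴿ (λ ()) (unpackᴿ ⨾ᴿ compile-runs v (x , xs , ρ)))
  compile-runs (foldl′ {a = a} {b} t u v) ρ = weaken (λ _ (p , q , l , h) → ((q , p) , tt) , (l , h) , tt)
    (⟨ ⟨ compile-runs v ρ , compile-runs u ρ ⟩ᴿ , skipᴿ ⟩ᴿ ⨾ᴿ
     loop-runs {a = a} {b} _ (λ s x y → fits t s (x , y , ρ)) (λ x y → compile-runs t (x , y , ρ)) (eval v ρ) (eval u ρ) ⨾ᴿ
     resultᴿ)
  compile-runs (foldr′ {Γ} {a} {b} t u v) ρ =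
    subst (λ y → Runs (compile (foldr′ t u v)) (encEnv Γ ρ) (enc b y) (λ s → fits (foldr′ t u v) s ρ) (time (foldr′ t u v)))
      (foldl-reverse (λ x y → eval t (x , y , ρ)) (eval u ρ) (eval v ρ))
      (weaken (λ s (p , q , l , h) →
          (((((q , tt) , tt) , (l , steps-cons (eval v ρ) []) , tt) , p) , tt) ,
          (subst (ℕ._≤ s) (sym (List.length-reverse (eval v ρ))) l , reverse-Step (eval v ρ) h) , tt)
        (⟨ ⟨ ⟨ ⟨ compile-runs v ρ , mkNilᴿ ⟩ᴿ , mkNilᴿ ⟩ᴿ ⨾ᴿ
             loop-runs {a = a} {list a} (flip _∷_) (λ _ _ _ → ⊤) (λ _ _ → consᴿ) (eval v ρ) [] ⨾ᴿ resultᴿ ,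
           compile-runs u ρ ⟩ᴿ , skipᴿ ⟩ᴿ ⨾ᴿ
         loop-runs {a = a} {b} (λ y x → eval t (x , y , ρ)) (λ s x y → fits t s (x , y , ρ))
           (λ x y → compile-runs t (x , y , ρ)) (reverse (eval v ρ)) (eval u ρ) ⨾ᴿ
         resultᴿ))
  compile-runs (omit₁ t) (x , y , ρ) = weaken (λ _ p → tt , p)
    (runs (both left (seq right right)) (λ _ _ → ℕ.≤-refl) ⨾ᴿ compile-runs t (x , ρ))

  -- The term is hidden behind a function `f` that it denotes and a convenient condition `F` that
  -- suffices for its cost, so that later proofs never unfold it. The argument is paired with an
  -- empty environment.
  routine : ∀ {a b} (t : Term (a ∷ []) b) (f : Val a → Val b) → (∀ x → eval t (x , tt) ≡ f x) →
            (F : ℕ → Val a → Set) → (∀ s x → F s x → fits t s (x , tt)) → Routine a b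
  routine {a} {b} t f eq F h = record
    { program = ⟨ skip , mkNil ⟩ ⨾ compile t
    ; spec    = f
    ; Fits    = F
    ; time    = con 1 :+ (con 3 :+ time t)
    ; correct = λ x → subst (λ y → Runs (⟨ skip , mkNil ⟩ ⨾ compile t) (enc a x) (enc b y) (λ s → F s x) (con 1 :+ (con 3 :+ time t)))
        (eq x) (weaken (λ s p → tt , h s x p)
          (runs {C = Always} (both skip mkNil) (λ _ _ → ℕ.≤-refl) ⨾ᴿ compile-runs t (x , tt)))
    }

-- Real arithmetic

module RealArithmetic (ℜ : CompleteOrderedField) where
  open CompleteOrderedField ℜ
  open CommutativeRing commutativeRing using (ring; +-assoc; +-comm; +-identityˡ; +-identityʳ; *-assoc; *-comm; *-identityˡ; *-identityʳ; distribˡ; distribʳ; zeroˡ; zeroʳ; -‿inverseʳ; -‿inverseˡ)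
  open RingProperties ring using (-‿distribˡ-*; -‿involutive)
  open IsDecTotalOrder isDecTotalOrder using (total; antisym)
    renaming (refl to ≤-refl; trans to ≤-trans; reflexive to ≤-reflexive)

  ≰⇒≥ : ∀ {x y} → ¬ (x ≤ y) → y ≤ x
  ≰⇒≥ {x} {y} x≰y = [ (λ x≤y → contradiction x≤y x≰y) , id ]′ (total x y)

  +-monoʳ-≤ : ∀ {x y} z → x ≤ y → z + x ≤ z + y
  +-monoʳ-≤ {x} {y} z x≤y = subst₂ _≤_ (+-comm x z) (+-comm y z) (+-monoˡ-≤ z x≤y)

  +-mono-≤ : ∀ {u v x y} → u ≤ v → x ≤ y → u + x ≤ v + y
  +-mono-≤ {v = v} {x} u≤v x≤y = ≤-trans (+-monoˡ-≤ x u≤v) (+-monoʳ-≤ v x≤y)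

  +-cancelˡ-≤ : ∀ {x y} z → z + x ≤ z + y → x ≤ y
  +-cancelˡ-≤ {x} {y} z h = subst₂ _≤_ (undo x) (undo y) (+-monoʳ-≤ (- z) h)
    where
    undo : ∀ w → - z + (z + w) ≡ w
    undo w = trans (sym (+-assoc (- z) z w)) (trans (cong (_+ w) (-‿inverseˡ z)) (+-identityˡ w))

  +-cancel-minus : ∀ x z → (x + z) - z ≡ x
  +-cancel-minus x z = trans (+-assoc x z (- z)) (trans (cong (x +_) (-‿inverseʳ z)) (+-identityʳ x))

  0≤y-x : ∀ {x y} → x ≤ y → 0# ≤ y - x
  0≤y-x {x} {y} x≤y = subst (_≤ y - x) (-‿inverseʳ x) (+-monoˡ-≤ (- x) x≤y)

  *-monoˡ-≤ : ∀ {x y z} → 0# ≤ z → x ≤ y → z * x ≤ z * y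
  *-monoˡ-≤ {x} {y} {z} 0≤z x≤y = subst₂ _≤_ (+-identityˡ (z * x)) restore (+-monoˡ-≤ (z * x) (*-nonneg 0≤z (0≤y-x x≤y)))
    where
    restore : z * (y - x) + z * x ≡ z * y
    restore = trans (sym (distribˡ z (y - x) x)) (cong (z *_)
      (trans (+-assoc y (- x) x) (trans (cong (y +_) (-‿inverseˡ x)) (+-identityʳ y))))

  *-monoʳ-≤ : ∀ {x y z} → 0# ≤ z → x ≤ y → x * z ≤ y * z
  *-monoʳ-≤ {x} {y} {z} 0≤z x≤y = subst₂ _≤_ (*-comm z x) (*-comm z y) (*-monoˡ-≤ 0≤z x≤y)

  0≤-x : ∀ {x} → x ≤ 0# → 0# ≤ - x
  0≤-x {x} h = subst (0# ≤_) (+-identityˡ (- x)) (0≤y-x h)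

  0≤1 : 0# ≤ 1#
  0≤1 = [ id , (λ 1≤0 → subst (0# ≤_) square (*-nonneg (0≤-x 1≤0) (0≤-x 1≤0))) ]′ (total 0# 1#)
    where
    square : (- 1#) * (- 1#) ≡ 1#
    square = trans (sym (-‿distribˡ-* 1# (- 1#))) (trans (cong -_ (*-identityˡ (- 1#))) (-‿involutive 1#))

  1≰0 : ¬ (1# ≤ 0#)
  1≰0 1≤0 = 0≢1 (antisym 0≤1 1≤0)

  ⁻¹-nonneg : ∀ {x} → 0# ≤ x → x ≢ 0# → 0# ≤ x ⁻¹
  ⁻¹-nonneg {x} 0≤x x≢0 = [ id , (λ x⁻¹≤0 → contradiction (1≤0 x⁻¹≤0) 1≰0) ]′ (total 0# (x ⁻¹))
    where
    1≤0 : x ⁻¹ ≤ 0# → 1# ≤ 0#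
    1≤0 h = subst₂ _≤_ (*-inverseʳ x x≢0) (zeroʳ x) (*-monoˡ-≤ 0≤x h)

  fromℕ-+ : ∀ a b → fromℕ (a ℕ.+ b) ≡ fromℕ a + fromℕ b
  fromℕ-+ zero    b = sym (+-identityˡ _)
  fromℕ-+ (suc a) b = trans (cong (1# +_) (fromℕ-+ a b)) (sym (+-assoc _ _ _))

  fromℕ-* : ∀ a b → fromℕ (a ℕ.* b) ≡ fromℕ a * fromℕ b
  fromℕ-* zero    b = sym (zeroˡ _)
  fromℕ-* (suc a) b = trans (fromℕ-+ b (a ℕ.* b))
    (trans (cong₂ _+_ (sym (*-identityˡ _)) (fromℕ-* a b)) (sym (distribʳ _ _ _)))

  fromℕ-nonneg : ∀ a → 0# ≤ fromℕ a
  fromℕ-nonneg zero    = ≤-refl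
  fromℕ-nonneg (suc a) = subst (_≤ 1# + fromℕ a) (+-identityˡ 0#) (+-mono-≤ 0≤1 (fromℕ-nonneg a))

  fromℕ-mono : ∀ {a b} → a ℕ.≤ b → fromℕ a ≤ fromℕ b
  fromℕ-mono {b = b} z≤n = fromℕ-nonneg b
  fromℕ-mono (s≤s h)     = +-monoʳ-≤ 1# (fromℕ-mono h)

  fromℕ-reflect : ∀ {a b} → fromℕ a ≤ fromℕ b → a ℕ.≤ b
  fromℕ-reflect {zero}          h = z≤n
  fromℕ-reflect {suc a} {zero}  h = contradiction
    (≤-trans (subst (_≤ fromℕ (suc a)) (+-identityʳ 1#) (+-monoʳ-≤ 1# (fromℕ-nonneg a))) h) 1≰0
  fromℕ-reflect {suc a} {suc b} h = s≤s (fromℕ-reflect {a} {b} (+-cancelˡ-≤ 1# h))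

  fromℕ-≤ᵇ : ∀ a b → Dec.does (fromℕ a ≤? fromℕ b) ≡ (a ℕ.≤ᵇ b)
  fromℕ-≤ᵇ a b with a ℕ.≤ᵇ b in eq
  ... | true  = dec-true (fromℕ a ≤? fromℕ b) (fromℕ-mono {a} {b} (ℕ.≤ᵇ⇒≤ a b (subst T (sym eq) tt)))
  ... | false = dec-false (fromℕ a ≤? fromℕ b) λ h → subst T eq (ℕ.≤⇒≤ᵇ (fromℕ-reflect {a} {b} h))

  fromℕ-∸ : ∀ {a b} → b ℕ.≤ a → fromℕ (a ℕ.∸ b) ≡ fromℕ a - fromℕ b
  fromℕ-∸ {a} {b} b≤a = begin
    fromℕ (a ℕ.∸ b)                        ≡⟨ sym (+-cancel-minus _ (fromℕ b)) ⟩
    fromℕ (a ℕ.∸ b) + fromℕ b - fromℕ b    ≡⟨ cong (_- fromℕ b) (sym (fromℕ-+ (a ℕ.∸ b) b)) ⟩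
    fromℕ (a ℕ.∸ b ℕ.+ b) - fromℕ b        ≡⟨ cong (λ c → fromℕ c - fromℕ b) (ℕ.m∸n+n≡m b≤a) ⟩
    fromℕ a - fromℕ b                      ∎
    where open ≡-Reasoning

  s-1<s : ∀ s → s - 1# < s
  s-1<s s s≤s-1 = 1≰0 (+-cancelˡ-≤ s (subst₂ _≤_ refl eq (+-monoˡ-≤ 1# s≤s-1)))
    where
    eq : (s - 1#) + 1# ≡ s + 0#
    eq = trans (+-assoc s (- 1#) 1#) (cong (s +_) (-‿inverseˡ 1#))

  -- Let s be the supremum of the naturals that are at most x. Some such k exceeds s - 1; if k + 1
  -- were still at most x, it would be at most s, a contradiction.
  archimedean : ∀ x → 0# ≤ x → ∃[ k ] x ≤ fromℕ k
  archimedean x 0≤x = beyond (proj₂ supremum)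
    where
    P : ℝ → Set
    P y = ∃[ k ] y ≡ fromℕ k × fromℕ k ≤ x

    supremum : ∃ (Supremum P)
    supremum = complete P (0# , 0 , refl , 0≤x) (x , λ { _ (k , refl , k≤x) → k≤x })

    beyond : ∀ {s} → Supremum P s → ∃[ k ] x ≤ fromℕ k
    beyond {s} (above , approached) with approached (s - 1#) (s-1<s s)
    ... | _ , (k , refl , k≤x) , s-1<k = suc k , ≰⇒≥ λ k+1≤x →
      s-1<k (subst (_≤ s - 1#) (+-cancel-minus (fromℕ k) 1#)
        (+-monoˡ-≤ (- 1#) (≤-trans (≤-reflexive (+-comm (fromℕ k) 1#)) (above _ (suc k , refl , k+1≤x)))))

  1+-nonneg : ∀ {ε} → 0# ≤ ε → 0# ≤ 1# + ε
  1+-nonneg {ε} 0≤ε = subst (_≤ 1# + ε) (+-identityˡ 0#) (+-mono-≤ 0≤1 0≤ε)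

  1+-nonzero : ∀ {ε} → 0# ≤ ε → 1# + ε ≢ 0#
  1+-nonzero {ε} 0≤ε eq = 1≰0 (subst₂ _≤_ (+-identityʳ 1#) eq (+-monoʳ-≤ 1# 0≤ε))

  ≤-/ : ∀ {x y ε} → 0# ≤ ε → x ≤ y * (1# + ε) → x / (1# + ε) ≤ y
  ≤-/ {x} {y} {ε} 0≤ε h = subst (x / (1# + ε) ≤_) cancel (*-monoʳ-≤ (⁻¹-nonneg (1+-nonneg 0≤ε) (1+-nonzero 0≤ε)) h)
    where
    cancel : (y * (1# + ε)) / (1# + ε) ≡ y
    cancel = trans (*-assoc y _ _) (trans (cong (y *_) (*-inverseʳ _ (1+-nonzero 0≤ε))) (*-identityʳ y))

  ≈-refl-nonneg : ∀ {x ε} → 0# ≤ ε → 0# ≤ x → x ≈[ ε ] x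
  ≈-refl-nonneg {x} {ε} 0≤ε 0≤x =
    ≤-/ 0≤ε (≤-trans grow (≤-reflexive (*-comm (1# + ε) x))) , grow
    where
    grow : x ≤ (1# + ε) * x
    grow = ≤-trans (≤-reflexive (sym (*-identityˡ x)))
      (*-monoʳ-≤ 0≤x (subst (_≤ 1# + ε) (+-identityʳ 1#) (+-monoʳ-≤ 1# 0≤ε)))

  -- Replaces the real tolerance by the rational 1/e, which is at most ε, so that errors can be
  -- tracked in ℕ alone.
  scale : ∀ {ε} → 0# < ε → ∃[ e ] 1# ≤ ε * fromℕ e
  scale {ε} 0<ε = proj₁ large , subst (_≤ ε * fromℕ (proj₁ large)) (*-inverseʳ ε ε≢0) (*-monoˡ-≤ 0≤ε (proj₂ large))
    where
    0≤ε : 0# ≤ ε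
    0≤ε = ≰⇒≥ 0<ε
    ε≢0 : ε ≢ 0#
    ε≢0 eq = 0<ε (≤-reflexive eq)
    large : ∃[ e ] ε ⁻¹ ≤ fromℕ e
    large = archimedean (ε ⁻¹) (⁻¹-nonneg 0≤ε ε≢0)

  -- For `i = k ∸ k′` the last hypothesis amounts to `e * i ≤ k′`, whence `i ≤ ε * e * i ≤ ε * k′`.
  -- The other inequality is immediate from `k′ ≤ k`.
  fromℕ-≈ : ∀ {ε e k k′} → 0# ≤ ε → 1# ≤ ε * fromℕ e → k′ ℕ.≤ k → e ℕ.* k ℕ.≤ suc e ℕ.* k′ → fromℕ k ≈[ ε ] fromℕ k′
  fromℕ-≈ {ε} {e} {k} {k′} 0≤ε 1≤εe k′≤k ek≤ = ≤-/ 0≤ε upper ,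
    ≤-trans (fromℕ-mono k′≤k) (proj₂ (≈-refl-nonneg 0≤ε (fromℕ-nonneg k)))
    where
    i = k ℕ.∸ k′
    k≡ : k ≡ k′ ℕ.+ i
    k≡ = sym (ℕ.m+[n∸m]≡n k′≤k)
    ei≤k′ : e ℕ.* i ℕ.≤ k′
    ei≤k′ = ℕ.+-cancelˡ-≤ (e ℕ.* k′) _ _
      (subst₂ ℕ._≤_ (trans (cong (e ℕ.*_) k≡) (ℕ.*-distribˡ-+ e k′ i)) (ℕ.+-comm k′ (e ℕ.* k′)) ek≤)
    i≤ : fromℕ i ≤ ε * fromℕ k′
    i≤ = ≤-trans (≤-reflexive (sym (*-identityˡ _))) (≤-trans (*-monoʳ-≤ (fromℕ-nonneg i) 1≤εe)
      (≤-trans (≤-reflexive (trans (*-assoc ε _ _) (cong (ε *_) (sym (fromℕ-* e i)))))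
        (*-monoˡ-≤ 0≤ε (fromℕ-mono ei≤k′))))
    upper : fromℕ k ≤ fromℕ k′ * (1# + ε)
    upper = ≤-trans (≤-reflexive (trans (cong fromℕ k≡) (fromℕ-+ k′ i)))
      (≤-trans (+-monoʳ-≤ (fromℕ k′) i≤)
        (≤-reflexive (trans (cong₂ _+_ (sym (*-identityʳ _)) (*-comm ε _)) (sym (distribˡ (fromℕ k′) 1# ε)))))

-- The approximation algorithm

module Algorithm {ℜ : CompleteOrderedField} (M : RealCommutativeMonoid ℜ) where
  open CompleteOrderedField ℜ
  open RealCommutativeMonoid M

  -- Rows and sketches are association lists: a row maps column keys to
  -- entries, and a sketch is a multiset of reals given by multiplicities.
  Row Sketch : Set
  Row    = List (ℕ × ℝ)
  Sketch = List (ℝ × ℕ)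

  SketchedTable PreparedTable : Set
  SketchedTable = List ℕ × List (Row × Sketch)
  PreparedTable = List ℕ × List (Row × (ℝ × ∃ R))

  Functions : Set
  Functions = (ℝ → ℝ) × (ℝ → ∃ R)

  infix 4 _≤ᴿ_

  _≤ᴿ_ : ℝ → ℝ → Bool
  x ≤ᴿ y = Dec.does (x ≤? y)

  sameKey : ℕ × ℕ → Bool
  sameKey (k , l) = if k ℕ.≤ᵇ l then l ℕ.≤ᵇ k else false

  sameReal : ℝ × ℝ → Bool
  sameReal (x , y) = if x ≤ᴿ y then y ≤ᴿ x else false

  consistent : Row × Row → Bool
  consistent (r , s) = every r λ e → every s λ e′ →
    if sameKey (proj₁ e , proj₁ e′) then sameReal (proj₂ e , proj₂ e′) else true

  hasKey : ℕ × List ℕ → Bool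
  hasKey (k , ks) = some ks λ l → sameKey (k , l)

  -- A fold does not show the tail of the list to its body, so the accumulator rebuilds that tail as
  -- its first component.
  selections : {A : Set} → List A → List (A × List A)
  selections xs = proj₂ (foldr (λ x s →
    (x ∷ proj₁ s , (x , proj₁ s) ∷ mapᶠ (proj₂ s) (λ p → proj₁ p , x ∷ proj₂ p))) ([] , []) xs)

  pairs : {A : Set} → List A → List (A × (A × List A))
  pairs xs = selections xs >>=′ λ p → mapᶠ (selections (proj₂ p)) λ q → proj₁ p , q

  isEar : SketchedTable × (SketchedTable × List SketchedTable) → Bool
  isEar (x , (y , zs)) = every zs λ z → every (proj₁ x) λ k →
    if hasKey (k , proj₁ z) then hasKey (k , proj₁ y) else true

  -- Convolution of multisets: the values add up and the multiplicities multiply.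
  times : Sketch × Sketch → Sketch
  times (S , S′) = S >>=′ λ a → mapᶠ S′ λ b → proj₁ a + proj₁ b , proj₂ a ℕ.* proj₂ b

  -- Insertion as a fold: the new entry starts at the far end and moves forward past smaller
  -- entries.
  insert : (ℝ × ℕ) × Sketch → Sketch
  insert (e , S) = foldr (λ y acc → caseList acc (y ∷ []) λ h t →
    if proj₁ h ≤ᴿ proj₁ y then y ∷ h ∷ t else h ∷ y ∷ t) (e ∷ []) S

  -- The order is descending, because the right fold in `compress` starts at the end of the list and
  -- has to meet the smallest reals first.
  sort : Sketch → Sketch
  sort S = foldr (λ e acc → insert (e , acc)) [] S

  -- The state is the multiplicity read so far, the multiplicity emitted so
  -- far and the output; an entry is emitted once the former exceeds
  -- (1 + 1/N) times the latter.
  thin : ℕ × (ℝ × ℕ) → ℕ × (ℕ × Sketch) → ℕ × (ℕ × Sketch)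
  thin (N , e) (c , (a , out)) = let c′ = c ℕ.+ proj₂ e in
    if N ℕ.* c′ ℕ.≤ᵇ N ℕ.* a ℕ.+ a then (c′ , (a , out)) else (c′ , (c′ , (proj₁ e , c′ ℕ.∸ a) ∷ out))

  compress : ℕ × Sketch → Sketch
  compress (N , S) = proj₂ (proj₂ (foldr (λ e → thin (N , e)) (0 , (0 , [])) (sort S)))

  matching : SketchedTable × Row → Sketch
  matching (x , r) = proj₂ x >>=′ λ e → if consistent (proj₁ e , r) then proj₂ e else []

  absorb : ℕ × (SketchedTable × SketchedTable) → SketchedTable
  absorb (N , (x , y)) = proj₁ y , mapᶠ (proj₂ y) λ e →
    proj₁ e , compress (N , times (proj₂ e , matching (x , proj₁ e)))

  merge : SketchedTable × SketchedTable → SketchedTable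
  merge (x , y) = append (proj₁ x) (proj₁ y) , (proj₂ y >>=′ λ e → proj₂ x >>=′ λ e′ →
    if consistent (proj₁ e′ , proj₁ e)
    then (append (proj₁ e′) (proj₁ e) , times (proj₂ e , proj₂ e′)) ∷ [] else [])

  reduce : ℕ × List SketchedTable → List SketchedTable
  reduce (N , Ts) = caseList Ts [] λ x xs → caseList xs (x ∷ []) λ y ys →
    caseList (select (pairs Ts) isEar) (merge (x , y) ∷ ys) λ p _ →
      absorb (N , (proj₁ p , proj₁ (proj₂ p))) ∷ proj₂ (proj₂ p)

  -- The list of tables is its own loop counter. One round fewer would leave a single table already;
  -- the surplus round changes nothing.
  reduceAll : ℕ × List SketchedTable → List SketchedTable
  reduceAll (N , Ts) = foldr (λ _ Us → reduce (N , Us)) Ts Ts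

  count : ℝ × Sketch → ℕ
  count (L , S) = foldr (λ e n → if proj₁ e ≤ᴿ L then proj₂ e ℕ.+ n else n) 0 S

  tally : ℕ × (ℝ × List SketchedTable) → ℕ
  tally (N , (L , Ts)) = caseList (reduceAll (N , Ts)) 0 λ T _ →
    foldr (λ e n → count (L , proj₂ e) ℕ.+ n) 0 (proj₂ T)

  double : ℕ × (∃ R × List (ℕ × ∃ R)) → ℕ × (∃ R × List (ℕ × ∃ R))
  double (p , (x , out)) = p ℕ.+ p , (x ⊕ x , (p , x) ∷ out)

  spend : ℕ × ∃ R → ℕ × ∃ R → ℕ × ∃ R
  spend (k , y) (p , x) = if p ℕ.≤ᵇ k then (k ℕ.∸ p , y ⊕ x) else (k , y)

  -- The powers of two are listed in decreasing order; the rows only supply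
  -- a sufficient number of them.
  powers : ∃ R × List (Row × (ℝ × ∃ R)) → List (ℕ × ∃ R)
  powers (x , rs) = proj₂ (proj₂ (foldr (λ _ → double) (1 , (x , [])) rs))

  -- Greedy binary expansion of `k`, from the highest power down. It is exact as long as `k` is less
  -- than 2 to the number of rows listed.
  copies : ℕ × (∃ R × List (Row × (ℝ × ∃ R))) → ∃ R
  copies (k , (x , rs)) = proj₂ (foldl spend (k , I₀) (powers (x , rs)))

  -- The key of a column is the number of columns after it.
  describe : List Functions → List (ℕ × Functions)
  describe fs = proj₂ (foldr (λ f s → suc (proj₁ s) , (proj₁ s , f) ∷ proj₂ s) (0 , []) fs)

  columnsOf : List Bool × List (ℕ × Functions) → List (ℕ × Functions)
  columnsOf (mask , cs) = zip mask cs >>=′ λ p → if proj₁ p then proj₂ p ∷ [] else []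

  -- A column contributes to the first table, counted from the right, in which it occurs.
  prepareRow : List ℕ × (List (ℕ × Functions) × List ℝ) → Row × (ℝ × ∃ R)
  prepareRow (seen , (cs , r)) =
    mapᶠ (zip cs r) (λ e → proj₁ (proj₁ e) , proj₂ e) ,
    (foldr (λ e s → if hasKey (proj₁ (proj₁ e) , seen) then s else proj₁ (proj₂ (proj₁ e)) (proj₂ e) + s) 0# (zip cs r) ,
     foldr (λ e s → if hasKey (proj₁ (proj₁ e) , seen) then s else proj₂ (proj₂ (proj₁ e)) (proj₂ e) ⊕ s) I₀ (zip cs r))

  prepareTable : List (ℕ × Functions) × (List ℕ × (List Bool × List (List ℝ))) → PreparedTable
  prepareTable (cs , (seen , t)) = let cs′ = columnsOf (proj₁ t , cs) in
    mapᶠ cs′ proj₁ , mapᶠ (proj₂ t) (λ r → prepareRow (seen , (cs′ , r)))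

  prepare : List (ℕ × Functions) × List (List Bool × List (List ℝ)) → List PreparedTable
  prepare (cs , ts) = proj₂ (foldr (λ t s → let T = prepareTable (cs , (proj₁ s , t)) in
    append (proj₁ T) (proj₁ s) , T ∷ proj₂ s) ([] , []) ts)

  annotate : PreparedTable → SketchedTable
  annotate T = proj₁ T , mapᶠ (proj₂ T) λ r → proj₁ r , (proj₁ (proj₂ r) , 1) ∷ []

  allRows : List PreparedTable → List (Row × (ℝ × ∃ R))
  allRows Ps = Ps >>=′ proj₂

  precision : ℕ → List PreparedTable → ℕ
  precision E Ps = foldr (λ _ n → E ℕ.+ n) 0 Ps

  -- Cutting one table down to the single row `r` makes the tally count exactly the rows of the join
  -- that extend `r`.
  restricted : (PreparedTable × List PreparedTable) × (Row × (ℝ × ∃ R)) → List SketchedTable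
  restricted ((T , Ps) , r) = annotate (proj₁ T , r ∷ []) ∷ mapᶠ Ps annotate

  total : ℕ × (ℝ × List PreparedTable) → ∃ R
  total (N , (L , Ps)) = foldr (λ s acc → foldr (λ r acc′ →
      copies (tally (N , (L , restricted (s , r))) , (proj₂ (proj₂ r) , allRows Ps)) ⊕ acc′)
    I₀ (proj₂ (proj₁ s)) ⊕ acc) I₀ (selections Ps)

  answer : ℕ → ℝ × (List Functions × List (List Bool × List (List ℝ))) → ∃ R
  answer E (L , (fs , ts)) = let Ps = prepare (describe fs , ts) in total (precision E Ps , (L , Ps))

-- Its implementation

stepʳ-all : {A B : Set} (f : A → B → B) (P : A → B → Set) (z : B) (xs : List A) →
            (∀ x → x ∈ xs → ∀ y → P x y) → Stepʳ f P z xs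
stepʳ-all f P z []       h = tt
stepʳ-all f P z (x ∷ xs) h = h x (here refl) _ , stepʳ-all f P z xs λ y y∈ → h y (there y∈)

stepˡ-all : {A B : Set} (f : B → A → B) (P : A → B → Set) (xs : List A) (y : B) →
            (∀ x y → P x y) → Step f P xs y
stepˡ-all f P []       y h = []
stepˡ-all f P (x ∷ xs) y h = h x y ∷ stepˡ-all f P xs (f y x) h

-- The invariant `I` ties the accumulator to the suffix already consumed. This bounds the lengths of
-- accumulated lists while the loop is still running.
stepʳ-suffix : {A B : Set} (f : A → B → B) (P : A → B → Set) (I : List A → B → Set) (z : B) → I [] z →
               (∀ x xs y → I xs y → I (x ∷ xs) (f x y)) → (xs : List A) →
               (∀ x ys y → x ∈ xs → length (x ∷ ys) ℕ.≤ length xs → I ys y → P x y) → Stepʳ f P z xs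
stepʳ-suffix f P I z i step []       h = tt
stepʳ-suffix {A} f P I z i step (x ∷ xs) h = h x xs _ (here refl) ℕ.≤-refl (invariant xs) ,
  stepʳ-suffix f P I z i step xs (λ w ys y w∈ l → h w ys y (there w∈) (ℕ.m≤n⇒m≤1+n l))
  where
  invariant : (ys : List A) → I ys (foldr f z ys)
  invariant []       = i
  invariant (y ∷ ys) = step y ys _ (invariant ys)

branch : ∀ {ℓ} (b : Bool) {X Y : Set ℓ} → X → Y → if b then X else Y
branch true  x y = x
branch false x y = y

cases : {A : Set} (xs : List A) {X : Set} {Y : A → List A → Set} → X →
        (∀ y ys → xs ≡ y ∷ ys → Y y ys) → caseList xs X Y
cases []       x f = x
cases (y ∷ ys) x f = f y ys refl

-- The conditions that the bodies of the derived loops impose.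
module _ {A B : Set} {f : A → B → B} {z : B} {xs : List A} where

  each : {P : A → B → Set} → (∀ x → x ∈ xs → ∀ y → P x y) → Stepʳ f P z xs
  each = stepʳ-all f _ z xs

  each-map : {F : A → Set} → (∀ x → x ∈ xs → F x) → Stepʳ f (λ x _ → (F x × ⊤) × ⊤) z xs
  each-map h = each λ x x∈ _ → (h x x∈ , tt) , tt

  each-test : {F : A → Set} {g : A → Bool} → (∀ x → x ∈ xs → F x) →
              Stepʳ f (λ x _ → F x × (if g x then ⊤ else ⊤)) z xs
  each-test {g = g} h = each λ x x∈ _ → h x x∈ , branch (g x) tt tt

module _ {A B : Set} {f : A → List B → List B} {z : List B} {xs : List A} {s : ℕ} where

  each-bind : {F : A → Set} {g : A → List B} → (∀ x → x ∈ xs → F x) → (∀ x → x ∈ xs → length (g x) ℕ.≤ s) →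
              Stepʳ f (λ x y → ⊤ × F x × length (g x) ℕ.≤ s × Stepʳ _∷_ (λ _ _ → (⊤ × ⊤) × ⊤) y (g x)) z xs
  each-bind h k = each λ x x∈ _ → tt , h x x∈ , k x x∈ , each λ _ _ _ → (tt , tt) , tt

  each-select : {F : A → Set} {g : A → Bool} {h : A → B} → 1 ℕ.≤ s → (∀ x → x ∈ xs → F x) →
                Stepʳ f (λ x y → ⊤ × (F x × (if g x then (⊤ × ⊤) × ⊤ else ⊤)) ×
                         length (if g x then h x ∷ [] else []) ℕ.≤ s ×
                         Stepʳ _∷_ (λ _ _ → (⊤ × ⊤) × ⊤) y (if g x then h x ∷ [] else [])) z xs
  each-select {g = g} {h} 1≤s q = each-bind (λ x x∈ → q x x∈ , branch (g x) ((tt , tt) , tt) tt)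
    (λ x _ → one (g x))
    where
    one : ∀ {x} (b : Bool) → length (if b then h x ∷ [] else []) ℕ.≤ s
    one true  = 1≤s
    one false = z≤n

module Primitives {ℜ : CompleteOrderedField} (B : BasicFunctions ℜ) (M : RealCommutativeMonoid ℜ)
                  (⊕-program : PolynomialTimeOperator B M) where
  open CompleteOrderedField ℜ
  open RealCommutativeMonoid M
  open RealArithmetic ℜ
  open Language B M
  open Algorithm M

  instruction : ∀ {a b} (p : Program B) (f : Val a → Val b) →
                (∀ x → _∶_⇓_∣_ B p (enc a x) (enc b (f x)) 1) → Routine a b
  instruction p f h = record
    { program = p ; spec = f ; Fits = λ _ _ → ⊤ ; time = con 1 ; correct = λ x → unit (h x) }

  fstᴿ : ∀ {a b} → Routine (a ⊗ b) a
  fstᴿ {a} {b} = instruction {a ⊗ b} {a} left proj₁ λ _ → left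

  sndᴿ : ∀ {a b} → Routine (a ⊗ b) b
  sndᴿ {a} {b} = instruction {a ⊗ b} {b} right proj₂ λ _ → right

  consᴿ : ∀ {a} → Routine (a ⊗ list a) (list a)
  consᴿ {a} = instruction {a ⊗ list a} {list a} skip (λ (x , xs) → x ∷ xs) λ _ → skip

  add-real : Routine (real ⊗ real) real
  add-real = instruction {real ⊗ real} {real} add (λ (x , y) → x + y) λ _ → add

  leq-real : Routine (real ⊗ real) bool
  leq-real = instruction {real ⊗ real} {bool} leq (λ (x , y) → x ≤ᴿ y) λ _ → leq

  add-nat : Routine (nat ⊗ nat) nat
  add-nat = instruction {nat ⊗ nat} {nat} add (λ (k , l) → k ℕ.+ l) λ (k , l) →
    subst (λ z → _∶_⇓_∣_ B add (pair (num (fromℕ k)) (num (fromℕ l))) (num z) 1) (sym (fromℕ-+ k l)) add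

  mul-nat : Routine (nat ⊗ nat) nat
  mul-nat = instruction {nat ⊗ nat} {nat} mul (λ (k , l) → k ℕ.* l) λ (k , l) →
    subst (λ z → _∶_⇓_∣_ B mul (pair (num (fromℕ k)) (num (fromℕ l))) (num z) 1) (sym (fromℕ-* k l)) mul

  leq-nat : Routine (nat ⊗ nat) bool
  leq-nat = instruction {nat ⊗ nat} {bool} leq (λ (k , l) → k ℕ.≤ᵇ l) λ (k , l) →
    subst (λ b → _∶_⇓_∣_ B leq (pair (num (fromℕ k)) (num (fromℕ l))) (truth B b) 1) (fromℕ-≤ᵇ k l) leq

  monus : Routine (nat ⊗ nat) nat
  monus = record
    { program = ifte leq (mkNum 0#) sub ; spec = λ (k , l) → k ℕ.∸ l ; Fits = λ _ _ → ⊤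
    ; time = con 3 ; correct = λ (k , l) → go k l }
    where
    input : ℕ → ℕ → Value B
    input k l = pair (num (fromℕ k)) (num (fromℕ l))
    go : ∀ k l → Runs (ifte leq (mkNum 0#) sub) (input k l) (num (fromℕ (k ℕ.∸ l))) Always (con 3)
    go k l with fromℕ k ≤? fromℕ l in eq
    ... | yes k≤l = runs (then′ (subst (λ b → _∶_⇓_∣_ B leq (input k l) (truth B b) 1) (cong Dec.does eq) leq) (λ ())
      (subst (λ z → _∶_⇓_∣_ B (mkNum 0#) (input k l) (num (fromℕ z)) 1) (sym (ℕ.m≤n⇒m∸n≡0 (fromℕ-reflect {k} {l} k≤l))) mkNum))
      λ _ _ → ℕ.≤-refl
    ... | no k≰l  = runs (else′ (subst (λ b → _∶_⇓_∣_ B leq (input k l) (truth B b) 1) (cong Dec.does eq) leq)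
      (subst (λ z → _∶_⇓_∣_ B sub (input k l) (num z) 1)
        (sym (fromℕ-∸ (fromℕ-reflect {l} {k} (≰⇒≥ k≰l)))) sub))
      λ _ _ → ℕ.≤-refl

  plus-mon : Routine (mon ⊗ mon) mon
  plus-mon = record
    { program = proj₁ ⊕-program
    ; spec    = λ (x , y) → x ⊕ y
    ; Fits    = λ _ _ → ⊤
    -- A pair of two numbers has size 3, so the polynomial bound on the time of ⊕ is a constant.
    ; time    = con (evaluate (proj₁ (proj₂ ⊕-program)) (3 ∷ []))
    ; correct = λ (x , y) → let _ , h , t = proj₂ (proj₂ ⊕-program) x y in runs h λ _ _ → t
    }

  apply-real : Routine (realFun ⊗ real) real
  apply-real = instruction {realFun ⊗ real} {real} apply (λ (f , x) → f x) λ _ → apply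

  apply-mon : Routine (monFun ⊗ real) mon
  apply-mon = instruction {monFun ⊗ real} {mon} apply (λ (f , x) → f x) λ _ → apply

  true′ false′ : ∀ {Γ} → Term Γ bool
  true′  = lit record { program = ⟨ mkNil , mkNil ⟩ ; val = true ; correct = λ v → runs (both mkNil mkNil) λ _ _ → ℕ.≤-refl }
  false′ = lit record { program = mkNil ; val = false ; correct = λ v → runs mkNil λ _ _ → s≤s z≤n }

  nil′ : ∀ {Γ a} → Term Γ (list a)
  nil′ {a = a} = lit record { program = mkNil ; val = [] ; correct = λ v → runs mkNil λ _ _ → s≤s z≤n }

  nat′ : ∀ {Γ} → ℕ → Term Γ nat
  nat′ k = lit record { program = mkNum (fromℕ k) ; val = k ; correct = λ v → runs mkNum λ _ _ → s≤s z≤n }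

  zero-real : ∀ {Γ} → Term Γ real
  zero-real = lit record { program = mkNum 0# ; val = 0# ; correct = λ v → runs mkNum λ _ _ → s≤s z≤n }

  zero-mon : ∀ {Γ} → Term Γ mon
  zero-mon = lit record { program = mkNum (proj₁ I₀) ; val = I₀ ; correct = λ v → runs mkNum λ _ _ → s≤s z≤n }

  v0 : ∀ {a Γ} → Term (a ∷ Γ) a
  v0 = var′ (here refl)

  v1 : ∀ {a b Γ} → Term (a ∷ b ∷ Γ) b
  v1 = var′ (there (here refl))

  v2 : ∀ {a b c Γ} → Term (a ∷ b ∷ c ∷ Γ) c
  v2 = var′ (there (there (here refl)))

  v3 : ∀ {a b c d Γ} → Term (a ∷ b ∷ c ∷ d ∷ Γ) d
  v3 = var′ (there (there (there (here refl))))

  v4 : ∀ {a b c d e Γ} → Term (a ∷ b ∷ c ∷ d ∷ e ∷ Γ) e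
  v4 = var′ (there (there (there (there (here refl)))))

  v5 : ∀ {a b c d e f Γ} → Term (a ∷ b ∷ c ∷ d ∷ e ∷ f ∷ Γ) f
  v5 = var′ (there (there (there (there (there (here refl))))))

  v6 : ∀ {a b c d e f g Γ} → Term (a ∷ b ∷ c ∷ d ∷ e ∷ f ∷ g ∷ Γ) g
  v6 = var′ (there (there (there (there (there (there (here refl)))))))

  infixr 5 _∷′_

  fst′ : ∀ {Γ a b} → Term Γ (a ⊗ b) → Term Γ a
  fst′ = call fstᴿ

  snd′ : ∀ {Γ a b} → Term Γ (a ⊗ b) → Term Γ b
  snd′ = call sndᴿ

  _∷′_ : ∀ {Γ a} → Term Γ a → Term Γ (list a) → Term Γ (list a)
  t ∷′ u = call consᴿ (t ,′ u)

  map′ : ∀ {Γ a b} → Term Γ (list a) → Term (a ∷ Γ) b → Term Γ (list b)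
  map′ t u = foldr′ (omit₁ u ∷′ v1) nil′ t

  append′ : ∀ {Γ a} → Term Γ (list a) → Term Γ (list a) → Term Γ (list a)
  append′ t u = foldr′ (v0 ∷′ v1) u t

  bind′ : ∀ {Γ a b} → Term Γ (list a) → Term (a ∷ Γ) (list b) → Term Γ (list b)
  bind′ t u = foldr′ (append′ (omit₁ u) v1) nil′ t

  every′ some′ : ∀ {Γ a} → Term Γ (list a) → Term (a ∷ Γ) bool → Term Γ bool
  every′ t u = foldr′ (if′ (omit₁ u) v1 false′) true′ t
  some′  t u = foldr′ (if′ (omit₁ u) true′ v1) false′ t

  select′ : ∀ {Γ a} → Term Γ (list a) → Term (a ∷ Γ) bool → Term Γ (list a)
  select′ t u = bind′ t (if′ u (v0 ∷′ nil′) nil′)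

  sameKeyᴿ : Routine (nat ⊗ nat) bool
  sameKeyᴿ = routine (split v0 (if′ (call leq-nat (v0 ,′ v1)) (call leq-nat (v1 ,′ v0)) false′)) sameKey
    (λ _ → refl) (λ _ _ → ⊤) λ _ (k , l) _ → tt , ((tt , tt) , tt) , branch (k ℕ.≤ᵇ l) ((tt , tt) , tt) tt

  sameRealᴿ : Routine (real ⊗ real) bool
  sameRealᴿ = routine (split v0 (if′ (call leq-real (v0 ,′ v1)) (call leq-real (v1 ,′ v0)) false′)) sameReal
    (λ _ → refl) (λ _ _ → ⊤) λ _ (x , y) _ → tt , ((tt , tt) , tt) , branch (x ≤ᴿ y) ((tt , tt) , tt) tt

  row sketch sketchedTable preparedRow preparedTable : Type
  row           = list (nat ⊗ real)
  sketch        = list (real ⊗ nat)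
  sketchedTable = list nat ⊗ list (row ⊗ sketch)
  preparedRow   = row ⊗ real ⊗ mon
  preparedTable = list nat ⊗ list preparedRow

  consistentᴿ : Routine (row ⊗ row) bool
  consistentᴿ = routine
    (split v0 (every′ v0 (every′ v2
      (if′ (call sameKeyᴿ (fst′ v1 ,′ fst′ v0)) (call sameRealᴿ (snd′ v1 ,′ snd′ v0)) true′))))
    consistent (λ _ → refl) (λ s (r , r′) → length r ℕ.≤ s × length r′ ℕ.≤ s)
    λ s (r , r′) (p , q) → tt , tt , tt , p , each-test λ e _ → tt , tt , q , each-test λ e′ _ →
      _ , branch (sameKey (proj₁ e , proj₁ e′)) _ _

  hasKeyᴿ : Routine (nat ⊗ list nat) bool
  hasKeyᴿ = routine (split v0 (some′ v1 (call sameKeyᴿ (v1 ,′ v0)))) hasKey (λ _ → refl)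
    (λ s (k , ks) → length ks ℕ.≤ s) λ s (k , ks) p → tt , tt , tt , p , each-test λ _ _ → _

module Lengths {ℜ : CompleteOrderedField} (M : RealCommutativeMonoid ℜ) where
  open Algorithm M

  selectionsOf : {A : Set} → A → List A × List (A × List A) → List A × List (A × List A)
  selectionsOf x s = x ∷ proj₁ s , (x , proj₁ s) ∷ mapᶠ (proj₂ s) (λ p → proj₁ p , x ∷ proj₂ p)

  selections-∷ : {A : Set} (x : A) (xs : List A) →
                 selections (x ∷ xs) ≡ (x , xs) ∷ mapᶠ (selections xs) (λ p → proj₁ p , x ∷ proj₂ p)
  selections-∷ {A} x xs = cong (λ ys → (x , ys) ∷ mapᶠ (selections xs) (λ p → proj₁ p , x ∷ proj₂ p)) (suffix xs)
    where
    suffix : (ys : List A) → proj₁ (foldr selectionsOf ([] , []) ys) ≡ ys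
    suffix []       = refl
    suffix (y ∷ ys) = cong (y ∷_) (suffix ys)

  length-selections : {A : Set} (xs : List A) → length (selections xs) ≡ length xs
  length-selections []       = refl
  length-selections (x ∷ xs) = cong suc (trans (length-mapᶠ (selections xs) _) (length-selections xs))

  selections-↭ : {A : Set} (xs : List A) {x : A} {ys : List A} → (x , ys) ∈ selections xs → x ∷ ys ↭ xs
  selections-↭ (z ∷ xs) {x} {ys} p with subst ((x , ys) ∈_) (selections-∷ z xs) p
  ... | here refl = ↭-refl
  ... | there q with ∈-mapᶠ⁻ (selections xs) (λ p → proj₁ p , z ∷ proj₂ p) q
  ...   | _ , q′ , refl = ↭-trans (swap _ _ ↭-refl) (prep z (selections-↭ xs q′))

  ∈-selections : {A : Set} (xs : List A) {x : A} → x ∈ xs → ∃[ ys ] (x , ys) ∈ selections xs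
  ∈-selections (z ∷ xs) {x} (here refl) = xs , subst ((x , xs) ∈_) (sym (selections-∷ z xs)) (here refl)
  ∈-selections (z ∷ xs) {x} (there x∈)  with ∈-selections xs x∈
  ... | ys , p = z ∷ ys , subst ((x , z ∷ ys) ∈_) (sym (selections-∷ z xs))
    (there (∈-mapᶠ⁺ (selections xs) (λ p → proj₁ p , z ∷ proj₂ p) p))

  length-selection : {A : Set} (xs : List A) {x : A} {ys : List A} → (x , ys) ∈ selections xs → suc (length ys) ≡ length xs
  length-selection xs p = Perm.↭-length (selections-↭ xs p)

  pairs-↭ : {A : Set} (xs : List A) {x y : A} {zs : List A} → (x , (y , zs)) ∈ pairs xs → x ∷ y ∷ zs ↭ xs
  pairs-↭ xs p with ∈->>=⁻ (selections xs) (λ p → mapᶠ (selections (proj₂ p)) λ q → proj₁ p , q) p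
  ... | (x , ys) , x∈ , q with ∈-mapᶠ⁻ (selections ys) (λ q → x , q) q
  ...   | _ , q′ , refl = ↭-trans (prep x (selections-↭ ys q′)) (selections-↭ xs x∈)

  length-pairs : {A : Set} (xs : List A) → length (pairs xs) ℕ.≤ length xs ℕ.* length xs
  length-pairs xs = subst (λ n → length (pairs xs) ℕ.≤ n ℕ.* length xs) (length-selections xs)
    (length->>= (selections xs) (λ p → mapᶠ (selections (proj₂ p)) λ q → proj₁ p , q) (length xs) λ p p∈ →
      subst (ℕ._≤ length xs) (sym (trans (length-mapᶠ (selections (proj₂ p)) _) (length-selections (proj₂ p))))
        (ℕ.≤-trans (ℕ.n≤1+n _) (ℕ.≤-reflexive (length-selection xs p∈))))

  length-insert : ∀ e S → length (insert (e , S)) ≡ suc (length S)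
  length-insert e []      = refl
  length-insert e (y ∷ S) with insert (e , S) | length-insert e S
  ... | h ∷ t | eq with proj₁ h ≤ᴿ proj₁ y
  ...   | true  = cong suc eq
  ...   | false = cong suc eq

  length-sort : ∀ S → length (sort S) ≡ length S
  length-sort []      = refl
  length-sort (e ∷ S) = trans (length-insert e (sort S)) (cong suc (length-sort S))

  length-powers : ∀ x rs → length (powers (x , rs)) ≡ length rs
  length-powers x []       = refl
  length-powers x (r ∷ rs) = cong suc (length-powers x rs)

  length-describe : ∀ fs → length (describe fs) ≡ length fs
  length-describe []       = refl
  length-describe (f ∷ fs) = cong suc (length-describe fs)

  length-zip : {A B : Set} (xs : List A) (ys : List B) → length (zip xs ys) ℕ.≤ length xs
  length-zip []       ys       = z≤n
  length-zip (x ∷ xs) []       = z≤n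
  length-zip (x ∷ xs) (y ∷ ys) = s≤s (length-zip xs ys)

  length-zip′ : {A B : Set} (xs : List A) (ys : List B) → length (zip xs ys) ℕ.≤ length ys
  length-zip′ []       ys       = z≤n
  length-zip′ (x ∷ xs) []       = z≤n
  length-zip′ (x ∷ xs) (y ∷ ys) = s≤s (length-zip′ xs ys)

  length-columnsOf : ∀ mask cs → length (columnsOf (mask , cs)) ℕ.≤ length cs
  length-columnsOf mask cs = ℕ.≤-trans
    (subst (length (columnsOf (mask , cs)) ℕ.≤_) (ℕ.*-identityʳ _)
      (length->>= (zip mask cs) (λ p → if proj₁ p then proj₂ p ∷ [] else []) 1 λ p _ → one (proj₁ p)))
    (length-zip′ mask cs)
    where
    one : {A : Set} {x : A} (b : Bool) → length (if b then x ∷ [] else []) ℕ.≤ 1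
    one true  = s≤s z≤n
    one false = z≤n

module Implementation {ℜ : CompleteOrderedField} (B : BasicFunctions ℜ) (M : RealCommutativeMonoid ℜ)
                      (⊕-program : PolynomialTimeOperator B M) where
  open Language B M
  open Algorithm M
  open Lengths M
  open Primitives B M ⊕-program
  open Routine using (Fits)

  selectionsᴿ : ∀ {a} → Routine (list a) (list (a ⊗ list a))
  selectionsᴿ = routine
    (snd′ (foldr′ ((v0 ∷′ fst′ v1) ,′ ((v0 ,′ fst′ v1) ∷′ map′ (snd′ v1) (fst′ v0 ,′ (v1 ∷′ snd′ v0))))
      (nil′ ,′ nil′) v0))
    selections (λ _ → refl) (λ s xs → length xs ℕ.≤ s)
    λ s xs p → (_ , tt , p , stepʳ-suffix selectionsOf _ (λ ys st → length (proj₂ st) ≡ length ys) ([] , []) refl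
      (λ x ys st e → cong suc (trans (length-mapᶠ (proj₂ st) _) e)) xs
      λ x ys st _ l e → _ , (_ , (tt , _ , ℕ.≤-trans (ℕ.≤-reflexive e) (ℕ.≤-trans (ℕ.n≤1+n _) (ℕ.≤-trans l p)) ,
        each-map λ _ _ → _)) , tt) , tt

  pairsᴿ : ∀ {a} → Routine (list a) (list (a ⊗ a ⊗ list a))
  pairsᴿ = routine
    (bind′ (call selectionsᴿ v0) (map′ (call selectionsᴿ (snd′ v0)) (fst′ v1 ,′ v0)))
    pairs (λ _ → refl) (λ s xs → length xs ℕ.≤ s)
    λ s xs p →
      let fewer : ∀ {q} → q ∈ selections xs → length (proj₂ q) ℕ.≤ s
          fewer q∈ = ℕ.≤-trans (ℕ.n≤1+n _) (ℕ.≤-trans (ℕ.≤-reflexive (length-selection xs q∈)) p)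
      in tt , (tt , p) , subst (ℕ._≤ s) (sym (length-selections xs)) p , each-bind
        (λ q q∈ → tt , (_ , fewer q∈) , subst (ℕ._≤ s) (sym (length-selections (proj₂ q))) (fewer q∈) , each-map λ _ _ → _)
        (λ q q∈ → subst (ℕ._≤ s) (sym (trans (length-mapᶠ (selections (proj₂ q)) _) (length-selections (proj₂ q)))) (fewer q∈))

  isEarᴿ : Routine (sketchedTable ⊗ sketchedTable ⊗ list sketchedTable) bool
  isEarᴿ = routine
    (every′ (snd′ (snd′ v0)) (every′ (fst′ (fst′ v1))
      (if′ (call hasKeyᴿ (v0 ,′ fst′ v1)) (call hasKeyᴿ (v0 ,′ fst′ (fst′ (snd′ v2)))) true′)))
    isEar (λ _ → refl)
    (λ s (x , (y , zs)) → length (proj₁ x) ℕ.≤ s × length (proj₁ y) ℕ.≤ s × length zs ℕ.≤ s ×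
                          (∀ z → z ∈ zs → length (proj₁ z) ℕ.≤ s))
    λ s (x , (y , zs)) (p , q , l , h) → tt , _ , l , each-test λ z z∈ → tt , _ , p , each-test λ k _ →
      (_ , h z z∈) , branch (hasKey (k , proj₁ z)) (_ , q) tt

  timesᴿ : Routine (sketch ⊗ sketch) sketch
  timesᴿ = routine
    (split v0 (bind′ v0 (map′ v2 (call add-real (fst′ v1 ,′ fst′ v0) ,′ call mul-nat (snd′ v1 ,′ snd′ v0)))))
    times (λ _ → refl) (λ s (S , S′) → length S ℕ.≤ s × length S′ ℕ.≤ s)
    λ s (S , S′) (p , q) → tt , tt , tt , p , each-bind (λ _ _ → tt , tt , q , each-map λ _ _ → _)
      λ _ _ → subst (ℕ._≤ s) (sym (length-mapᶠ S′ _)) q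

  insertᴿ : Routine ((real ⊗ nat) ⊗ sketch) sketch
  insertᴿ = routine
    (split v0 (foldr′ (case′ v1 (v0 ∷′ nil′)
      (if′ (call leq-real (fst′ v0 ,′ fst′ v2)) (v2 ∷′ v0 ∷′ v1) (v0 ∷′ v2 ∷′ v1))) (v0 ∷′ nil′) v1))
    insert (λ _ → refl) (λ s (e , S) → length S ℕ.≤ s)
    λ s (e , S) p → tt , _ , tt , p , each λ y _ acc → tt , cases acc _ λ h t _ → _ , branch (proj₁ h ≤ᴿ proj₁ y) _ _

  sortᴿ : Routine sketch sketch
  sortᴿ = routine
    (foldr′ (call insertᴿ (v0 ,′ v1)) nil′ v0) sort (λ _ → refl) (λ s S → length S ℕ.≤ s)
    λ s S p → tt , tt , p , stepʳ-suffix (λ e acc → insert (e , acc)) _ (λ ys st → length st ≡ length ys) [] refl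
      (λ e ys st eq → trans (length-insert e st) (cong suc eq)) S
      λ e ys st _ l eq → _ , ℕ.≤-trans (ℕ.≤-reflexive eq) (ℕ.≤-trans (ℕ.n≤1+n _) (ℕ.≤-trans l p))

  compressᴿ : Routine (nat ⊗ sketch) sketch
  compressᴿ = routine
    (split v0 (snd′ (snd′ (foldr′
      (let′ (call add-nat (fst′ v1 ,′ snd′ v0))
        (if′ (call leq-nat (call mul-nat (v3 ,′ v0) ,′
                            call add-nat (call mul-nat (v3 ,′ fst′ (snd′ v2)) ,′ fst′ (snd′ v2))))
             (v0 ,′ snd′ v2)
             (v0 ,′ (v0 ,′ ((fst′ v1 ,′ call monus (v0 ,′ fst′ (snd′ v2))) ∷′ snd′ (snd′ v2))))))
      (nat′ 0 ,′ (nat′ 0 ,′ nil′)) (call sortᴿ v1)))))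
    compress (λ _ → refl) (λ s (N , S) → length S ℕ.≤ s)
    λ s (N , S) p → tt , (((tt , tt , tt) , (tt , p) , subst (ℕ._≤ s) (sym (length-sort S)) p ,
      each λ e _ (c , (a , out)) → _ , _ , branch (N ℕ.* (c ℕ.+ proj₂ e) ℕ.≤ᵇ N ℕ.* a ℕ.+ a) _ _) , tt) , tt

  matchingᴿ : Routine (sketchedTable ⊗ row) sketch
  matchingᴿ = routine
    (split v0 (bind′ (snd′ v0) (if′ (call consistentᴿ (fst′ v0 ,′ v2)) (snd′ v0) nil′)))
    matching (λ _ → refl)
    (λ s (x , r) → length r ℕ.≤ s × length (proj₂ x) ℕ.≤ s ×
                   (∀ e → e ∈ proj₂ x → length (proj₁ e) ℕ.≤ s × length (proj₂ e) ℕ.≤ s))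
    λ s (x , r) (p , l , h) → tt , tt , _ , l , each-bind
      (λ e e∈ → (_ , proj₁ (h e e∈) , p) , branch (consistent (proj₁ e , r)) _ _)
      λ e e∈ → bound (consistent (proj₁ e , r)) (proj₂ (h e e∈))
    where
    bound : ∀ {s} {S : Sketch} b → length S ℕ.≤ s → length (if b then S else []) ℕ.≤ s
    bound true  p = p
    bound false p = z≤n

  absorbᴿ : Routine (nat ⊗ sketchedTable ⊗ sketchedTable) sketchedTable
  absorbᴿ = routine
    (split v0 (split v1 (fst′ v1 ,′ map′ (snd′ v1)
      (fst′ v0 ,′ call compressᴿ (v3 ,′ call timesᴿ (snd′ v0 ,′ call matchingᴿ (v1 ,′ fst′ v0)))))))
    absorb (λ _ → refl)
    (λ s (N , (x , y)) → length (proj₂ y) ℕ.≤ s × (∀ e → e ∈ proj₂ y → length (proj₂ e) ℕ.≤ s ×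
      Fits matchingᴿ s (x , proj₁ e) × length (matching (x , proj₁ e)) ℕ.≤ s ×
      length (times (proj₂ e , matching (x , proj₁ e))) ℕ.≤ s))
    λ s (N , (x , y)) (l , h) → tt , tt , _ , tt , _ , l , each-map λ e e∈ →
      let p , q , m , t = h e e∈ in _ , (tt , (_ , _ , q) , p , m) , t

  -- Only cyclic joins are merged, so no bound on the time is needed.
  mergeᴿ : Routine (sketchedTable ⊗ sketchedTable) sketchedTable
  mergeᴿ = routine
    (split v0 (append′ (fst′ v0) (fst′ v1) ,′ bind′ (snd′ v1) (bind′ (snd′ v1)
      (if′ (call consistentᴿ (fst′ v0 ,′ fst′ v1))
           ((append′ (fst′ v0) (fst′ v1) ,′ call timesᴿ (snd′ v1 ,′ snd′ v0)) ∷′ nil′) nil′))))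
    merge (λ _ → refl) (λ _ _ → ⊥) λ _ _ ()

  -- The last clause of the condition demands an ear whenever there are two tables. It excludes the
  -- branch that calls `mergeᴿ`, whose own condition is never satisfied.
  reduceᴿ : Routine (nat ⊗ list sketchedTable) (list sketchedTable)
  reduceᴿ = routine
    (split v0 (case′ v1 nil′ (case′ v1 (v0 ∷′ nil′)
      (case′ (select′ (call pairsᴿ v5) (call isEarᴿ v0)) (call mergeᴿ (v2 ,′ v0) ∷′ v1)
        (call absorbᴿ (v6 ,′ (fst′ v0 ,′ fst′ (snd′ v0))) ∷′ snd′ (snd′ v0))))))
    reduce (λ _ → refl)
    (λ s (N , Ts) → 1 ℕ.≤ s × length Ts ℕ.≤ s × length (pairs Ts) ℕ.≤ s ×
      (∀ T → T ∈ Ts → length (proj₁ T) ℕ.≤ s) ×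
      (∀ x y zs → (x , (y , zs)) ∈ pairs Ts → Fits absorbᴿ s (N , (x , y))) ×
      (2 ℕ.≤ length Ts → select (pairs Ts) isEar ≢ []))
    λ { s (N , [])         _ → _
      ; s (N , _ ∷ [])     _ → _
      ; s (N , Ts@(x ∷ y ∷ zs)) (1≤s , l , lp , keys , ab , ear) → tt , tt , tt ,
          (tt , (tt , l) , lp , each-select 1≤s λ (u , (v , ws)) p → tt ,
            let perm = pairs-↭ Ts p
                key  = λ {T} (T∈ : T ∈ _) → keys T (Perm.∈-resp-↭ perm T∈)
            in key (here refl) , key (there (here refl)) ,
               ℕ.≤-trans (ℕ.≤-trans (ℕ.n≤1+n _) (ℕ.≤-trans (ℕ.n≤1+n _) (ℕ.≤-reflexive (Perm.↭-length perm)))) l ,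
               λ z z∈ → key (there (there z∈))) ,
          (case select (pairs Ts) isEar of λ _ → nonempty (select (pairs Ts) isEar) (ear (s≤s (s≤s z≤n)))
            λ p ps eq → (((tt , _ , _) , ab _ _ _ (proj₁ (∈-select⁻ (pairs Ts) isEar (subst (p ∈_) (sym eq) (here refl))))) , _) , tt) }
    where
    nonempty : {A : Set} (xs : List A) {X : Set} {Y : A → List A → Set} → xs ≢ [] →
               (∀ y ys → xs ≡ y ∷ ys → Y y ys) → caseList xs X Y
    nonempty []       ne f = contradiction refl ne
    nonempty (x ∷ xs) ne f = f x xs refl

  reduceAllᴿ : Routine (nat ⊗ list sketchedTable) (list sketchedTable)
  reduceAllᴿ = routine
    (split v0 (foldr′ (call reduceᴿ (v2 ,′ v1)) v1 v1)) reduceAll (λ _ → refl)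
    (λ s (N , Ts) → length Ts ℕ.≤ s × Stepʳ (λ _ Us → reduce (N , Us)) (λ _ Us → Fits reduceᴿ s (N , Us)) Ts Ts)
    λ s (N , Ts) (l , h) → tt , tt , tt , l , go s N Ts Ts h
    where
    go : ∀ s N Ts Us → Stepʳ (λ _ Us → reduce (N , Us)) (λ _ Us → Fits reduceᴿ s (N , Us)) Us Ts →
         Stepʳ (λ _ Us → reduce (N , Us)) (λ _ Us → (⊤ × ⊤) × Fits reduceᴿ s (N , Us)) Us Ts
    go s N []       Us h       = tt
    go s N (T ∷ Ts) Us (p , h) = (_ , p) , go s N Ts Us h

  countᴿ : Routine (real ⊗ sketch) nat
  countᴿ = routine
    (split v0 (foldr′ (if′ (call leq-real (fst′ v0 ,′ v2)) (call add-nat (snd′ v0 ,′ v1)) v1) (nat′ 0) v1))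
    count (λ _ → refl) (λ s (L , S) → length S ℕ.≤ s)
    λ s (L , S) p → tt , tt , tt , p , each λ e _ n → _ , branch (proj₁ e ≤ᴿ L) _ _

  tallyᴿ : Routine (nat ⊗ real ⊗ list sketchedTable) nat
  tallyᴿ = routine
    (split v0 (split v1 (case′ (call reduceAllᴿ (v2 ,′ v1)) (nat′ 0)
      (foldr′ (call add-nat (call countᴿ (v4 ,′ snd′ v0) ,′ v1)) (nat′ 0) (snd′ v0)))))
    tally (λ _ → refl)
    (λ s (N , (L , Ts)) → Fits reduceAllᴿ s (N , Ts) × (∀ T Us → reduceAll (N , Ts) ≡ T ∷ Us →
      length (proj₂ T) ℕ.≤ s × (∀ e → e ∈ proj₂ T → length (proj₂ e) ℕ.≤ s)))
    λ s (N , (L , Ts)) (p , h) → tt , tt , (_ , p) , cases (reduceAll (N , Ts)) tt λ T Us eq →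
      tt , _ , proj₁ (h T Us eq) , each λ e e∈ _ → ((_ , proj₂ (h T Us eq) e e∈) , tt) , tt

module FullImplementation {ℜ : CompleteOrderedField} (B : BasicFunctions ℜ) (M : RealCommutativeMonoid ℜ)
                          (⊕-program : PolynomialTimeOperator B M) where
  open RealCommutativeMonoid M
  open Language B M
  open Algorithm M
  open Lengths M
  open Primitives B M ⊕-program
  open Implementation B M ⊕-program
  open Routine using (Fits)

  powersᴿ : Routine (mon ⊗ list preparedRow) (list (nat ⊗ mon))
  powersᴿ = routine
    (split v0 (snd′ (snd′ (foldr′
      (call add-nat (fst′ v1 ,′ fst′ v1) ,′
        (call plus-mon (fst′ (snd′ v1) ,′ fst′ (snd′ v1)) ,′ ((fst′ v1 ,′ fst′ (snd′ v1)) ∷′ snd′ (snd′ v1))))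
      (nat′ 1 ,′ (v0 ,′ nil′)) v1))))
    powers (λ _ → refl) (λ s (x , rs) → length rs ℕ.≤ s)
    λ s (x , rs) p → tt , (((tt , tt , tt) , tt , p , each λ _ _ _ → _) , tt) , tt

  copiesᴿ : Routine (nat ⊗ mon ⊗ list preparedRow) mon
  copiesᴿ = routine
    (split v0 (snd′ (foldl′
      (if′ (call leq-nat (fst′ v0 ,′ fst′ v1))
           (call monus (fst′ v1 ,′ fst′ v0) ,′ call plus-mon (snd′ v1 ,′ snd′ v0)) v1)
      (v0 ,′ zero-mon) (call powersᴿ v1))))
    copies (λ _ → refl) (λ s (k , (x , rs)) → length rs ℕ.≤ s)
    λ s (k , (x , rs)) p → tt , (_ , (tt , p) , subst (ℕ._≤ s) (sym (length-powers x rs)) p ,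
      stepˡ-all spend _ (powers (x , rs)) (k , I₀) λ e t → _ , branch (proj₁ e ℕ.≤ᵇ proj₁ t) _ _) , tt

  -- A fold consumes one list only, so the second list travels in the accumulator. The output comes
  -- out reversed, and `zipᴿ` reverses it back with another fold.
  zipStep : {X Y : Set} → List Y × List (X × Y) → X → List Y × List (X × Y)
  zipStep t x = caseList (proj₁ t) t λ y ys → ys , (x , y) ∷ proj₂ t

  zipStep-done : {X Y : Set} (xs : List X) (out : List (X × Y)) → foldl zipStep ([] , out) xs ≡ ([] , out)
  zipStep-done []       out = refl
  zipStep-done (x ∷ xs) out = zipStep-done xs out

  zipStep-zip : {X Y : Set} (xs : List X) (ys : List Y) (out : List (X × Y)) →
                proj₂ (foldl zipStep (ys , out) xs) ≡ zip xs ys ʳ++ out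
  zipStep-zip []       ys       out = refl
  zipStep-zip (x ∷ xs) []       out = cong proj₂ (zipStep-done xs out)
  zipStep-zip (x ∷ xs) (y ∷ ys) out = zipStep-zip xs ys ((x , y) ∷ out)

  zipᴿ : ∀ {a b} → Routine (list a ⊗ list b) (list (a ⊗ b))
  zipᴿ = routine
    (split v0 (foldl′ (v0 ∷′ v1) nil′ (snd′ (foldl′
      (case′ (fst′ v1) v1 (v1 ,′ ((v2 ,′ v0) ∷′ snd′ v3))) (v1 ,′ nil′) v0))))
    (λ (xs , ys) → zip xs ys)
    (λ (xs , ys) → trans (cong reverse (zipStep-zip xs ys [])) (List.reverse-involutive (zip xs ys)))
    (λ s (xs , ys) → length xs ℕ.≤ s)
    λ s (xs , ys) p → tt , tt ,
      (((tt , tt) , tt , p , stepˡ-all zipStep _ xs (ys , []) λ x t → (tt , tt) , cases (proj₁ t) tt λ _ _ _ → _) , tt) ,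
      subst (ℕ._≤ s) (sym (trans (cong length (zipStep-zip xs ys [])) (List.length-reverse (zip xs ys))))
        (ℕ.≤-trans (length-zip xs ys) p) ,
      stepˡ-all _ _ (proj₂ (foldl zipStep (ys , []) xs)) [] λ _ _ → _

  functions table column : Type
  functions = realFun ⊗ monFun
  column    = nat ⊗ functions
  table     = list bool ⊗ list (list real)

  describeᴿ : Routine (list functions) (list column)
  describeᴿ = routine
    (snd′ (foldr′ (call add-nat (nat′ 1 ,′ fst′ v1) ,′ ((fst′ v1 ,′ v0) ∷′ snd′ v1)) (nat′ 0 ,′ nil′) v0))
    describe (λ _ → refl) (λ s fs → length fs ℕ.≤ s)
    λ s fs p → (_ , tt , p , each λ _ _ _ → _) , tt

  columnsOfᴿ : Routine (list bool ⊗ list column) (list column)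
  columnsOfᴿ = routine
    (bind′ (call zipᴿ v0) (if′ (fst′ v0) (snd′ v0 ∷′ nil′) nil′))
    columnsOf (λ _ → refl) (λ s (mask , cs) → 1 ℕ.≤ s × length mask ℕ.≤ s)
    λ s (mask , cs) (1≤s , p) → tt , (tt , p) , ℕ.≤-trans (length-zip mask cs) p , each-bind
      (λ q _ → _ , branch (proj₁ q) _ _) λ q _ → one 1≤s (proj₁ q)
    where
    one : ∀ {s} {A : Set} {x : A} → 1 ℕ.≤ s → (b : Bool) → length (if b then x ∷ [] else []) ℕ.≤ s
    one 1≤s true  = 1≤s
    one 1≤s false = z≤n

  prepareRowᴿ : Routine (list nat ⊗ list column ⊗ list real) preparedRow
  prepareRowᴿ = routine
    (split v0 (split v1 (let′ (call zipᴿ (v0 ,′ v1))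
      (map′ v0 (fst′ (fst′ v0) ,′ snd′ v0) ,′
       (foldr′ (if′ (call hasKeyᴿ (fst′ (fst′ v0) ,′ v5)) v1
         (call add-real (call apply-real (fst′ (snd′ (fst′ v0)) ,′ snd′ v0) ,′ v1))) zero-real v0 ,′
        foldr′ (if′ (call hasKeyᴿ (fst′ (fst′ v0) ,′ v5)) v1
         (call plus-mon (call apply-mon (snd′ (snd′ (fst′ v0)) ,′ snd′ v0) ,′ v1))) zero-mon v0)))))
    prepareRow (λ _ → refl) (λ s (seen , (cs , r)) → length seen ℕ.≤ s × length cs ℕ.≤ s)
    λ s (seen , (cs , r)) (p , q) → let l = ℕ.≤-trans (length-zip cs r) q in
      tt , tt , (_ , q) , (tt , tt , l , each-map λ _ _ → _) ,
      (tt , tt , l , each λ e _ _ → (_ , p) , branch (hasKey (proj₁ (proj₁ e) , seen)) _ _) ,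
      (tt , tt , l , each λ e _ _ → (_ , p) , branch (hasKey (proj₁ (proj₁ e) , seen)) _ _)

  prepareTableᴿ : Routine (list column ⊗ list nat ⊗ table) preparedTable
  prepareTableᴿ = routine
    (split v0 (split v1 (let′ (call columnsOfᴿ (fst′ v1 ,′ v2))
      (map′ v0 (fst′ v0) ,′ map′ (snd′ v2) (call prepareRowᴿ (v2 ,′ (v1 ,′ v0)))))))
    prepareTable (λ _ → refl)
    (λ s (cs , (seen , t)) → 1 ℕ.≤ s × length cs ℕ.≤ s × length seen ℕ.≤ s × length (proj₁ t) ℕ.≤ s × length (proj₂ t) ℕ.≤ s)
    λ s (cs , (seen , t)) (1≤s , p , q , l , k) →
      let c = ℕ.≤-trans (length-columnsOf (proj₁ t) cs) p in
      tt , tt , (_ , 1≤s , l) , (tt , tt , c , each-map λ _ _ → _) , tt , _ , k , each-map λ _ _ → _ , q , c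

  prepareᴿ : Routine (list column ⊗ list table) (list preparedTable)
  prepareᴿ = routine
    (split v0 (snd′ (foldr′ (let′ (call prepareTableᴿ (v2 ,′ (fst′ v1 ,′ v0)))
      (append′ (fst′ v0) (fst′ v2) ,′ (v0 ∷′ snd′ v2))) (nil′ ,′ nil′) v1)))
    prepare (λ _ → refl)
    (λ s (cs , ts) → 1 ℕ.≤ s × length cs ℕ.≤ s × length ts ℕ.≤ s × length ts ℕ.* length cs ℕ.≤ s ×
      (∀ t → t ∈ ts → length (proj₁ t) ℕ.≤ s × length (proj₂ t) ℕ.≤ s))
    λ s (cs , ts) (1≤s , p , l , k , h) → tt , (_ , tt , l ,
      stepʳ-suffix _ _ (λ ys st → length (proj₁ st) ℕ.≤ length ys ℕ.* length cs) ([] , []) z≤n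
        (λ t ys st i → subst (ℕ._≤ _) (sym (length-append (proj₁ (prepareTable (cs , (proj₁ st , t)))) (proj₁ st)))
          (ℕ.+-mono-≤ (fewKeys cs (proj₁ st) t) i)) ts
        λ t ys st t∈ n i → (_ , 1≤s , p , seenBound i n k , h t t∈) ,
          (_ , _ , ℕ.≤-trans (fewKeys cs (proj₁ st) t) p , each λ _ _ _ → _) , _) , tt
    where
    fewKeys : ∀ cs seen t → length (proj₁ (prepareTable (cs , (seen , t)))) ℕ.≤ length cs
    fewKeys cs seen t = subst (ℕ._≤ length cs) (sym (length-mapᶠ (columnsOf (proj₁ t , cs)) proj₁)) (length-columnsOf (proj₁ t) cs)
    seenBound : ∀ {i n m c s} → i ℕ.≤ n ℕ.* c → suc n ℕ.≤ m → m ℕ.* c ℕ.≤ s → i ℕ.≤ s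
    seenBound {c = c} p q r = ℕ.≤-trans p (ℕ.≤-trans (ℕ.*-monoˡ-≤ c (ℕ.≤-trans (ℕ.n≤1+n _) q)) r)

  annotateᴿ : Routine preparedTable sketchedTable
  annotateᴿ = routine
    (fst′ v0 ,′ map′ (snd′ v0) (fst′ v0 ,′ ((fst′ (snd′ v0) ,′ nat′ 1) ∷′ nil′)))
    annotate (λ _ → refl) (λ s T → length (proj₂ T) ℕ.≤ s)
    λ s T p → _ , tt , _ , p , each-map λ _ _ → _

  allRowsᴿ : Routine (list preparedTable) (list preparedRow)
  allRowsᴿ = routine (bind′ v0 (snd′ v0)) allRows (λ _ → refl)
    (λ s Ps → length Ps ℕ.≤ s × (∀ T → T ∈ Ps → length (proj₂ T) ℕ.≤ s))
    λ s Ps (p , h) → tt , tt , p , each-bind (λ _ _ → _) h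

  precisionᴿ : ℕ → Routine (list preparedTable) nat
  precisionᴿ E = routine (foldr′ (call add-nat (nat′ E ,′ v1)) (nat′ 0) v0) (precision E) (λ _ → refl)
    (λ s Ps → length Ps ℕ.≤ s) λ s Ps p → tt , tt , p , each λ _ _ _ → _

  restrictedᴿ : Routine ((preparedTable ⊗ list preparedTable) ⊗ preparedRow) (list sketchedTable)
  restrictedᴿ = routine
    (split v0 (call annotateᴿ (fst′ (fst′ v0) ,′ (v1 ∷′ nil′)) ∷′ map′ (snd′ v0) (call annotateᴿ v0)))
    restricted (λ _ → refl)
    (λ s ((T , Ps) , r) → 1 ℕ.≤ s × length Ps ℕ.≤ s × (∀ P → P ∈ Ps → length (proj₂ P) ℕ.≤ s))
    λ s ((T , Ps) , r) (1≤s , p , h) → tt , ((_ , 1≤s) , tt , _ , p , each-map λ P P∈ → _ , h P P∈) , tt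

  totalᴿ : Routine (nat ⊗ real ⊗ list preparedTable) mon
  totalᴿ = routine
    (split v0 (split v1 (foldr′ (call plus-mon
      (foldr′ (call plus-mon
        (call copiesᴿ (call tallyᴿ (v6 ,′ (v4 ,′ call restrictedᴿ (v2 ,′ v0))) ,′ (snd′ (snd′ v0) ,′ call allRowsᴿ v5)) ,′ v1))
        zero-mon (snd′ (fst′ v0)) ,′ v1)) zero-mon (call selectionsᴿ v1))))
    total (λ _ → refl)
    (λ s (N , (L , Ps)) → 1 ℕ.≤ s × length Ps ℕ.≤ s × (∀ T → T ∈ Ps → length (proj₂ T) ℕ.≤ s) ×
      length (allRows Ps) ℕ.≤ s ×
      (∀ x → x ∈ selections Ps → ∀ r → r ∈ proj₂ (proj₁ x) → Fits tallyᴿ s (N , (L , restricted (x , r)))))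
    λ s (N , (L , Ps)) (1≤s , p , rows , all , h) → tt , tt , tt , (tt , p) ,
      subst (ℕ._≤ s) (sym (length-selections Ps)) p , each λ x x∈ _ →
        let perm = selections-↭ Ps x∈ in
        ((tt , _ , rows (proj₁ x) (Perm.∈-resp-↭ perm (here refl)) , each λ r r∈ _ →
          (((((tt , (tt , _ , 1≤s ,
                     ℕ.≤-trans (ℕ.n≤1+n _) (ℕ.≤-trans (ℕ.≤-reflexive (Perm.↭-length perm)) p) ,
                     λ P P∈ → rows P (Perm.∈-resp-↭ perm (there P∈)))) ,
              h x x∈ r r∈) , _ , tt , p , rows) , all) , tt) , tt) , tt) , tt

  answerᴿ : ℕ → Routine (real ⊗ list functions ⊗ list table) mon
  answerᴿ E = routine
    (split v0 (split v1 (let′ (call prepareᴿ (call describeᴿ v0 ,′ v1))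
      (call totalᴿ (call (precisionᴿ E) v0 ,′ (v3 ,′ v0))))))
    (answer E) (λ _ → refl)
    (λ s (L , (fs , ts)) → let Ps = prepare (describe fs , ts) in
      length fs ℕ.≤ s × Fits prepareᴿ s (describe fs , ts) × Fits totalᴿ s (precision E Ps , (L , Ps)))
    λ s (L , (fs , ts)) (p , q , h) → tt , tt , (((tt , p) , tt) , q) , ((tt , proj₁ (proj₂ h)) , tt , tt) , h

-- Thinning and elimination

-- a approximates b from below, up to the factor (1 + 1/N) ^ j.
Approx : ℕ → ℕ → ℕ → ℕ → Set
Approx N j a b = a ℕ.≤ b × N ℕ.^ j ℕ.* b ℕ.≤ suc N ℕ.^ j ℕ.* a

module _ {N : ℕ} where
  open BigSum ℕ.+-0-commutativeMonoid

  approx-refl : ∀ j {a} → Approx N j a a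
  approx-refl j = ℕ.≤-refl , ℕ.*-monoˡ-≤ _ (ℕ.^-monoˡ-≤ j (ℕ.n≤1+n N))

  approx-trans : ∀ {i j a b c} → Approx N i a b → Approx N j b c → Approx N (i ℕ.+ j) a c
  approx-trans {i} {j} {a} {b} {c} (a≤b , p) (b≤c , q) = ℕ.≤-trans a≤b b≤c , (begin
    N ℕ.^ (i ℕ.+ j) ℕ.* c                ≡⟨ cong (ℕ._* c) (ℕ.^-distribˡ-+-* N i j) ⟩
    N ℕ.^ i ℕ.* N ℕ.^ j ℕ.* c            ≡⟨ ℕ.*-assoc (N ℕ.^ i) _ c ⟩
    N ℕ.^ i ℕ.* (N ℕ.^ j ℕ.* c)          ≤⟨ ℕ.*-monoʳ-≤ (N ℕ.^ i) q ⟩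
    N ℕ.^ i ℕ.* (suc N ℕ.^ j ℕ.* b)      ≡⟨ *-exchange (N ℕ.^ i) (suc N ℕ.^ j) b ⟩
    suc N ℕ.^ j ℕ.* (N ℕ.^ i ℕ.* b)      ≤⟨ ℕ.*-monoʳ-≤ (suc N ℕ.^ j) p ⟩
    suc N ℕ.^ j ℕ.* (suc N ℕ.^ i ℕ.* a)  ≡⟨ *-exchange (suc N ℕ.^ j) (suc N ℕ.^ i) a ⟩
    suc N ℕ.^ i ℕ.* (suc N ℕ.^ j ℕ.* a)  ≡⟨ ℕ.*-assoc (suc N ℕ.^ i) _ a ⟨
    suc N ℕ.^ i ℕ.* suc N ℕ.^ j ℕ.* a    ≡⟨ cong (ℕ._* a) (ℕ.^-distribˡ-+-* (suc N) i j) ⟨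
    suc N ℕ.^ (i ℕ.+ j) ℕ.* a            ∎)
    where open ℕ.≤-Reasoning

  approx-∑ : ∀ {j} {A : Set} (xs : List A) {f g : A → ℕ} →
             (∀ x → x ∈ xs → Approx N j (f x) (g x)) → Approx N j (∑ xs f) (∑ xs g)
  approx-∑ {j} xs {f} {g} h = ∑-mono xs (λ x x∈ → proj₁ (h x x∈)) ,
    subst₂ ℕ._≤_ (sym (*-∑ (N ℕ.^ j) xs g)) (sym (*-∑ (suc N ℕ.^ j) xs f)) (∑-mono xs λ x x∈ → proj₂ (h x x∈))

  approx-* : ∀ {j a b} k → Approx N j a b → Approx N j (k ℕ.* a) (k ℕ.* b)
  approx-* {j} {a} {b} k (p , q) = ℕ.*-monoʳ-≤ k p ,
    subst₂ ℕ._≤_ (*-exchange k (N ℕ.^ j) b) (*-exchange k (suc N ℕ.^ j) a) (ℕ.*-monoʳ-≤ k q)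

module Integration {ℜ : CompleteOrderedField} (M : RealCommutativeMonoid ℜ) where
  open CompleteOrderedField ℜ
  open RealArithmetic ℜ
  open Algorithm M
  open BigSum ℕ.+-0-commutativeMonoid
  open CommutativeRing commutativeRing using (+-assoc; +-comm; +-identityʳ; -‿inverseˡ)
  open IsDecTotalOrder isDecTotalOrder using ()
    renaming (refl to ≤-refl; trans to ≤-trans; reflexive to ≤-reflexive)

  ≤ᴿ⁻ : ∀ {x y} → (x ≤ᴿ y) ≡ true → x ≤ y
  ≤ᴿ⁻ {x} {y} h with x ≤? y
  ... | yes p = p

  ≤ᴿ⁺ : ∀ {x y} → x ≤ y → (x ≤ᴿ y) ≡ true
  ≤ᴿ⁺ {x} {y} = dec-true (x ≤? y)

  ≰ᴿ⁻ : ∀ {x y} → (x ≤ᴿ y) ≡ false → ¬ (x ≤ y)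
  ≰ᴿ⁻ {x} {y} h with x ≤? y
  ... | no p = p

  -- A sketch is treated as a finite measure on ℝ. Sketches are compared through integrals, to which
  -- the order and the repetition of entries are invisible.
  ∫ : Sketch → (ℝ → ℕ) → ℕ
  ∫ S φ = ∑ S λ e → proj₂ e ℕ.* φ (proj₁ e)

  mass : Sketch → ℕ
  mass S = ∫ S λ _ → 1

  upTo : ℝ → ℝ → ℕ
  upTo L v = if v ≤ᴿ L then 1 else 0

  ∫-cong : ∀ S {φ ψ} → (∀ v → φ v ≡ ψ v) → ∫ S φ ≡ ∫ S ψ
  ∫-cong S h = ∑-cong S λ e _ → cong (proj₂ e ℕ.*_) (h (proj₁ e))

  ∫-∑ : ∀ {A : Set} S (xs : List A) (f : ℝ → A → ℕ) → ∫ S (λ v → ∑ xs (f v)) ≡ ∑ xs (λ x → ∫ S (λ v → f v x))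
  ∫-∑ S xs f = trans (∑-cong S λ e _ → *-∑ (proj₂ e) xs (f (proj₁ e))) (∑-swap S xs _)

  ∫-if : ∀ S b (φ : ℝ → ℕ) → ∫ S (λ v → if b then φ v else 0) ≡ (if b then ∫ S φ else 0)
  ∫-if S true  φ = refl
  ∫-if S false φ = ∑-𝟘 S λ e _ → ℕ.*-zeroʳ (proj₂ e)

  ∫-* : ∀ S k (φ : ℝ → ℕ) → ∫ S (λ v → k ℕ.* φ v) ≡ k ℕ.* ∫ S φ
  ∫-* S k φ = trans (∑-cong S λ e _ → *-exchange (proj₂ e) k (φ (proj₁ e))) (sym (*-∑ k S _))

  ∫-swap : ∀ S S′ (φ : ℝ → ℝ → ℕ) → ∫ S (λ v → ∫ S′ (φ v)) ≡ ∫ S′ (λ w → ∫ S (λ v → φ v w))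
  ∫-swap S S′ φ = trans (∫-∑ S S′ (λ v e → proj₂ e ℕ.* φ v (proj₁ e)))
    (∑-cong S′ λ e _ → ∫-* S (proj₂ e) (λ v → φ v (proj₁ e)))

  ∫-times : ∀ S S′ φ → ∫ (times (S , S′)) φ ≡ ∫ S (λ v → ∫ S′ (λ w → φ (v + w)))
  ∫-times S S′ φ = trans
    (∑->>= S (λ a → mapᶠ S′ λ b → proj₁ a + proj₁ b , proj₂ a ℕ.* proj₂ b) (λ e → proj₂ e ℕ.* φ (proj₁ e)))
    (∑-cong S λ a _ → trans
      (∑-mapᶠ S′ (λ b → proj₁ a + proj₁ b , proj₂ a ℕ.* proj₂ b) (λ e → proj₂ e ℕ.* φ (proj₁ e)))
    (trans (∑-cong S′ λ b _ → ℕ.*-assoc (proj₂ a) (proj₂ b) _) (sym (*-∑ (proj₂ a) S′ _))))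

  ∫-matching : ∀ x r φ → ∫ (matching (x , r)) φ ≡
               ∑ (proj₂ x) (λ e → if consistent (proj₁ e , r) then ∫ (proj₂ e) φ else 0)
  ∫-matching x r φ = trans (∑->>= (proj₂ x) (λ e → if consistent (proj₁ e , r) then proj₂ e else []) _)
    (∑-cong (proj₂ x) λ e _ → push (consistent (proj₁ e , r)) (proj₂ e))
    where
    push : ∀ b S → ∫ (if b then S else []) φ ≡ (if b then ∫ S φ else 0)
    push true  S = refl
    push false S = refl

  -- Only half-lines are compared: thinning moves mass to larger reals and may drop some at the end,
  -- so multiplicities of single reals are not even approximately preserved.
  Coarsening : ℕ → Sketch → Sketch → Set
  Coarsening N S′ S = ∀ L → Approx N 1 (∫ S′ (upTo L)) (∫ S (upTo L))

  -- The functions that can be integrated against a coarsening; they contain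
  -- the indicators of half-lines, and combinations of these.
  Tame : (ℝ → ℕ) → Set
  Tame φ = ∀ N S′ S → Coarsening N S′ S → Approx N 1 (∫ S′ φ) (∫ S φ)

  tame-cong : ∀ {φ ψ} → (∀ v → φ v ≡ ψ v) → Tame φ → Tame ψ
  tame-cong h t N S′ S c = subst₂ (Approx N 1) (∫-cong S′ h) (∫-cong S h) (t N S′ S c)

  tame-∑ : ∀ {A : Set} (xs : List A) (f : ℝ → A → ℕ) → (∀ x → Tame (λ v → f v x)) → Tame (λ v → ∑ xs (f v))
  tame-∑ xs f t N S′ S c = subst₂ (Approx N 1) (sym (∫-∑ S′ xs f)) (sym (∫-∑ S xs f))
    (approx-∑ {N} {1} xs λ x _ → t x N S′ S c)

  tame-* : ∀ k {φ} → Tame φ → Tame (λ v → k ℕ.* φ v)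
  tame-* k {φ} t N S′ S c = subst₂ (Approx N 1) (sym (∫-* S′ k φ)) (sym (∫-* S k φ)) (approx-* {N} {1} k (t N S′ S c))

  tame-if : ∀ b {φ} → Tame φ → Tame (λ v → if b then φ v else 0)
  tame-if true  t = t
  tame-if false t N S′ S c = subst₂ (Approx N 1) (sym (∫-if S′ false (λ _ → 0))) (sym (∫-if S false (λ _ → 0))) (approx-refl {N} 1)

  upTo-+ : ∀ L u v → upTo L (v + u) ≡ upTo (L - u) v
  upTo-+ L u v = cong (if_then 1 else 0) (⇔→≡
    (λ h → ≤ᴿ⁺ (subst (_≤ L - u) (+-cancel-minus v u) (+-monoˡ-≤ (- u) (≤ᴿ⁻ h))))
    (λ h → ≤ᴿ⁺ (subst (v + u ≤_) restore (+-monoˡ-≤ u (≤ᴿ⁻ h)))))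
    where
    restore : L - u + u ≡ L
    restore = trans (+-assoc L (- u) u) (trans (cong (L +_) (-‿inverseˡ u)) (+-identityʳ L))

  tame-upTo : ∀ L u → Tame (λ v → upTo L (v + u))
  tame-upTo L u = tame-cong (λ v → sym (upTo-+ L u v)) λ N S′ S c → c (L - u)

  ∫-↭ : ∀ {S S′} φ → S ↭ S′ → ∫ S φ ≡ ∫ S′ φ
  ∫-↭ φ = ∑-↭ λ e → proj₂ e ℕ.* φ (proj₁ e)

  insert-↭ : ∀ e S → insert (e , S) ↭ e ∷ S
  insert-↭ e []      = ↭-refl
  insert-↭ e (y ∷ S) with insert (e , S) | insert-↭ e S
  ... | []    | p = contradiction (Perm.↭-length p) λ ()
  ... | h ∷ t | p with proj₁ h ≤ᴿ proj₁ y
  ...   | true  = ↭-trans (prep y p) (swap y e ↭-refl)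
  ...   | false = ↭-trans (swap h y ↭-refl) (↭-trans (prep y p) (swap y e ↭-refl))

  sort-↭ : ∀ S → sort S ↭ S
  sort-↭ []      = ↭-refl
  sort-↭ (e ∷ S) = ↭-trans (insert-↭ e (sort S)) (prep e (sort-↭ S))

  Below : ℝ → Sketch → Set
  Below v S = ∀ {e} → e ∈ S → proj₁ e ≤ v

  data Descending : Sketch → Set where
    []  : Descending []
    _∷_ : ∀ {e S} → Below (proj₁ e) S → Descending S → Descending (e ∷ S)

  below-∷ : ∀ {v e S} → proj₁ e ≤ v → Below v S → Below v (e ∷ S)
  below-∷ p b (here refl) = p
  below-∷ p b (there q)   = b q

  -- The second part identifies the head. A head that exceeds `y` cannot come from the remaining
  -- list, which `y` bounds, so it is the new entry `e` and the tail is unchanged.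
  insert-descending : ∀ e S → Descending S → Descending (insert (e , S)) ×
    (insert (e , S) ≡ e ∷ S ⊎ (∃[ h ] ∃[ t ] insert (e , S) ≡ h ∷ t × h ∈ S × Below (proj₁ h) (e ∷ S)))
  insert-descending e []      d       = ((λ ()) ∷ []) , inj₁ refl
  insert-descending e (y ∷ S) (b ∷ d) with insert (e , S) | insert-descending e S d | insert-↭ e S
  ... | []    | _       | p = contradiction (Perm.↭-length p) λ ()
  ... | h ∷ t | (c ∷ f) , k | p with proj₁ h ≤ᴿ proj₁ y in eq
  ...   | true  = (below-∷ (≤ᴿ⁻ eq) (λ q → ≤-trans (c q) (≤ᴿ⁻ eq)) ∷ (c ∷ f)) ,
                  inj₂ (y , h ∷ t , refl , here refl ,
                        below-∷ (below-h∷t (Perm.∈-resp-↭ (↭-sym p) (here refl))) (below-∷ ≤-refl b))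
    where
    below-h∷t : Below (proj₁ y) (h ∷ t)
    below-h∷t = below-∷ (≤ᴿ⁻ eq) (λ q → ≤-trans (c q) (≤ᴿ⁻ eq))
  ...   | false with k
  ...     | inj₁ refl = (below-∷ (≰⇒≥ (≰ᴿ⁻ eq)) (λ q → ≤-trans (b q) (≰⇒≥ (≰ᴿ⁻ eq))) ∷ (b ∷ d)) , inj₁ refl
  ...     | inj₂ (_ , _ , refl , h∈ , _) = contradiction (b h∈) (≰ᴿ⁻ eq)

  sort-descending : ∀ S → Descending (sort S)
  sort-descending []      = []
  sort-descending (e ∷ S) = proj₁ (insert-descending e (sort S) (sort-descending S))

  upTo-below : ∀ {L S} → Below L S → ∫ S (upTo L) ≡ mass S
  upTo-below {L} {S} b = ∑-cong S λ e e∈ → cong (λ c → proj₂ e ℕ.* (if c then 1 else 0)) (≤ᴿ⁺ (b e∈))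

  record Thinned (N : ℕ) (S : Sketch) (c a : ℕ) (out : Sketch) : Set where
    field
      read    : c ≡ mass S
      emitted : a ≡ mass out
      close   : a ℕ.≤ c × N ℕ.* c ℕ.≤ N ℕ.* a ℕ.+ a
      coarse  : Coarsening N out S
      values  : ∀ {v} → Below v S → Below v out

  -- As entries arrive in increasing order, a threshold L leaves two cases. If it lies below the
  -- newest entry, that entry does not count and induction applies. Otherwise everything read lies
  -- below L, both integrals are full masses, and `close` compares them.
  thinned : ∀ N S → Descending S → let c , (a , out) = foldr (λ e → thin (N , e)) (0 , (0 , [])) S in Thinned N S c a out
  thinned N []      d = record
    { read = refl ; emitted = refl ; close = z≤n , ℕ.≤-trans (ℕ.≤-reflexive (ℕ.*-zeroʳ N)) z≤n
    ; coarse = λ L → approx-refl {N} 1 ; values = λ b () }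
  thinned N (e ∷ S) (b ∷ d) with foldr (λ e → thin (N , e)) (0 , (0 , [])) S | thinned N S d
  ... | c , (a , out) | ih with N ℕ.* (c ℕ.+ proj₂ e) ℕ.≤ᵇ N ℕ.* a ℕ.+ a in eq
  ...   | true  = record
    { read    = read′
    ; emitted = emitted
    ; close   = close′
    ; coarse  = λ L → coarse′ L
    ; values  = λ b′ → values (b′ ∘ there)
    }
    where
    open Thinned ih
    read′ : c ℕ.+ proj₂ e ≡ mass (e ∷ S)
    read′ = trans (ℕ.+-comm c (proj₂ e)) (cong₂ ℕ._+_ (sym (ℕ.*-identityʳ (proj₂ e))) read)
    close′ : a ℕ.≤ c ℕ.+ proj₂ e × N ℕ.* (c ℕ.+ proj₂ e) ℕ.≤ N ℕ.* a ℕ.+ a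
    close′ = ℕ.≤-trans (proj₁ close) (ℕ.m≤m+n c _) , ℕ.≤ᵇ⇒≤ _ _ (subst T (sym eq) tt)
    coarse′ : Coarsening N out (e ∷ S)
    coarse′ L with proj₁ e ≤ᴿ L in eq′
    ... | false = subst (Approx N 1 _) (cong (ℕ._+ ∫ S (upTo L)) (sym (ℕ.*-zeroʳ (proj₂ e)))) (coarse L)
    ... | true  = subst₂ (Approx N 1) (trans emitted (sym (upTo-below (values below))))
      (trans read′ (cong (proj₂ e ℕ.* 1 ℕ.+_) (sym (upTo-below below))))
      (proj₁ close′ , subst₂ ℕ._≤_ (cong (ℕ._* (c ℕ.+ proj₂ e)) (sym (ℕ.*-identityʳ N)))
        (trans (ℕ.+-comm (N ℕ.* a) a) (cong (ℕ._* a) (sym (ℕ.*-identityʳ (suc N))))) (proj₂ close′))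
      where
      below : Below L S
      below q = ≤-trans (b q) (≤ᴿ⁻ eq′)
  ...   | false = record
    { read    = read′
    ; emitted = emitted′
    ; close   = ℕ.≤-refl , ℕ.m≤m+n _ _
    ; coarse  = λ L → coarse′ L
    ; values  = λ b′ → below-∷ (b′ (here refl)) (values (b′ ∘ there))
    }
    where
    open Thinned ih
    c′ = c ℕ.+ proj₂ e
    a≤c′ : a ℕ.≤ c′
    a≤c′ = ℕ.≤-trans (proj₁ close) (ℕ.m≤m+n c _)
    read′ : c′ ≡ mass (e ∷ S)
    read′ = trans (ℕ.+-comm c (proj₂ e)) (cong₂ ℕ._+_ (sym (ℕ.*-identityʳ (proj₂ e))) read)
    emitted′ : c′ ≡ mass ((proj₁ e , c′ ℕ.∸ a) ∷ out)
    emitted′ = trans (sym (ℕ.m∸n+n≡m a≤c′)) (cong₂ ℕ._+_ (sym (ℕ.*-identityʳ (c′ ℕ.∸ a))) emitted)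
    coarse′ : Coarsening N ((proj₁ e , c′ ℕ.∸ a) ∷ out) (e ∷ S)
    coarse′ L with proj₁ e ≤ᴿ L in eq′
    ... | false = subst₂ (Approx N 1) (cong (ℕ._+ ∫ out (upTo L)) (sym (ℕ.*-zeroʳ (c′ ℕ.∸ a))))
      (cong (ℕ._+ ∫ S (upTo L)) (sym (ℕ.*-zeroʳ (proj₂ e)))) (coarse L)
    ... | true  = subst₂ (Approx N 1)
      (trans emitted′ (cong ((c′ ℕ.∸ a) ℕ.* 1 ℕ.+_) (sym (upTo-below (values below)))))
      (trans read′ (cong (proj₂ e ℕ.* 1 ℕ.+_) (sym (upTo-below below)))) (approx-refl {N} 1)
      where
      below : Below L S
      below q = ≤-trans (b q) (≤ᴿ⁻ eq′)

  compress-coarsening : ∀ N S → Coarsening N (compress (N , S)) S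
  compress-coarsening N S L = subst (Approx N 1 _) (∫-↭ (upTo L) (sort-↭ S))
    (Thinned.coarse (thinned N (sort S) (sort-descending S)) L)

-- Ears, absorption and the sum over consistent choices of rows

module Elimination {ℜ : CompleteOrderedField} (M : RealCommutativeMonoid ℜ) where
  open CompleteOrderedField ℜ
  open Algorithm M
  open Lengths M
  open Integration M
  open BigSum ℕ.+-0-commutativeMonoid
  open CommutativeRing commutativeRing using (+-assoc; +-comm; +-identityʳ)
  open IsDecTotalOrder isDecTotalOrder using (antisym) renaming (reflexive to ≤-reflexive)

  sameKey⁻ : ∀ {k l} → sameKey (k , l) ≡ true → k ≡ l
  sameKey⁻ {k} {l} h with k ℕ.≤ᵇ l in eq
  ... | true = ℕ.≤-antisym (ℕ.≤ᵇ⇒≤ k l (subst T (sym eq) tt)) (ℕ.≤ᵇ⇒≤ l k (subst T (sym h) tt))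

  T⇒≡ : ∀ {b} → T b → b ≡ true
  T⇒≡ {true} _ = refl

  sameKey⁺ : ∀ k → sameKey (k , k) ≡ true
  sameKey⁺ k = trans (if-true self) self
    where
    self : (k ℕ.≤ᵇ k) ≡ true
    self = T⇒≡ (ℕ.≤⇒≤ᵇ (ℕ.≤-refl {k}))

  sameReal⁻ : ∀ {x y} → sameReal (x , y) ≡ true → x ≡ y
  sameReal⁻ {x} {y} h with x ≤ᴿ y in eq
  ... | true = antisym (≤ᴿ⁻ eq) (≤ᴿ⁻ h)

  sameReal⁺ : ∀ x → sameReal (x , x) ≡ true
  sameReal⁺ x = trans (if-true self) self
    where
    self : (x ≤ᴿ x) ≡ true
    self = ≤ᴿ⁺ (≤-reflexive refl)

  hasKey⁻ : ∀ {k ks} → hasKey (k , ks) ≡ true → k ∈ ks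
  hasKey⁻ {k} {ks} h with some⁻ ks (λ l → sameKey (k , l)) h
  ... | l , l∈ , q = subst (_∈ ks) (sym (sameKey⁻ q)) l∈

  hasKey⁺ : ∀ {k ks} → k ∈ ks → hasKey (k , ks) ≡ true
  hasKey⁺ {k} {ks} k∈ = some⁺ ks (λ l → sameKey (k , l)) k∈ (sameKey⁺ k)

  Compatible : Row → Row → Set
  Compatible r s = ∀ {k v w} → (k , v) ∈ r → (k , w) ∈ s → v ≡ w

  consistent⁻ : ∀ {r s} → consistent (r , s) ≡ true → Compatible r s
  consistent⁻ {r} {s} h {k} {v} {w} p q = sameReal⁻ (trans (sym (if-true (sameKey⁺ k)))
    (every⁻ s (λ e′ → if sameKey (k , proj₁ e′) then sameReal (v , proj₂ e′) else true)
      (every⁻ r (λ e → every s λ e′ → if sameKey (proj₁ e , proj₁ e′) then sameReal (proj₂ e , proj₂ e′) else true) h p) q))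

  consistent⁺ : ∀ {r s} → Compatible r s → consistent (r , s) ≡ true
  consistent⁺ {r} {s} h = every⁺ r _ λ {e} e∈ → every⁺ s _ λ {e′} e∈′ → test e∈ e∈′
    where
    test : ∀ {e e′} → e ∈ r → e′ ∈ s → (if sameKey (proj₁ e , proj₁ e′) then sameReal (proj₂ e , proj₂ e′) else true) ≡ true
    test {e} {e′} p q with sameKey (proj₁ e , proj₁ e′) in eq
    ... | false = refl
    ... | true  with sameKey⁻ {proj₁ e} {proj₁ e′} eq
    ...   | refl with h p q
    ...     | refl = sameReal⁺ _

  compatible-sym : ∀ {r s} → Compatible r s → Compatible s r
  compatible-sym h p q = sym (h q p)

  consistent-sym : ∀ r s → consistent (r , s) ≡ consistent (s , r)
  consistent-sym r s = ⇔→≡ (λ h → consistent⁺ (compatible-sym (consistent⁻ {r} {s} h)))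
                           (λ h → consistent⁺ (compatible-sym (consistent⁻ {s} {r} h)))

  agree : Row → List Row → Bool
  agree r ps = every ps λ p → consistent (r , p)

  -- The integral of φ against the multiset of sums that the tables produce
  -- from all choices of one row per table, where the chosen rows agree with
  -- each other and with ps.
  Z : List Row → List SketchedTable → (ℝ → ℕ) → ℕ
  Z ps []       φ = φ 0#
  Z ps (T ∷ Ts) φ = ∑ (proj₂ T) λ e →
    if agree (proj₁ e) ps then ∫ (proj₂ e) (λ v → Z (proj₁ e ∷ ps) Ts (λ w → φ (v + w))) else 0

  if-cong : {A : Set} (b : Bool) {x y z : A} → (b ≡ true → x ≡ y) → (if b then x else z) ≡ (if b then y else z)
  if-cong true  h = h refl
  if-cong false h = refl

  Z-cong : ∀ ps Ts {φ ψ} → (∀ v → φ v ≡ ψ v) → Z ps Ts φ ≡ Z ps Ts ψ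
  Z-cong ps []       h = h 0#
  Z-cong ps (T ∷ Ts) h = ∑-cong (proj₂ T) λ e _ → cong (if agree (proj₁ e) ps then_else 0)
    (∫-cong (proj₂ e) λ v → Z-cong (proj₁ e ∷ ps) Ts λ w → h (v + w))

  Z-agree : ∀ ps qs Ts φ → (∀ T e → T ∈ Ts → e ∈ proj₂ T → agree (proj₁ e) ps ≡ agree (proj₁ e) qs) →
            Z ps Ts φ ≡ Z qs Ts φ
  Z-agree ps qs []       φ h = refl
  Z-agree ps qs (T ∷ Ts) φ h = ∑-cong (proj₂ T) λ e e∈ → cong₂ (if_then_else 0) (h T e (here refl) e∈)
    (∫-cong (proj₂ e) λ v → Z-agree (proj₁ e ∷ ps) (proj₁ e ∷ qs) Ts _ λ U f U∈ f∈ →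
      cong (if consistent (proj₁ f , proj₁ e) then_else false) (h U f (there U∈) f∈))

  -- Fubini, the symmetry of consistency and the commutativity of addition. It lets an ear and its
  -- partner be moved to the front.
  Z-swap : ∀ ps T U Ts φ → Z ps (T ∷ U ∷ Ts) φ ≡ Z ps (U ∷ T ∷ Ts) φ
  Z-swap ps T U Ts φ = begin
    Z ps (T ∷ U ∷ Ts) φ                                  ≡⟨ expand T U ⟩
    ∑ (proj₂ T) (λ e → ∑ (proj₂ U) (λ f → both′ e f))    ≡⟨ ∑-swap (proj₂ T) (proj₂ U) both′ ⟩
    ∑ (proj₂ U) (λ f → ∑ (proj₂ T) (λ e → both′ e f))    ≡⟨ ∑-cong (proj₂ U) (λ f _ → ∑-cong (proj₂ T) λ e _ → both-sym e f) ⟩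
    ∑ (proj₂ U) (λ f → ∑ (proj₂ T) (λ e → both′ f e))    ≡⟨ expand U T ⟨
    Z ps (U ∷ T ∷ Ts) φ                                  ∎
    where
    open ≡-Reasoning
    inner : Row × Sketch → Row × Sketch → ℕ
    inner e f = ∫ (proj₂ e) λ v → ∫ (proj₂ f) λ w → Z (proj₁ f ∷ proj₁ e ∷ ps) Ts λ u → φ (v + (w + u))

    both′ : Row × Sketch → Row × Sketch → ℕ
    both′ e f = if agree (proj₁ e) ps then (if agree (proj₁ f) (proj₁ e ∷ ps) then inner e f else 0) else 0

    expand : ∀ T U → Z ps (T ∷ U ∷ Ts) φ ≡ ∑ (proj₂ T) (λ e → ∑ (proj₂ U) (λ f → both′ e f))
    expand T U = ∑-cong (proj₂ T) λ e _ → trans (cong (if agree (proj₁ e) ps then_else 0)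
      (trans (∫-∑ (proj₂ e) (proj₂ U) λ v f → if agree (proj₁ f) (proj₁ e ∷ ps)
                then ∫ (proj₂ f) (λ w → Z (proj₁ f ∷ proj₁ e ∷ ps) Ts (λ u → φ (v + (w + u)))) else 0)
        (∑-cong (proj₂ U) λ f _ → ∫-if (proj₂ e) (agree (proj₁ f) (proj₁ e ∷ ps)) _)))
      (sym (∑-if (proj₂ U) (agree (proj₁ e) ps) _))

    rotate : ∀ v w u → v + (w + u) ≡ w + (v + u)
    rotate v w u = trans (sym (+-assoc v w u)) (trans (cong (_+ u) (+-comm v w)) (+-assoc w v u))

    inner-sym : ∀ e f → inner e f ≡ inner f e
    inner-sym e f = trans (∫-swap (proj₂ e) (proj₂ f) _) (∫-cong (proj₂ f) λ w → ∫-cong (proj₂ e) λ v →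
      trans (Z-agree (proj₁ f ∷ proj₁ e ∷ ps) (proj₁ e ∷ proj₁ f ∷ ps) Ts _ λ V g _ _ →
              if-exchange (consistent (proj₁ g , proj₁ f)) (consistent (proj₁ g , proj₁ e)))
        (Z-cong (proj₁ e ∷ proj₁ f ∷ ps) Ts λ u → cong φ (rotate v w u)))
      where
      if-exchange : ∀ b c {d} → (if b then (if c then d else false) else false) ≡ (if c then (if b then d else false) else false)
      if-exchange true  true  = refl
      if-exchange true  false = refl
      if-exchange false true  = refl
      if-exchange false false = refl

    both-sym : ∀ e f → both′ e f ≡ both′ f e
    both-sym e f rewrite consistent-sym (proj₁ e) (proj₁ f) | inner-sym e f
      with agree (proj₁ e) ps | agree (proj₁ f) ps | consistent (proj₁ f , proj₁ e)
    ... | true  | true  | true  = refl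
    ... | true  | true  | false = refl
    ... | true  | false | true  = refl
    ... | true  | false | false = refl
    ... | false | true  | true  = refl
    ... | false | true  | false = refl
    ... | false | false | true  = refl
    ... | false | false | false = refl

  Z-∷ : ∀ ps T {Ts Us} → (∀ qs ψ → Z qs Ts ψ ≡ Z qs Us ψ) → ∀ φ → Z ps (T ∷ Ts) φ ≡ Z ps (T ∷ Us) φ
  Z-∷ ps T h φ = ∑-cong (proj₂ T) λ e _ → cong (if agree (proj₁ e) ps then_else 0)
    (∫-cong (proj₂ e) λ v → h (proj₁ e ∷ ps) _)

  Z-↭ : ∀ ps {Ts Us} φ → Ts ↭ Us → Z ps Ts φ ≡ Z ps Us φ
  Z-↭ ps φ reflᵖ                  = refl
  Z-↭ ps φ (prep {xs} {ys} T p)   = Z-∷ ps T {xs} {ys} (λ qs ψ → Z-↭ qs ψ p) φ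
  Z-↭ ps φ (swap {xs} {ys} T U p) = trans (Z-swap ps T U xs φ)
    (Z-∷ ps U {T ∷ xs} {T ∷ ys} (λ qs ψ → Z-∷ qs T {xs} {ys} (λ rs χ → Z-↭ rs χ p) ψ) φ)
  Z-↭ ps φ (transᵖ p q)           = trans (Z-↭ ps φ p) (Z-↭ ps φ q)

  -- The values chosen in other tables translate the integrand, so tameness is required of all
  -- translates at once.
  Shiftable : (ℝ → ℕ) → Set
  Shiftable φ = ∀ u → Tame (λ v → φ (v + u))

  shift : ∀ {φ} u → Shiftable φ → Shiftable (λ w → φ (w + u))
  shift {φ} u h u′ = tame-cong (λ v → cong φ (sym (+-assoc v u′ u))) (h (u′ + u))

  -- For fixed choices in the tables `Ts` the integrand is a translate of `φ`, and `Z` is a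
  -- combination of these with natural coefficients. An error in one sketch therefore passes through
  -- all remaining tables without growing.
  Z-tame : ∀ ps Ts {φ} → Shiftable φ → Tame (λ v → Z ps Ts (λ w → φ (v + w)))
  Z-tame ps []       h = h 0#
  Z-tame ps (T ∷ Ts) {φ} h = tame-∑ (proj₂ T) _ λ e → tame-if (agree (proj₁ e) ps)
    (tame-∑ (proj₂ e) _ λ a → tame-* (proj₂ a)
      (tame-cong (λ v → Z-cong (proj₁ e ∷ ps) Ts λ w → cong φ (trans (+-assoc v w _) (cong (v +_) (+-comm w _))))
        (Z-tame (proj₁ e ∷ ps) Ts {λ w → φ (w + proj₁ a)} (shift {φ} (proj₁ a) h))))

  upTo-shiftable : ∀ L → Shiftable (upTo L)
  upTo-shiftable L = tame-upTo L

  -- Links the ear test, which sees the column lists of tables, to consistency, which sees the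
  -- entries of rows.
  Keyed : SketchedTable → Set
  Keyed T = ∀ {e} → e ∈ proj₂ T → ∀ {k} → k ∈ proj₁ T ⇔ (∃[ v ] (k , v) ∈ proj₁ e)

  isEar⁻ : ∀ {x y zs} → isEar (x , (y , zs)) ≡ true → ∀ {z} → z ∈ zs → ∀ {k} → k ∈ proj₁ x → k ∈ proj₁ z → k ∈ proj₁ y
  isEar⁻ {x} {y} {zs} h {z} z∈ {k} p q = hasKey⁻ (trans (sym (if-true (hasKey⁺ q)))
    (every⁻ (proj₁ x) (λ k → if hasKey (k , proj₁ z) then hasKey (k , proj₁ y) else true)
      (every⁻ zs (λ z → every (proj₁ x) λ k → if hasKey (k , proj₁ z) then hasKey (k , proj₁ y) else true) h z∈) p))

  isEar⁺ : ∀ {x y zs} → (∀ {z} → z ∈ zs → ∀ {k} → k ∈ proj₁ x → k ∈ proj₁ z → k ∈ proj₁ y) → isEar (x , (y , zs)) ≡ true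
  isEar⁺ {x} {y} {zs} h = every⁺ zs _ λ {z} z∈ → every⁺ (proj₁ x) _ λ {k} k∈ → test z∈ k∈
    where
    test : ∀ {z k} → z ∈ zs → k ∈ proj₁ x → (if hasKey (k , proj₁ z) then hasKey (k , proj₁ y) else true) ≡ true
    test {z} {k} z∈ k∈ with hasKey (k , proj₁ z) in eq
    ... | false = refl
    ... | true  = hasKey⁺ (h z∈ k∈ (hasKey⁻ eq))

  Z-pair : ∀ x y zs φ → Z [] (x ∷ y ∷ zs) φ ≡ ∑ (proj₂ y) λ s → ∫ (proj₂ s) λ v →
           ∑ (proj₂ x) λ r → if consistent (proj₁ r , proj₁ s)
             then ∫ (proj₂ r) (λ w → Z (proj₁ r ∷ proj₁ s ∷ []) zs (λ u → φ (v + (w + u)))) else 0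
  Z-pair x y zs φ = trans (Z-swap [] x y zs φ) (∑-cong (proj₂ y) λ s _ → ∫-cong (proj₂ s) λ v →
    ∑-cong (proj₂ x) λ r _ → one (consistent (proj₁ r , proj₁ s)))
    where
    one : ∀ b {n : ℕ} → (if (if b then true else false) then n else 0) ≡ (if b then n else 0)
    one true  = refl
    one false = refl

  absorbed : SketchedTable → SketchedTable → SketchedTable
  absorbed x y = proj₁ y , mapᶠ (proj₂ y) λ e → proj₁ e , times (proj₂ e , matching (x , proj₁ e))

  -- A row of the ear x that agrees with a row of y agrees with whatever that row agrees with.
  Z-absorbed : ∀ x y zs φ → Keyed x → Keyed y → (∀ {z} → z ∈ zs → Keyed z) → isEar (x , (y , zs)) ≡ true →
               Z [] (x ∷ y ∷ zs) φ ≡ Z [] (absorbed x y ∷ zs) φ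
  Z-absorbed x y zs φ kx ky kz ear = trans (Z-pair x y zs φ) (sym (trans
    (∑-mapᶠ (proj₂ y) (λ e → proj₁ e , times (proj₂ e , matching (x , proj₁ e))) _)
    (∑-cong (proj₂ y) λ s s∈ → trans (∫-times (proj₂ s) (matching (x , proj₁ s)) _) (∫-cong (proj₂ s) λ v →
      trans (∫-matching x (proj₁ s) _) (∑-cong (proj₂ x) λ r r∈ → if-cong (consistent (proj₁ r , proj₁ s)) λ c →
        ∫-cong (proj₂ r) λ w → trans (Z-cong (proj₁ s ∷ []) zs λ u → cong φ (+-assoc v w u))
          (Z-agree (proj₁ s ∷ []) (proj₁ r ∷ proj₁ s ∷ []) zs _ λ z e z∈ e∈ → forget s∈ r∈ c z∈ e∈))))))
    where
    forget : ∀ {s r z e} → s ∈ proj₂ y → r ∈ proj₂ x → consistent (proj₁ r , proj₁ s) ≡ true → z ∈ zs → e ∈ proj₂ z →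
             agree (proj₁ e) (proj₁ s ∷ []) ≡ agree (proj₁ e) (proj₁ r ∷ proj₁ s ∷ [])
    forget {s} {r} {z} {e} s∈ r∈ c z∈ e∈ with consistent (proj₁ e , proj₁ s) in eq
    ... | false = sym (if-same (consistent (proj₁ e , proj₁ r)))
    ... | true  = sym (if-true (consistent⁺ {proj₁ e} {proj₁ r} compatible))
      where
      compatible : Compatible (proj₁ e) (proj₁ r)
      compatible {k} p q with Equivalence.to (ky s∈) (isEar⁻ {x} {y} {zs} ear z∈ (Equivalence.from (kx r∈) (_ , q)) (Equivalence.from (kz z∈ e∈) (_ , p)))
      ... | _ , t = trans (consistent⁻ {proj₁ e} {proj₁ s} eq p t) (sym (consistent⁻ {proj₁ r} {proj₁ s} c q t))

  -- Each summand involves the sketch of a single row of `y`, so thinning all these sketches costs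
  -- one factor 1 + 1/N in total rather than one for every row.
  Z-absorb : ∀ N x y zs {φ} → Shiftable φ → Approx N 1 (Z [] (absorb (N , (x , y)) ∷ zs) φ) (Z [] (absorbed x y ∷ zs) φ)
  Z-absorb N x y zs {φ} h = subst₂ (Approx N 1)
    (sym (∑-mapᶠ (proj₂ y) (λ e → proj₁ e , compress (N , times (proj₂ e , matching (x , proj₁ e)))) _))
    (sym (∑-mapᶠ (proj₂ y) (λ e → proj₁ e , times (proj₂ e , matching (x , proj₁ e))) _))
    (approx-∑ {N} {1} (proj₂ y) λ e _ → Z-tame (proj₁ e ∷ []) zs {φ} h N
      (compress (N , times (proj₂ e , matching (x , proj₁ e)))) (times (proj₂ e , matching (x , proj₁ e)))
      (compress-coarsening N (times (proj₂ e , matching (x , proj₁ e)))))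

  mergeRow : SketchedTable → Row × Sketch → List (Row × Sketch)
  mergeRow x e = proj₂ x >>=′ λ e′ → if consistent (proj₁ e′ , proj₁ e)
    then (append (proj₁ e′) (proj₁ e) , times (proj₂ e , proj₂ e′)) ∷ [] else []

  ∈-append⁻ : ∀ {A : Set} {x : A} xs ys → x ∈ append xs ys → x ∈ xs ⊎ x ∈ ys
  ∈-append⁻ xs ys p = ∈-++⁻ xs (subst (_ ∈_) (append≡++ xs ys) p)

  ∈-append⁺ˡ : ∀ {A : Set} {x : A} {xs ys} → x ∈ xs → x ∈ append xs ys
  ∈-append⁺ˡ {xs = xs} {ys} p = subst (_ ∈_) (sym (append≡++ xs ys)) (∈-++⁺ˡ p)

  ∈-append⁺ʳ : ∀ {A : Set} {x : A} xs {ys} → x ∈ ys → x ∈ append xs ys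
  ∈-append⁺ʳ xs {ys} p = subst (_ ∈_) (sym (append≡++ xs ys)) (∈-++⁺ʳ xs p)

  consistent-append : ∀ t r s → consistent (t , append r s) ≡ (if consistent (t , r) then consistent (t , s) else false)
  consistent-append t r s = ⇔→≡ to from
    where
    to : consistent (t , append r s) ≡ true → (if consistent (t , r) then consistent (t , s) else false) ≡ true
    to h rewrite consistent⁺ {t} {r} (λ p q → consistent⁻ {t} {append r s} h p (∈-append⁺ˡ q)) =
      consistent⁺ {t} {s} λ p q → consistent⁻ {t} {append r s} h p (∈-append⁺ʳ r q)
    from : (if consistent (t , r) then consistent (t , s) else false) ≡ true → consistent (t , append r s) ≡ true
    from h with consistent (t , r) in eq
    ... | true = consistent⁺ {t} {append r s} λ p q →
      [ (λ q′ → consistent⁻ {t} {r} eq p q′) , (λ q′ → consistent⁻ {t} {s} h p q′) ]′ (∈-append⁻ r s q)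

  Z-merge : ∀ x y zs φ → Z [] (x ∷ y ∷ zs) φ ≡ Z [] (merge (x , y) ∷ zs) φ
  Z-merge x y zs φ = trans (Z-pair x y zs φ) (sym (trans (∑->>= (proj₂ y) (mergeRow x) rest)
    (∑-cong (proj₂ y) λ s _ → trans (∑->>= (proj₂ x) (mergeOne s) rest)
      (trans (∑-cong (proj₂ x) λ r _ → single (consistent (proj₁ r , proj₁ s)) s r)
        (trans (∑-cong (proj₂ x) λ r _ → trans (if-cong (consistent (proj₁ r , proj₁ s)) λ _ → joined s r)
                  (sym (∫-if (proj₂ s) (consistent (proj₁ r , proj₁ s)) _)))
          (sym (∫-∑ (proj₂ s) (proj₂ x) λ v r → if consistent (proj₁ r , proj₁ s)
             then ∫ (proj₂ r) (λ w → Z (proj₁ r ∷ proj₁ s ∷ []) zs (λ u → φ (v + (w + u)))) else 0)))))))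
    where
    mergeOne : Row × Sketch → Row × Sketch → List (Row × Sketch)
    mergeOne s r = if consistent (proj₁ r , proj₁ s)
      then (append (proj₁ r) (proj₁ s) , times (proj₂ s , proj₂ r)) ∷ [] else []

    rest : Row × Sketch → ℕ
    rest e = ∫ (proj₂ e) λ v → Z (proj₁ e ∷ []) zs λ w → φ (v + w)

    single : ∀ b s r → ∑ (if b then (append (proj₁ r) (proj₁ s) , times (proj₂ s , proj₂ r)) ∷ [] else []) rest
                     ≡ (if b then rest (append (proj₁ r) (proj₁ s) , times (proj₂ s , proj₂ r)) else 0)
    single true  s r = ℕ.+-identityʳ _
    single false s r = refl

    joined : ∀ s r → rest (append (proj₁ r) (proj₁ s) , times (proj₂ s , proj₂ r)) ≡
             ∫ (proj₂ s) λ v → ∫ (proj₂ r) λ w → Z (proj₁ r ∷ proj₁ s ∷ []) zs λ u → φ (v + (w + u))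
    joined s r = trans (∫-times (proj₂ s) (proj₂ r) _) (∫-cong (proj₂ s) λ v → ∫-cong (proj₂ r) λ w →
      trans (Z-cong (append (proj₁ r) (proj₁ s) ∷ []) zs λ u → cong φ (+-assoc v w u))
        (Z-agree (append (proj₁ r) (proj₁ s) ∷ []) (proj₁ r ∷ proj₁ s ∷ []) zs _ λ _ e _ _ →
          agree-append (proj₁ e) (proj₁ r) (proj₁ s)))
      where
      agree-append : ∀ t r s → agree t (append r s ∷ []) ≡ agree t (r ∷ s ∷ [])
      agree-append t r s rewrite consistent-append t r s with consistent (t , r) | consistent (t , s)
      ... | true  | true  = refl
      ... | true  | false = refl
      ... | false | c     = refl

  AllKeyed : List SketchedTable → Set
  AllKeyed Ts = ∀ {T} → T ∈ Ts → Keyed T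

  keyed-absorb : ∀ N x y → Keyed y → Keyed (absorb (N , (x , y)))
  keyed-absorb N x y ky e∈ with ∈-mapᶠ⁻ (proj₂ y) (λ e → proj₁ e , compress (N , times (proj₂ e , matching (x , proj₁ e)))) e∈
  ... | s , s∈ , refl = ky s∈

  keyed-merge : ∀ x y → Keyed x → Keyed y → Keyed (merge (x , y))
  keyed-merge x y kx ky e∈ {k} with ∈->>=⁻ (proj₂ y) (mergeRow x) e∈
  ... | s , s∈ , p with ∈->>=⁻ (proj₂ x) (λ e′ → if consistent (proj₁ e′ , proj₁ s)
                             then (append (proj₁ e′) (proj₁ s) , times (proj₂ s , proj₂ e′)) ∷ [] else []) p
  ...   | r , r∈ , q with consistent (proj₁ r , proj₁ s)
  keyed-merge x y kx ky e∈ {k} | s , s∈ , p | r , r∈ , here refl | true = mk⇔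
    (λ k∈ → [ (λ h → let v , h′ = Equivalence.to (kx r∈) h in v , ∈-append⁺ˡ h′)
            , (λ h → let v , h′ = Equivalence.to (ky s∈) h in v , ∈-append⁺ʳ (proj₁ r) h′) ]′ (∈-append⁻ (proj₁ x) (proj₁ y) k∈))
    (λ (v , h) → [ (λ h′ → ∈-append⁺ˡ (Equivalence.from (kx r∈) (v , h′)))
                 , (λ h′ → ∈-append⁺ʳ (proj₁ x) (Equivalence.from (ky s∈) (v , h′))) ]′ (∈-append⁻ (proj₁ r) (proj₁ s) h))

  record Reduction (N : ℕ) (Ts Us : List SketchedTable) : Set where
    field
      keyed  : AllKeyed Us
      -- The predecessor, except that lists of length 0 and 1 keep their length.
      shrunk : length Us ≡ (length Ts ℕ.∸ 1) ℕ.⊔ (1 ℕ.⊓ length Ts)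
      approx : ∀ {φ} → Shiftable φ → Approx N 1 (Z [] Us φ) (Z [] Ts φ)

  reduction : ∀ N Ts → AllKeyed Ts → Reduction N Ts (reduce (N , Ts))
  reduction N []       k = record { keyed = k ; shrunk = refl ; approx = λ _ → approx-refl {N} 1 }
  reduction N (x ∷ []) k = record { keyed = k ; shrunk = refl ; approx = λ _ → approx-refl {N} 1 }
  reduction N Ts@(x ∷ y ∷ ys) k with select (pairs Ts) isEar in eq
  ... | [] = record
    { keyed  = λ { (here refl) → keyed-merge x y (k (here refl)) (k (there (here refl))) ; (there p) → k (there (there p)) }
    ; shrunk = sym (ℕ.m≥n⇒m⊔n≡m (s≤s z≤n))
    ; approx = λ {φ} _ → subst (λ n → Approx N 1 n (Z [] Ts φ)) (Z-merge x y ys φ) (approx-refl {N} 1)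
    }
  ... | (u , (v , ws)) ∷ _ with ∈-select⁻ (pairs Ts) isEar (subst ((u , (v , ws)) ∈_) (sym eq) (here refl))
  ...   | p∈ , ear = record
    { keyed  = λ { (here refl) → keyed-absorb N u v (k′ (there (here refl))) ; (there p) → k′ (there (there p)) }
    ; shrunk = trans (ℕ.suc-injective (Perm.↭-length perm)) (sym (ℕ.m≥n⇒m⊔n≡m (s≤s z≤n)))
    ; approx = λ {φ} h → subst (Approx N 1 _) (trans (sym (Z-absorbed u v ws φ (k′ (here refl)) (k′ (there (here refl)))
        (λ z∈ → k′ (there (there z∈))) ear)) (Z-↭ [] φ perm)) (Z-absorb N u v ws {φ} h)
    }
    where
    perm : u ∷ v ∷ ws ↭ Ts
    perm = pairs-↭ Ts p∈
    k′ : AllKeyed (u ∷ v ∷ ws)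
    k′ T∈ = k (Perm.∈-resp-↭ perm T∈)

  reduceAll-steps : ∀ N Ts (Us : List SketchedTable) → AllKeyed Ts → let Vs = foldr (λ _ Vs → reduce (N , Vs)) Ts Us in
    AllKeyed Vs × (1 ℕ.≤ length Ts → length Vs ≡ (length Ts ℕ.∸ length Us) ℕ.⊔ 1) ×
    (∀ {φ} → Shiftable φ → Approx N (length Us) (Z [] Vs φ) (Z [] Ts φ))
  reduceAll-steps N Ts []       k = k , (λ l → sym (ℕ.m≥n⇒m⊔n≡m l)) , λ _ → approx-refl {N} 0
  reduceAll-steps N Ts (U ∷ Us) k with reduceAll-steps N Ts Us k
  ... | k′ , l , a = R.keyed , (λ 1≤ → trans R.shrunk (trans (cong (λ n → (n ℕ.∸ 1) ℕ.⊔ (1 ℕ.⊓ n)) (l 1≤)) (arith (length Ts) (length Us)))) ,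
    λ {φ} h → approx-trans {N} {1} {length Us} (R.approx {φ} h) (a {φ} h)
    where
    module R = Reduction (reduction N (foldr (λ _ Vs → reduce (N , Vs)) Ts Us) k′)
    arith : ∀ m n → ((m ℕ.∸ n) ℕ.⊔ 1 ℕ.∸ 1) ℕ.⊔ (1 ℕ.⊓ ((m ℕ.∸ n) ℕ.⊔ 1)) ≡ (m ℕ.∸ suc n) ℕ.⊔ 1
    arith zero    zero    = refl
    arith zero    (suc n) = refl
    arith (suc m) (suc n) = arith m n
    arith (suc zero)    zero = refl
    arith (suc (suc m)) zero = refl

  count-∫ : ∀ L S → count (L , S) ≡ ∫ S (upTo L)
  count-∫ L []      = refl
  count-∫ L (e ∷ S) with proj₁ e ≤ᴿ L
  ... | true  = cong₂ ℕ._+_ (sym (ℕ.*-identityʳ (proj₂ e))) (count-∫ L S)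
  ... | false = trans (count-∫ L S) (cong (ℕ._+ ∫ S (upTo L)) (sym (ℕ.*-zeroʳ (proj₂ e))))

  -- A factor 1 + 1/N is charged for each of the `length Ts` rounds, including rounds that cause no
  -- error. On the one table left, `Z` is a plain sum of masses.
  tally-approx : ∀ N L Ts → AllKeyed Ts → 1 ℕ.≤ length Ts → Approx N (length Ts) (tally (N , (L , Ts))) (Z [] Ts (upTo L))
  tally-approx N L Ts k 1≤ with reduceAll (N , Ts) | reduceAll-steps N Ts Ts k
  ... | Us | _ , l , a with trans (l 1≤) (cong (ℕ._⊔ 1) (ℕ.n∸n≡0 (length Ts)))
  tally-approx N L Ts k 1≤ | T ∷ [] | _ , l , a | refl = subst (λ n → Approx N (length Ts) n (Z [] Ts (upTo L)))
    (∑-cong (proj₂ T) λ e _ → trans (∫-cong (proj₂ e) λ v → cong (upTo L) (+-identityʳ v)) (sym (count-∫ L (proj₂ e))))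
    (a {upTo L} (upTo-shiftable L))

-- Counting rows of the join

-- A copy of a commutative monoid whose equality is a record, so that the
-- elements related by a proof can be inferred from its type.
module Rigid (𝓒 : CommutativeMonoid 0ℓ 0ℓ) where
  open CommutativeMonoid 𝓒 using (Carrier; _≈_; _∙_) renaming (ε to 𝟘)
  private
    module C = CommutativeMonoid 𝓒

  record _≋_ (x y : Carrier) : Set where
    constructor rigidly
    field
      plain : x ≈ y

  open _≋_ public

  rigid : CommutativeMonoid 0ℓ 0ℓ
  rigid = record
    { Carrier = Carrier ; _≈_ = _≋_ ; _∙_ = _∙_ ; ε = 𝟘
    ; isCommutativeMonoid = record
      { isMonoid = record
        { isSemigroup = record
          { isMagma = record
            { isEquivalence = record
              { refl = rigidly C.refl ; sym = λ p → rigidly (C.sym (plain p)) ; trans = λ p q → rigidly (C.trans (plain p) (plain q)) }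
            ; ∙-cong = λ p q → rigidly (C.∙-cong (plain p) (plain q)) }
          ; assoc = λ x y z → rigidly (C.assoc x y z) }
        ; identity = (λ x → rigidly (C.identityˡ x)) , (λ x → rigidly (C.identityʳ x)) }
      ; comm = λ x y → rigidly (C.comm x y) } }

  module _ where
    open RawMonoidDefinitions (CommutativeMonoid.rawMonoid rigid) renaming (_×_ to _×ʳ_; sum to sumʳ)
    open RawMonoidDefinitions (CommutativeMonoid.rawMonoid 𝓒) renaming (_×_ to _×ᶜ_; sum to sumᶜ)

    ×-rigid : ∀ k x → k ×ʳ x ≡ k ×ᶜ x
    ×-rigid zero    x = refl
    ×-rigid (suc k) x = cong (x ∙_) (×-rigid k x)

    sum-rigid : ∀ {n} (f : Fin n → Carrier) → sumʳ f ≡ sumᶜ f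
    sum-rigid {zero}  f = refl
    sum-rigid {suc n} f = cong (f zero ∙_) (sum-rigid (f ∘ suc))

-- Copies by repeated doubling

module Copies {ℜ : CompleteOrderedField} (M : RealCommutativeMonoid ℜ) where
  open CompleteOrderedField ℜ
  open RealCommutativeMonoid M
  open Algorithm M
  open Rigid commutativeMonoid using (rigid; ×-rigid)
  open CommutativeMonoid rigid using (_≈_; monoid; ∙-cong; assoc; identityˡ; identityʳ; reflexive)
    renaming (refl to ≈-refl; sym to ≈-sym; trans to ≈-trans)
  open MonoidMult monoid using (×-homo-+)

  copies-+ : ∀ k l x → ((k ℕ.+ l) copiesOf x) ≈ (k copiesOf x) ⊕ (l copiesOf x)
  copies-+ k l x = ≈-trans (reflexive (sym (×-rigid (k ℕ.+ l) x)))
    (≈-trans (×-homo-+ x k l) (reflexive (cong₂ _⊕_ (×-rigid k x) (×-rigid l x))))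

  private
    doubled : ∃ R → List (Row × (ℝ × ∃ R)) → ℕ × (∃ R × List (ℕ × ∃ R))
    doubled x = foldr (λ _ → double) (1 , (x , []))

  double-power : ∀ x rs → proj₁ (doubled x rs) ≡ 2 ℕ.^ length rs
  double-power x []       = refl
  double-power x (r ∷ rs) = cong₂ ℕ._+_ (double-power x rs) (trans (double-power x rs) (sym (ℕ.+-identityʳ _)))

  double-copies : ∀ x rs → proj₁ (proj₂ (doubled x rs)) ≈ (proj₁ (doubled x rs) copiesOf x)
  double-copies x []       = ≈-sym (identityʳ x)
  double-copies x (r ∷ rs) = ≈-trans (∙-cong (double-copies x rs) (double-copies x rs))
    (≈-sym (copies-+ (proj₁ (doubled x rs)) (proj₁ (doubled x rs)) x))

  -- The first power listed is half of the bound on `k`. Whether or not it is spent, what remains is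
  -- less than that power, which is the bound for the rest of the list.
  spend-copies : ∀ x rs k y → k ℕ.< 2 ℕ.^ length rs →
                 proj₂ (foldl spend (k , y) (powers (x , rs))) ≈ y ⊕ (k copiesOf x)
  spend-copies x []       zero    y k<   = ≈-sym (identityʳ y)
  spend-copies x []       (suc k) y (s≤s ())
  spend-copies x (r ∷ rs) k       y k<   with proj₁ (doubled x rs) ℕ.≤ᵇ k in eq
  ... | true  = ≈-trans (spend-copies x rs (k ℕ.∸ p) _ smaller)
    (≈-trans (assoc y _ _) (∙-cong ≈-refl (≈-trans (∙-cong (double-copies x rs) ≈-refl)
      (≈-trans (≈-sym (copies-+ p (k ℕ.∸ p) x)) (reflexive (cong (_copiesOf x) (ℕ.m+[n∸m]≡n p≤k)))))))
    where
    p = proj₁ (doubled x rs)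
    p≤k : p ℕ.≤ k
    p≤k = ℕ.≤ᵇ⇒≤ p k (subst T (sym eq) tt)
    smaller : k ℕ.∸ p ℕ.< 2 ℕ.^ length rs
    smaller = ℕ.+-cancelˡ-< p _ _ (subst₂ ℕ._<_ (sym (ℕ.m+[n∸m]≡n p≤k))
      (cong₂ ℕ._+_ (sym (double-power x rs)) (ℕ.+-identityʳ _)) k<)
  ... | false = spend-copies x rs k y
    (subst (k ℕ.<_) (double-power x rs) (ℕ.≰⇒> λ p≤k → subst T eq (ℕ.≤⇒≤ᵇ p≤k)))

  copies-correct : ∀ k x rs → k ℕ.< 2 ℕ.^ length rs → copies (k , (x , rs)) ≈ (k copiesOf x)
  copies-correct k x rs k< = ≈-trans (spend-copies x rs k I₀ k<) (identityˡ _)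

-- Columns, keys and the shares of tables

module Columns {ℜ : CompleteOrderedField} (M : RealCommutativeMonoid ℜ) where
  open CompleteOrderedField ℜ
  open Algorithm M
  open Elimination M

  -- Counting from the end leaves the keys of the later columns unchanged when a column is
  -- prepended, so inductions over the columns need no renumbering.
  keyOf : ∀ {n} → Fin n → ℕ
  keyOf {suc n} zero    = n
  keyOf         (suc c) = keyOf c

  keyOf-< : ∀ {n} (c : Fin n) → keyOf c ℕ.< n
  keyOf-< zero    = ℕ.≤-refl
  keyOf-< (suc c) = ℕ.m≤n⇒m≤1+n (keyOf-< c)

  keyOf-injective : ∀ {n} {c c′ : Fin n} → keyOf c ≡ keyOf c′ → c ≡ c′
  keyOf-injective {c = zero}  {zero}   eq = refl
  keyOf-injective {c = zero}  {suc c′} eq = contradiction (sym eq) (ℕ.<⇒≢ (keyOf-< c′))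
  keyOf-injective {c = suc c} {zero}   eq = contradiction eq (ℕ.<⇒≢ (keyOf-< c))
  keyOf-injective {c = suc c} {suc c′} eq = cong suc (keyOf-injective eq)

  keysOf : ∀ {n} → Subset n → List ℕ
  keysOf []                = []
  keysOf {suc n} (inside ∷ C)  = n ∷ keysOf C
  keysOf {suc n} (outside ∷ C) = keysOf C

  ∈-keysOf⁺ : ∀ {n} {C : Subset n} {c : Fin n} → c ∈ˢ C → keyOf c ∈ keysOf C
  ∈-keysOf⁺ {C = inside ∷ C}  here      = here refl
  ∈-keysOf⁺ {C = inside ∷ C}  (there p) = there (∈-keysOf⁺ p)
  ∈-keysOf⁺ {C = outside ∷ C} (there p) = ∈-keysOf⁺ p

  ∈-keysOf⁻ : ∀ {n} {C : Subset n} {k} → k ∈ keysOf C → Σ (Fin n) λ c → c ∈ˢ C × k ≡ keyOf c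
  ∈-keysOf⁻ {C = inside ∷ C}  (here refl) = zero , here , refl
  ∈-keysOf⁻ {C = inside ∷ C}  (there p)   = let c , c∈ , eq = ∈-keysOf⁻ p in suc c , there c∈ , eq
  ∈-keysOf⁻ {C = outside ∷ C} p           = let c , c∈ , eq = ∈-keysOf⁻ p in suc c , there c∈ , eq

  fullRow : ∀ {n} → Vec ℝ n → Row
  fullRow []              = []
  fullRow {suc n} (x ∷ xs) = (n , x) ∷ fullRow xs

  rowOf : ∀ {n} (C : Subset n) → Vec ℝ ∣ C ∣ → Row
  rowOf []                     []       = []
  rowOf {suc n} (inside ∷ C)  (x ∷ r) = (n , x) ∷ rowOf C r
  rowOf {suc n} (outside ∷ C) r       = rowOf C r

  ∈-fullRow⁺ : ∀ {n} (x : Vec ℝ n) c → (keyOf c , lookup x c) ∈ fullRow x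
  ∈-fullRow⁺ (a ∷ x) zero    = here refl
  ∈-fullRow⁺ (a ∷ x) (suc c) = there (∈-fullRow⁺ x c)

  ∈-fullRow⁻ : ∀ {n} (x : Vec ℝ n) {k v} → (k , v) ∈ fullRow x → Σ (Fin n) λ c → k ≡ keyOf c × v ≡ lookup x c
  ∈-fullRow⁻ (a ∷ x) (here refl) = zero , refl , refl
  ∈-fullRow⁻ (a ∷ x) (there p)   = let c , eq , eq′ = ∈-fullRow⁻ x p in suc c , eq , eq′

  ∈-rowOf⁺ : ∀ {n} (C : Subset n) r {c} → c ∈ˢ C → ∃[ v ] (keyOf c , v) ∈ rowOf C r
  ∈-rowOf⁺ (inside ∷ C)  (v ∷ r) here      = v , here refl
  ∈-rowOf⁺ (inside ∷ C)  (v ∷ r) (there p) = let w , q = ∈-rowOf⁺ C r p in w , there q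
  ∈-rowOf⁺ (outside ∷ C) r       (there p) = ∈-rowOf⁺ C r p

  ∈-rowOf⁻ : ∀ {n} (C : Subset n) r {k v} → (k , v) ∈ rowOf C r → Σ (Fin n) λ c → c ∈ˢ C × k ≡ keyOf c
  ∈-rowOf⁻ []            []      ()
  ∈-rowOf⁻ (inside ∷ C)  (v ∷ r) (here refl) = zero , here , refl
  ∈-rowOf⁻ (inside ∷ C)  (v ∷ r) (there p)   = let c , c∈ , eq = ∈-rowOf⁻ C r p in suc c , there c∈ , eq
  ∈-rowOf⁻ (outside ∷ C) r       p           = let c , c∈ , eq = ∈-rowOf⁻ C r p in suc c , there c∈ , eq

  rowOf-self : ∀ {n} (C : Subset n) r → Compatible (rowOf C r) (rowOf C r)
  rowOf-self []            []      ()          q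
  rowOf-self (inside ∷ C)  (x ∷ r) (here refl) (here refl) = refl
  rowOf-self (inside ∷ C)  (x ∷ r) (here refl) (there q)   =
    let c , _ , eq = ∈-rowOf⁻ C r q in contradiction (sym eq) (ℕ.<⇒≢ (keyOf-< c))
  rowOf-self (inside ∷ C)  (x ∷ r) (there p)   (here refl) =
    let c , _ , eq = ∈-rowOf⁻ C r p in contradiction (sym eq) (ℕ.<⇒≢ (keyOf-< c))
  rowOf-self (inside ∷ C)  (x ∷ r) (there p)   (there q)   = rowOf-self C r p q
  rowOf-self (outside ∷ C) r       p           q           = rowOf-self C r p q

  extends⇒project : ∀ {n} (C : Subset n) x r → Compatible (fullRow x) (rowOf C r) → project C x ≡ r
  extends⇒project []            []      []      h = refl
  extends⇒project (inside ∷ C)  (a ∷ x) (b ∷ r) h = cong₂ _∷_ (h (here refl) (here refl))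
    (extends⇒project C x r λ p q → h (there p) (there q))
  extends⇒project (outside ∷ C) (a ∷ x) r       h = extends⇒project C x r λ p q → h (there p) q

  rowOf-project : ∀ {n} (C : Subset n) x {k v} → (k , v) ∈ rowOf C (project C x) → Σ (Fin n) λ c → k ≡ keyOf c × v ≡ lookup x c
  rowOf-project []            []      ()
  rowOf-project (inside ∷ C)  (a ∷ x) (here refl) = zero , refl , refl
  rowOf-project (inside ∷ C)  (a ∷ x) (there p)   = let c , eq , eq′ = rowOf-project C x p in suc c , eq , eq′
  rowOf-project (outside ∷ C) (a ∷ x) p           = let c , eq , eq′ = rowOf-project C x p in suc c , eq , eq′

  project⇒extends : ∀ {n} (C : Subset n) x → Compatible (fullRow x) (rowOf C (project C x))
  project⇒extends C x p q with ∈-fullRow⁻ x p | rowOf-project C x q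
  ... | c , eq , refl | c′ , eq′ , refl = cong (lookup x) (keyOf-injective (trans (sym eq) eq′))

  columnsFrom : ∀ {n} → (Fin n → Functions) → List (ℕ × Functions)
  columnsFrom {zero}  f = []
  columnsFrom {suc n} f = (n , f zero) ∷ columnsFrom (f ∘ suc)

  describe-tabulate : ∀ {n} (f : Fin n → Functions) → describe (tabulate f) ≡ columnsFrom f
  describe-tabulate {zero}  f = refl
  describe-tabulate {suc n} f = cong₂ _∷_ (cong (_, f zero) (counter f)) (describe-tabulate (f ∘ suc))
    where
    counter : ∀ {n} (f : Fin (suc n) → Functions) →
      proj₁ (foldr (λ f s → suc (proj₁ s) , (proj₁ s , f) ∷ proj₂ s) (0 , []) (tabulate (f ∘ suc))) ≡ n
    counter {zero}  f = refl
    counter {suc n} f = cong suc (counter (f ∘ suc))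

  cells : ∀ {n} → (Fin n → Functions) → Vec ℝ n → List ((ℕ × Functions) × ℝ)
  cells f []              = []
  cells {suc n} f (a ∷ x) = ((n , f zero) , a) ∷ cells (f ∘ suc) x

  cellsIn : ∀ {n} (C : Subset n) → (Fin n → Functions) → Vec ℝ ∣ C ∣ → List ((ℕ × Functions) × ℝ)
  cellsIn C f r = zip (columnsOf (toList C , columnsFrom f)) (toList r)

  keys-columnsOf : ∀ {n} (C : Subset n) (f : Fin n → Functions) → mapᶠ (columnsOf (toList C , columnsFrom f)) proj₁ ≡ keysOf C
  keys-columnsOf []            f = refl
  keys-columnsOf {suc n} (inside ∷ C)  f = cong (n ∷_) (keys-columnsOf C (f ∘ suc))
  keys-columnsOf (outside ∷ C) f = keys-columnsOf C (f ∘ suc)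

  row-cellsIn : ∀ {n} (C : Subset n) (f : Fin n → Functions) r → mapᶠ (cellsIn C f r) (λ e → proj₁ (proj₁ e) , proj₂ e) ≡ rowOf C r
  row-cellsIn []            f []      = refl
  row-cellsIn {suc n} (inside ∷ C)  f (x ∷ r) = cong ((n , x) ∷_) (row-cellsIn C (f ∘ suc) r)
  row-cellsIn (outside ∷ C) f r       = row-cellsIn C (f ∘ suc) r

  hasKey-≡ : ∀ {k ks k′ ks′} → (k ∈ ks → k′ ∈ ks′) → (k′ ∈ ks′ → k ∈ ks) → hasKey (k , ks) ≡ hasKey (k′ , ks′)
  hasKey-≡ {k} {ks} {k′} {ks′} f g = ⇔→≡ (λ h → hasKey⁺ (f (hasKey⁻ {k} {ks} h))) (λ h → hasKey⁺ (g (hasKey⁻ {k′} {ks′} h)))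

  hasKey-∉ : ∀ {k ks} → ¬ (k ∈ ks) → hasKey (k , ks) ≡ false
  hasKey-∉ {k} {ks} n with hasKey (k , ks) in eq
  ... | false = refl
  ... | true  = contradiction (hasKey⁻ eq) n

  ∈-cells-< : ∀ {n} (f : Fin n → Functions) x {e} → e ∈ cells f x → proj₁ (proj₁ e) ℕ.< n
  ∈-cells-< f (a ∷ x) (here refl) = ℕ.≤-refl
  ∈-cells-< f (a ∷ x) (there p)   = ℕ.m≤n⇒m≤1+n (∈-cells-< (f ∘ suc) x p)

  ∈-keysOf-< : ∀ {n} (C : Subset n) {k} → k ∈ keysOf C → k ℕ.< n
  ∈-keysOf-< C p = let c , _ , eq = ∈-keysOf⁻ {C = C} p in subst (ℕ._< _) (sym eq) (keyOf-< c)

  -- A row carries a real for the inequality and an element of R for the value. Both arise from the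
  -- same fold, which is analysed once over an arbitrary commutative monoid.
  module Weights (𝓒 : CommutativeMonoid 0ℓ 0ℓ) (h : Functions → ℝ → CommutativeMonoid.Carrier 𝓒) where
    open CommutativeMonoid 𝓒 renaming (ε to 𝟘; refl to ≈-refl; sym to ≈-sym; trans to ≈-trans)
    open BigSum 𝓒
    open RawMonoidDefinitions rawMonoid using (sum)

    value : (ℕ × Functions) × ℝ → Carrier
    value e = h (proj₂ (proj₁ e)) (proj₂ e)

    weight : List ℕ → List ((ℕ × Functions) × ℝ) → Carrier
    weight seen = foldr (λ e s → if hasKey (proj₁ (proj₁ e) , seen) then s else value e ∙ s) 𝟘

    weight-∑ : ∀ seen es → weight seen es ≈ ∑ es (λ e → if hasKey (proj₁ (proj₁ e) , seen) then 𝟘 else value e)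
    weight-∑ seen []       = ≈-refl
    weight-∑ seen (e ∷ es) with hasKey (proj₁ (proj₁ e) , seen)
    ... | true  = ≈-trans (weight-∑ seen es) (≈-sym (identityˡ _))
    ... | false = ∙-cong ≈-refl (weight-∑ seen es)

    ∑-cellsIn : ∀ {n} (C : Subset n) (f : Fin n → Functions) x (φ : (ℕ × Functions) × ℝ → Carrier) → ∑ (cellsIn C f (project C x)) φ ≈
                ∑ (cells f x) (λ e → if hasKey (proj₁ (proj₁ e) , keysOf C) then φ e else 𝟘)
    ∑-cellsIn []            f []      φ = ≈-refl
    ∑-cellsIn {suc n} (inside ∷ C)  f (a ∷ x) φ = ∙-cong
      (reflexive (sym (if-true (hasKey⁺ {n} {n ∷ keysOf C} (here refl)))))
      (≈-trans (∑-cellsIn C (f ∘ suc) x φ) (∑-cong (cells (f ∘ suc) x) λ e e∈ →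
        reflexive (cong (if_then φ e else 𝟘) (hasKey-≡ {ks = keysOf C} {ks′ = n ∷ keysOf C} there λ
          { (here refl) → contradiction refl (ℕ.<⇒≢ (∈-cells-< (f ∘ suc) x e∈)) ; (there p) → p }))))
    ∑-cellsIn {suc n} (outside ∷ C) f (a ∷ x) φ = ≈-trans (∑-cellsIn C (f ∘ suc) x φ)
      (≈-trans (≈-sym (identityˡ _)) (∙-cong (reflexive (sym (cong (if_then φ ((n , f zero) , a) else 𝟘)
        (hasKey-∉ {n} {keysOf C} λ p → ℕ.<⇒≢ (∈-keysOf-< C p) refl)))) ≈-refl))

    seenWeight : ∀ {n} → List ℕ → (Fin n → Functions) → Vec ℝ n → Carrier
    seenWeight seen f x = ∑ (cells f x) λ e → if hasKey (proj₁ (proj₁ e) , seen) then value e else 𝟘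

    -- A key of the union is either already seen, or new and in `C`. As the two cases exclude each
    -- other, a column shared by several tables is counted once.
    seenWeight-append : ∀ {n} (C : Subset n) (f : Fin n → Functions) x seen → seenWeight (append (keysOf C) seen) f x ≈
                        weight seen (cellsIn C f (project C x)) ∙ seenWeight seen f x
    seenWeight-append C f x seen = ≈-trans (∑-cong (cells f x) λ e _ → pointwise e)
      (≈-trans (∑-∙ (cells f x) _ _)
        (∙-cong (≈-sym (≈-trans (weight-∑ seen (cellsIn C f (project C x)))
          (∑-cellsIn C f x (λ e → if hasKey (proj₁ (proj₁ e) , seen) then 𝟘 else value e)))) ≈-refl))
      where
      pointwise : ∀ e → (if hasKey (proj₁ (proj₁ e) , append (keysOf C) seen) then value e else 𝟘) ≈
        (if hasKey (proj₁ (proj₁ e) , keysOf C) then (if hasKey (proj₁ (proj₁ e) , seen) then 𝟘 else value e) else 𝟘) ∙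
        (if hasKey (proj₁ (proj₁ e) , seen) then value e else 𝟘)
      pointwise e with hasKey (proj₁ (proj₁ e) , keysOf C) in eq | hasKey (proj₁ (proj₁ e) , seen) in eq′
      ... | true  | true  = ≈-trans (reflexive (if-true (hasKey⁺ (∈-append⁺ˡ {xs = keysOf C} (hasKey⁻ eq))))) (≈-sym (identityˡ _))
      ... | true  | false = ≈-trans (reflexive (if-true (hasKey⁺ (∈-append⁺ˡ {xs = keysOf C} (hasKey⁻ eq))))) (≈-sym (identityʳ _))
      ... | false | true  = ≈-trans (reflexive (if-true (hasKey⁺ (∈-append⁺ʳ (keysOf C) (hasKey⁻ eq′))))) (≈-sym (identityˡ _))
      ... | false | false = ≈-trans (reflexive (cong (if_then value e else 𝟘) (hasKey-∉ λ p →
        [ (λ q → absurd eq (hasKey⁺ q)) , (λ q → absurd eq′ (hasKey⁺ q)) ]′ (∈-append⁻ (keysOf C) seen p)))) (≈-sym (identityˡ _))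
        where
        absurd : ∀ {b} → b ≡ false → b ≡ true → ⊥
        absurd refl ()

    seenWeight-[] : ∀ {n} (f : Fin n → Functions) x → seenWeight [] f x ≈ 𝟘
    seenWeight-[] f x = ∑-𝟘 (cells f x) λ _ _ → ≈-refl

    seenWeight-all : ∀ {n} seen (f : Fin n → Functions) x → (∀ (c : Fin n) → keyOf c ∈ seen) →
                     seenWeight seen f x ≈ sum (λ c → h (f c) (lookup x c))
    seenWeight-all seen f []      all = ≈-refl
    seenWeight-all {suc n} seen f (a ∷ x) all = ∙-cong (reflexive (if-true (hasKey⁺ {n} (all zero))))
      (seenWeight-all seen (f ∘ suc) x λ c → all (suc c))

module Joins {ℜ : CompleteOrderedField} (M : RealCommutativeMonoid ℜ) (q : Query M) where
  open CompleteOrderedField ℜ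
  open RealCommutativeMonoid M
  open Query q
  open Algorithm M
  open Lengths M
  open Elimination M
  open Columns M
  open Rigid commutativeMonoid using (rigid)
  open CommutativeRing commutativeRing using (+-commutativeMonoid)
  open BigSum ℕ.+-0-commutativeMonoid

  J : List (Vec ℝ d)
  J = join database

  columns : (i : Fin m) → Subset d
  columns i = Table.columns (table i)

  rows : (i : Fin m) → List (Vec ℝ ∣ columns i ∣)
  rows i = Table.rows (table i)

  functions : Fin d → Functions
  functions c = g c , F c

  -- A table together with the keys of all tables after it, which its share must leave out.
  Marked : Set
  Marked = List ℕ × Fin m

  seenIn : List (Fin m) → List ℕ
  seenIn []       = []
  seenIn (i ∷ is) = append (keysOf (columns i)) (seenIn is)

  marks : List (Fin m) → List Marked
  marks []       = []
  marks (i ∷ is) = (seenIn is , i) ∷ marks is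

  ∈-marks : ∀ {is i} → i ∈ is → ∃[ s ] (s , i) ∈ marks is
  ∈-marks (here refl) = _ , here refl
  ∈-marks (there p)   = let s , p′ = ∈-marks p in s , there p′

  ∈-seenIn : ∀ {is i k} → i ∈ is → k ∈ keysOf (columns i) → k ∈ seenIn is
  ∈-seenIn             (here refl) p = ∈-append⁺ˡ p
  ∈-seenIn {is = j ∷ is} (there q) p = ∈-append⁺ʳ (keysOf (columns j)) (∈-seenIn q p)

  length-marks : ∀ is → length (marks is) ≡ length is
  length-marks []       = refl
  length-marks (i ∷ is) = cong suc (length-marks is)

  allMarks : List Marked
  allMarks = marks (allFin m)

  length-allMarks : length allMarks ≡ m
  length-allMarks = trans (length-marks (allFin m)) (List.length-tabulate {n = m} id)

  module Distribution (𝓒 : CommutativeMonoid 0ℓ 0ℓ) (h : Functions → ℝ → CommutativeMonoid.Carrier 𝓒) where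
    open Weights 𝓒 h public
    open CommutativeMonoid 𝓒 using (_≈_; rawMonoid; ∙-cong) renaming (refl to ≈-refl; sym to ≈-sym; trans to ≈-trans)
    open BigSum 𝓒 using () renaming (∑ to ∑ᶜ)
    open RawMonoidDefinitions rawMonoid using (sum)

    share : Marked → Vec ℝ d → CommutativeMonoid.Carrier 𝓒
    share (s , i) x = weight s (cellsIn (columns i) functions (project (columns i) x))

    ∑-share : ∀ is x → ∑ᶜ (marks is) (λ a → share a x) ≈ seenWeight (seenIn is) functions x
    ∑-share []       x = ≈-sym (seenWeight-[] functions x)
    ∑-share (i ∷ is) x = ≈-trans (∙-cong ≈-refl (∑-share is x))
      (≈-sym (seenWeight-append (columns i) functions x (seenIn is)))

    ∑-share-all : ∀ x → ∑ᶜ allMarks (λ a → share a x) ≈ sum (λ c → h (functions c) (lookup x c))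
    ∑-share-all x = ≈-trans (∑-share (allFin m) x) (seenWeight-all (seenIn (allFin m)) functions x λ c →
      let i , c∈ = covered c in ∈-seenIn (∈-tabulate⁺ i) (∈-keysOf⁺ c∈))

  module Left  = Distribution +-commutativeMonoid proj₁
  module Right = Distribution rigid proj₂

  preparedRow : (a : Marked) → Vec ℝ ∣ columns (proj₂ a) ∣ → Row × (ℝ × ∃ R)
  preparedRow (s , i) r = rowOf (columns i) r ,
    (Left.weight s (cellsIn (columns i) functions r) , Right.weight s (cellsIn (columns i) functions r))

  prepared : Marked → PreparedTable
  prepared a = keysOf (columns (proj₂ a)) , mapᶠ (rows (proj₂ a)) (preparedRow a)

  input : Fin m → List Bool × List (List ℝ)
  input i = toList (columns i) , map toList (rows i)

  prepareTable-input : ∀ s i → prepareTable (columnsFrom functions , (s , input i)) ≡ prepared (s , i)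
  prepareTable-input s i = cong₂ _,_ (keys-columnsOf (columns i) functions) (go (rows i))
    where
    go : ∀ rs → mapᶠ (map toList rs) (λ r → prepareRow (s , (columnsOf (toList (columns i) , columnsFrom functions) , r)))
         ≡ mapᶠ rs (preparedRow (s , i))
    go []       = refl
    go (r ∷ rs) = cong₂ _∷_ (cong (_, proj₂ (preparedRow (s , i) r)) (row-cellsIn (columns i) functions r)) (go rs)

  prepareStep : List Bool × List (List ℝ) → List ℕ × List PreparedTable → List ℕ × List PreparedTable
  prepareStep t s = append (proj₁ (prepareTable (columnsFrom functions , (proj₁ s , t)))) (proj₁ s) ,
    prepareTable (columnsFrom functions , (proj₁ s , t)) ∷ proj₂ s

  prepare-input : ∀ is → prepare (columnsFrom functions , map input is) ≡ mapᶠ (marks is) prepared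
  prepare-input is = cong proj₂ (go is)
    where
    go : ∀ is → foldr prepareStep ([] , []) (map input is) ≡ (seenIn is , mapᶠ (marks is) prepared)
    go []       = refl
    go (i ∷ is) = trans (cong (prepareStep (input i)) (go is))
      (cong (λ P → append (proj₁ P) (seenIn is) , P ∷ mapᶠ (marks is) prepared) (prepareTable-input (seenIn is) i))

  arguments : ℝ × (List Functions × List (List Bool × List (List ℝ)))
  arguments = L , (map functions (allFin d) , map input (allFin m))

  Ps : List PreparedTable
  Ps = mapᶠ allMarks prepared

  length-Ps : length Ps ≡ m
  length-Ps = trans (length-mapᶠ allMarks prepared) length-allMarks

  prepare-arguments : ∀ E → let Qs = prepare (describe (map functions (allFin d)) , map input (allFin m)) in
                      (precision E Qs , Qs) ≡ (m ℕ.* E , Ps)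
  prepare-arguments E = trans (cong (λ Qs → precision E Qs , Qs) prepare-Ps) (cong (_, Ps)
    (trans (precision-length allMarks) (cong (ℕ._* E) length-allMarks)))
    where
    prepare-Ps : prepare (describe (map functions (allFin d)) , map input (allFin m)) ≡ Ps
    prepare-Ps = trans (cong (λ cs → prepare (cs , map input (allFin m)))
      (trans (cong describe (List.map-tabulate id functions)) (describe-tabulate functions))) (prepare-input (allFin m))
    precision-length : ∀ as → precision E (mapᶠ as prepared) ≡ length as ℕ.* E
    precision-length []       = refl
    precision-length (a ∷ as) = cong (E ℕ.+_) (precision-length as)

  W : List Marked → Vec ℝ d → ℝ
  W as x = BigSum.∑ +-commutativeMonoid as λ a → Left.share a x

  sketched : List Marked → List SketchedTable
  sketched as = mapᶠ (mapᶠ as prepared) annotate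

  Agreeing : List Row → Set
  Agreeing ps = ∀ {p p′} → p ∈ ps → p′ ∈ ps → Compatible p p′

  -- Invariant of the induction in `Z-join`: each table is either still to come or has already
  -- placed one of its rows in `ps`.
  Present : List Marked → List Row → Set
  Present as ps = ∀ i → (∃[ s ] (s , i) ∈ as) ⊎ (∃[ r ] r ∈ rows i × rowOf (columns i) r ∈ ps)

  agree⁻ : ∀ {r ps p} → agree r ps ≡ true → p ∈ ps → Compatible r p
  agree⁻ {r} {ps} {p} h p∈ = consistent⁻ {r} {p} (every⁻ ps (λ p → consistent (r , p)) h p∈)

  agree⁺ : ∀ {r ps} → (∀ {p} → p ∈ ps → Compatible r p) → agree r ps ≡ true
  agree⁺ {r} {ps} h = every⁺ ps (λ p → consistent (r , p)) λ {p} p∈ → consistent⁺ {r} {p} (h p∈)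

  -- Agreeing rows, one from each table, determine exactly one row of the join.
  module _ {ps : List Row} (agreeing : Agreeing ps) (present : ∀ i → ∃[ r ] r ∈ rows i × rowOf (columns i) r ∈ ps) where

    entry : (c : Fin d) → ∃[ v ] ∃[ p ] p ∈ ps × (keyOf c , v) ∈ p
    entry c = let i , c∈ = covered c
                  r , _ , r∈ = present i
                  v , v∈ = ∈-rowOf⁺ (columns i) r c∈
              in v , _ , r∈ , v∈

    combined : Vec ℝ d
    combined = Vec.tabulate λ c → proj₁ (entry c)

    combined-agrees : agree (fullRow combined) ps ≡ true
    combined-agrees = agree⁺ λ {p} p∈ u∈ w∈ → go p∈ (∈-fullRow⁻ combined u∈) w∈
      where
      go : ∀ {p k v w} → p ∈ ps → (Σ (Fin d) λ c → k ≡ keyOf c × v ≡ lookup combined c) → (k , w) ∈ p → v ≡ w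
      go p∈ (c , refl , refl) w∈ = trans (Vec.lookup∘tabulate _ c)
        (agreeing (proj₁ (proj₂ (proj₂ (entry c)))) p∈ (proj₂ (proj₂ (proj₂ (entry c)))) w∈)

    combined-∈ : combined ∈ J
    combined-∈ = Equivalence.from (∈-join database combined) λ i → let r , r∈ , p∈ = present i in
      subst (_∈ rows i) (sym (extends⇒project (columns i) combined r (agree⁻ combined-agrees p∈))) r∈

    combined-only : ∀ {x} → x ∈ J → agree (fullRow x) ps ≡ true → x ≡ combined
    combined-only {x} _ h = trans (sym (Vec.tabulate∘lookup x)) (Vec.tabulate-cong λ c →
      let _ , _ , p∈ , v∈ = entry c in agree⁻ h p∈ (∈-fullRow⁺ x c) v∈)

    ∑-combined : ∀ n → ∑ J (λ x → if agree (fullRow x) ps then n else 0) ≡ n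
    ∑-combined n = ∑-indicator J (join-unique database) combined-∈ (λ x → agree (fullRow x) ps) combined-agrees combined-only λ _ → n

  rowOf-agrees : ∀ {ps} i {x r} → consistent (fullRow x , rowOf (columns i) r) ≡ true → agree (fullRow x) ps ≡ true →
                 agree (rowOf (columns i) r) ps ≡ true
  rowOf-agrees {ps} i {x} {r} c h with extends⇒project (columns i) x r (consistent⁻ {fullRow x} {rowOf (columns i) r} c)
  ... | refl = agree⁺ λ p∈ u∈ w∈ → go p∈ (rowOf-project (columns i) x u∈) w∈
    where
    go : ∀ {p k v w} → p ∈ ps → (Σ (Fin d) λ c → k ≡ keyOf c × v ≡ lookup x c) → (k , w) ∈ p → v ≡ w
    go p∈ (c , refl , refl) w∈ = agree⁻ h p∈ (∈-fullRow⁺ x c) w∈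

  -- Induction on the remaining tables. A row of the join is consistent with exactly one row of the
  -- next table, namely its projection, so once the sums are interchanged the sum over the rows of
  -- that table collapses.
  Z-join : ∀ as ps φ → Agreeing ps → Present as ps →
           Z ps (sketched as) φ ≡ ∑ J (λ x → if agree (fullRow x) ps then φ (W as x) else 0)
  -- With no table left, `ps` contains a row of every table, and exactly one row of the join agrees
  -- with all of `ps`.
  Z-join []              ps φ ag pr = sym (∑-combined ag (λ i → [ (λ ()) , id ]′ (pr i)) (φ 0#))
  Z-join (a@(s , i) ∷ as) ps φ ag pr = begin
    Z ps (sketched (a ∷ as)) φ
      ≡⟨ trans (∑-mapᶠ (mapᶠ (rows i) (preparedRow a)) (λ r → proj₁ r , (proj₁ (proj₂ r) , 1) ∷ []) _)
               (∑-mapᶠ (rows i) (preparedRow a) _) ⟩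
    ∑ (rows i) (λ r → if agree (rw r) ps then
      1 ℕ.* Z (rw r ∷ ps) (sketched as) (λ w → φ (gw r + w)) ℕ.+ 0 else 0)
      ≡⟨ ∑-cong (rows i) (λ r r∈ → if-cong (agree (rw r) ps) λ h →
           trans (trans (ℕ.+-identityʳ _) (ℕ.+-identityʳ _)) (Z-join as (rw r ∷ ps) (λ w → φ (gw r + w)) (agreeing r h) (present r r∈))) ⟩
    ∑ (rows i) (λ r → if agree (rw r) ps then ∑ J (λ x → if agree (fullRow x) (rw r ∷ ps) then φ (gw r + W as x) else 0) else 0)
      ≡⟨ ∑-cong (rows i) (λ r _ → sym (∑-if J (agree (rw r) ps) _)) ⟩
    ∑ (rows i) (λ r → ∑ J (λ x → if agree (rw r) ps then (if agree (fullRow x) (rw r ∷ ps) then φ (gw r + W as x) else 0) else 0))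
      ≡⟨ ∑-swap (rows i) J _ ⟩
    ∑ J (λ x → ∑ (rows i) (λ r → if agree (rw r) ps then (if agree (fullRow x) (rw r ∷ ps) then φ (gw r + W as x) else 0) else 0))
      ≡⟨ ∑-cong J (λ x x∈ → trans (∑-cong (rows i) λ r _ → reorder x r)
           (trans (∑-indicator (rows i) (Table.unique (table i)) (Equivalence.to (∈-join database x) x∈ i)
              (λ r → consistent (fullRow x , rw r))
              (consistent⁺ {fullRow x} {rw (project (columns i) x)} (project⇒extends (columns i) x))
              (λ {r} _ h → sym (extends⇒project (columns i) x r (consistent⁻ {fullRow x} {rw r} h)))
              (λ r → if agree (fullRow x) ps then φ (gw r + W as x) else 0)) refl)) ⟩
    ∑ J (λ x → if agree (fullRow x) ps then φ (W (a ∷ as) x) else 0)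
      ∎
    where
    open ≡-Reasoning
    rw : Vec ℝ ∣ columns i ∣ → Row
    rw = rowOf (columns i)
    gw : Vec ℝ ∣ columns i ∣ → ℝ
    gw r = proj₁ (proj₂ (preparedRow a r))

    agreeing : ∀ r → agree (rw r) ps ≡ true → Agreeing (rw r ∷ ps)
    agreeing r h (here refl) (here refl) = rowOf-self (columns i) r
    agreeing r h (here refl) (there p)   = agree⁻ h p
    agreeing r h (there p)   (here refl) = compatible-sym (agree⁻ h p)
    agreeing r h (there p)   (there p′)  = ag p p′

    present : ∀ r → r ∈ rows i → Present as (rw r ∷ ps)
    present r r∈ j with pr j
    ... | inj₁ (_ , here refl)    = inj₂ (r , r∈ , here refl)
    ... | inj₁ (s , there p)      = inj₁ (s , p)
    ... | inj₂ (r′ , r′∈ , p)     = inj₂ (r′ , r′∈ , there p)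

    reorder : ∀ x r → (if agree (rw r) ps then (if agree (fullRow x) (rw r ∷ ps) then φ (gw r + W as x) else 0) else 0)
                    ≡ (if consistent (fullRow x , rw r) then (if agree (fullRow x) ps then φ (gw r + W as x) else 0) else 0)
    reorder x r with consistent (fullRow x , rw r) in c | agree (fullRow x) ps in h
    ... | false | _     = if-same (agree (rw r) ps)
    ... | true  | false = if-same (agree (rw r) ps)
    ... | true  | true  = if-true (rowOf-agrees {ps} i {x} {r} c h)

  additive : Vec ℝ d → ℝ
  additive x = sum λ c → g c (lookup x c)
    where open RawMonoidDefinitions (CommutativeMonoid.rawMonoid +-commutativeMonoid) using (sum)

  Z-restricted : ∀ {a as} → (a , as) ∈ selections allMarks → ∀ {r} → r ∈ rows (proj₂ a) → ∀ φ →
    Z [] (restricted ((prepared a , mapᶠ as prepared) , preparedRow a r)) φ ≡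
    ∑ J (λ x → if consistent (fullRow x , rowOf (columns (proj₂ a)) r) then φ (additive x) else 0)
  Z-restricted {a@(s , i)} {as} sel {r} r∈ φ = trans (trans (ℕ.+-identityʳ _) (trans (ℕ.+-identityʳ _) (ℕ.+-identityʳ _)))
    (trans (Z-join as (rowOf (columns i) r ∷ []) (λ w → φ (proj₁ (proj₂ (preparedRow a r)) + w))
        (λ { (here refl) (here refl) → rowOf-self (columns i) r }) present)
      (∑-cong J λ x _ → trans (one (consistent (fullRow x , rowOf (columns i) r)))
        (if-cong (consistent (fullRow x , rowOf (columns i) r)) λ h → cong φ (regroup x h))))
    where
    one : ∀ b {n : ℕ} → (if (if b then true else false) then n else 0) ≡ (if b then n else 0)
    one true  = refl
    one false = refl

    perm : a ∷ as ↭ marks (allFin m)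
    perm = selections-↭ allMarks sel

    present : Present as (rowOf (columns i) r ∷ [])
    present j with ∈-marks (∈-tabulate⁺ {f = id} j)
    ... | s′ , p with Perm.∈-resp-↭ (↭-sym perm) p
    ...   | here refl = inj₂ (r , r∈ , here refl)
    ...   | there p′  = inj₁ (s′ , p′)

    regroup : ∀ x → consistent (fullRow x , rowOf (columns i) r) ≡ true →
              proj₁ (proj₂ (preparedRow a r)) + W as x ≡ additive x
    regroup x h with extends⇒project (columns i) x r (consistent⁻ {fullRow x} {rowOf (columns i) r} h)
    ... | refl = trans (BigSum.∑-↭ +-commutativeMonoid (λ b → Left.share b x) perm) (Left.∑-share-all x)

-- Accuracy, and correctness of the total

n<2^n : ∀ n → n ℕ.< 2 ℕ.^ n
n<2^n zero    = s≤s z≤n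
n<2^n (suc n) = ℕ.+-mono-≤ (ℕ.≤-trans (s≤s z≤n) (n<2^n n)) (ℕ.≤-trans (n<2^n n) (ℕ.≤-reflexive (sym (ℕ.+-identityʳ _))))

-- (1 + 1/N) ^ j ≤ N / (N - j), with N - j written as r.
compound : ∀ N j r → j ℕ.+ r ≡ N → suc N ℕ.^ j ℕ.* r ℕ.≤ N ℕ.^ j ℕ.* N
compound N zero    r eq = ℕ.*-monoʳ-≤ 1 (ℕ.≤-reflexive eq)
compound N (suc j) r eq = begin
  suc N ℕ.^ suc j ℕ.* r               ≡⟨ shuffle (suc N) (suc N ℕ.^ j) r ⟩
  suc N ℕ.^ j ℕ.* (suc N ℕ.* r)       ≤⟨ ℕ.*-monoʳ-≤ (suc N ℕ.^ j) (begin
    r ℕ.+ N ℕ.* r   ≤⟨ ℕ.+-monoˡ-≤ (N ℕ.* r) (ℕ.≤-trans (ℕ.m≤n+m r (suc j)) (ℕ.≤-reflexive eq)) ⟩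
    N ℕ.+ N ℕ.* r   ≡⟨ ℕ.*-suc N r ⟨
    N ℕ.* suc r     ∎) ⟩
  suc N ℕ.^ j ℕ.* (N ℕ.* suc r)       ≡⟨ *-exchange (suc N ℕ.^ j) N (suc r) ⟩
  N ℕ.* (suc N ℕ.^ j ℕ.* suc r)       ≤⟨ ℕ.*-monoʳ-≤ N (compound N j (suc r) (trans (ℕ.+-suc j r) eq)) ⟩
  N ℕ.* (N ℕ.^ j ℕ.* N)               ≡⟨ ℕ.*-assoc N (N ℕ.^ j) N ⟨
  N ℕ.^ suc j ℕ.* N                   ∎
  where
  open ℕ.≤-Reasoning
  shuffle : ∀ a b c → a ℕ.* b ℕ.* c ≡ b ℕ.* (a ℕ.* c)
  shuffle = solve-∀

-- The accuracy N = m * (e + 1) compensates for m successive approximations.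
approx-total : ∀ m e {k′ k} → 1 ℕ.≤ m → Approx (m ℕ.* suc e) m k′ k → e ℕ.* k ℕ.≤ suc e ℕ.* k′
approx-total m@(suc _) e {k′} {k} 1≤m (_ , h) =
  ℕ.*-cancelˡ-≤ (N ℕ.^ m) {{ℕ.m^n≢0 N m}} (begin
    N ℕ.^ m ℕ.* (e ℕ.* k)            ≡⟨ *-exchange (N ℕ.^ m) e k ⟩
    e ℕ.* (N ℕ.^ m ℕ.* k)            ≤⟨ ℕ.*-monoʳ-≤ e h ⟩
    e ℕ.* (suc N ℕ.^ m ℕ.* k′)       ≡⟨ regroup e (suc N ℕ.^ m) k′ ⟩
    suc N ℕ.^ m ℕ.* e ℕ.* k′         ≤⟨ ℕ.*-monoˡ-≤ k′ ratio ⟩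
    N ℕ.^ m ℕ.* suc e ℕ.* k′         ≡⟨ ℕ.*-assoc (N ℕ.^ m) (suc e) k′ ⟩
    N ℕ.^ m ℕ.* (suc e ℕ.* k′)       ∎)
  where
  open ℕ.≤-Reasoning
  N = m ℕ.* suc e
  regroup : ∀ a b c → a ℕ.* (b ℕ.* c) ≡ b ℕ.* a ℕ.* c
  regroup = solve-∀
  -- Here N - m is `m * e`; dividing by `m` turns the ratio N / (N - m) into (e + 1) / e.
  ratio : suc N ℕ.^ m ℕ.* e ℕ.≤ N ℕ.^ m ℕ.* suc e
  ratio = ℕ.*-cancelˡ-≤ m (subst₂ ℕ._≤_ (*-exchange (suc N ℕ.^ m) m e) (*-exchange (N ℕ.^ m) m (suc e))
    (compound N m (m ℕ.* e) (sym (ℕ.*-suc m e))))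

module Correctness {ℜ : CompleteOrderedField} (M : RealCommutativeMonoid ℜ)
                   (no-error : IntroducesNoError M) (repeatable : Repeatable M) (q : Query M) where
  open CompleteOrderedField ℜ
  open RealCommutativeMonoid M
  open RealArithmetic ℜ using (fromℕ-≈; ≈-refl-nonneg; fromℕ-nonneg)
  open Query q
  open Algorithm M
  open Lengths M
  open Integration M
  open Elimination M
  open Columns M
  open Copies M
  open Joins M q
  open Rigid commutativeMonoid using (rigid; plain; sum-rigid)
  open CommutativeMonoid rigid using (_≈_; setoid; ∙-cong; identityʳ; reflexive)
    renaming (refl to ≈-refl; sym to ≈-sym; trans to ≈-trans)
  open BigSum rigid
  module Σℕ = BigSum ℕ.+-0-commutativeMonoid

  extends : Vec ℝ d → (a : Marked) → Vec ℝ ∣ columns (proj₂ a) ∣ → Bool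
  extends x a r = consistent (fullRow x , rowOf (columns (proj₂ a)) r)

  multiplicity : (a : Marked) → Vec ℝ ∣ columns (proj₂ a) ∣ → ℕ
  multiplicity a r = Σℕ.∑ J λ x → if extends x a r then upTo L (additive x) else 0

  share : (a : Marked) → Vec ℝ ∣ columns (proj₂ a) ∣ → ∃ R
  share a r = proj₂ (proj₂ (preparedRow a r))

  ∑-copies : {A : Set} (xs : List A) (n : A → ℕ) (y : ∃ R) → (Σℕ.∑ xs n copiesOf y) ≈ ∑ xs (λ x → n x copiesOf y)
  ∑-copies []       n y = ≈-refl
  ∑-copies (x ∷ xs) n y = ≈-trans (copies-+ (n x) _ y) (∙-cong ≈-refl (∑-copies xs n y))

  ∑-selections : {A : Set} (xs : List A) (f : A → ∃ R) → ∑ (selections xs) (f ∘ proj₁) ≈ ∑ xs f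
  ∑-selections []       f = ≈-refl
  ∑-selections (x ∷ xs) f = ≈-trans (reflexive (cong (λ s → ∑ s (f ∘ proj₁)) (selections-∷ x xs)))
    (∙-cong ≈-refl (≈-trans (∑-mapᶠ (selections xs) (λ p → proj₁ p , x ∷ proj₂ p) (f ∘ proj₁)) (∑-selections xs f)))

  satisfies : Vec ℝ d → Bool
  satisfies x = additive x ≤ᴿ L

  sumSum-∑ : sumSum M q ≈ ∑ J (λ x → if satisfies x then ⨁ (λ c → F c (lookup x c)) else I₀)
  sumSum-∑ = ≈-trans (reflexive (foldr-map (satisfying M q)))
    (∑-filter (λ x → additive x ≤? L) J (λ x → ⨁ (λ c → F c (lookup x c))))
    where
    foldr-map : ∀ xs → foldr _⊕_ I₀ (map (λ x → ⨁ (λ c → F c (lookup x c))) xs) ≡ ∑ xs (λ x → ⨁ (λ c → F c (lookup x c)))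
    foldr-map []       = refl
    foldr-map (x ∷ xs) = cong (⨁ (λ c → F c (lookup x c)) ⊕_) (foldr-map xs)

  -- Interchange the sums. A fixed row of the join extends exactly one row of each table, and the
  -- shares of these rows combine to the ⊕ over all columns.
  ∑-multiplicity : ∑ allMarks (λ a → ∑ (rows (proj₂ a)) (λ r → multiplicity a r copiesOf share a r)) ≈ sumSum M q
  ∑-multiplicity = begin
    ∑ ms (λ a → ∑ (rows (proj₂ a)) (λ r → multiplicity a r copiesOf share a r))
      ≈⟨ ∑-cong ms (λ a _ → ∑-cong (rows (proj₂ a)) λ r _ → ≈-trans (∑-copies J _ (share a r))
           (∑-cong J λ x _ → once (extends x a r) (satisfies x) (share a r))) ⟩
    ∑ ms (λ a → ∑ (rows (proj₂ a)) (λ r → ∑ J (λ x → term a r x)))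
      ≈⟨ ∑-cong ms (λ a _ → ∑-swap (rows (proj₂ a)) J (term a)) ⟩
    ∑ ms (λ a → ∑ J (λ x → ∑ (rows (proj₂ a)) (λ r → term a r x)))
      ≈⟨ ∑-swap ms J (λ a x → ∑ (rows (proj₂ a)) (λ r → term a r x)) ⟩
    ∑ J (λ x → ∑ ms (λ a → ∑ (rows (proj₂ a)) (λ r → term a r x)))
      ≈⟨ ∑-cong J (λ x x∈ → ≈-trans (∑-cong ms λ a _ → own a x x∈)
           (≈-trans (∑-if ms (satisfies x) (λ a → Right.share a x)) (conditional (satisfies x)
             (≈-trans (Right.∑-share-all x) (reflexive (sum-rigid λ c → F c (lookup x c))))))) ⟩
    ∑ J (λ x → if satisfies x then ⨁ (λ c → F c (lookup x c)) else I₀)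
      ≈⟨ sumSum-∑ ⟨
    sumSum M q ∎
    where
    open SetoidReasoning setoid
    ms = allMarks

    term : (a : Marked) → Vec ℝ ∣ columns (proj₂ a) ∣ → Vec ℝ d → ∃ R
    term a r x = if extends x a r then (if satisfies x then share a r else I₀) else I₀

    once : ∀ b c y → ((if b then (if c then 1 else 0) else 0) copiesOf y) ≈ (if b then (if c then y else I₀) else I₀)
    once true  true  y = identityʳ y
    once true  false y = ≈-refl
    once false c     y = ≈-refl

    conditional : ∀ b {x y} → x ≈ y → (if b then x else I₀) ≈ (if b then y else I₀)
    conditional true  h = h
    conditional false h = ≈-refl

    own : ∀ a x → x ∈ J → ∑ (rows (proj₂ a)) (λ r → term a r x) ≈ (if satisfies x then Right.share a x else I₀)
    own a@(s , i) x x∈ = ∑-indicator (rows i) (Table.unique (table i)) (Equivalence.to (∈-join database x) x∈ i)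
      (λ r → extends x a r)
      (consistent⁺ {fullRow x} {rowOf (columns i) (project (columns i) x)} (project⇒extends (columns i) x))
      (λ {r} _ h → sym (extends⇒project (columns i) x r (consistent⁻ {fullRow x} {rowOf (columns i) r} h)))
      (λ r → if satisfies x then share a r else I₀)

  length-allRows : ∀ Ps → length (allRows Ps) ≡ Σℕ.∑ Ps (length ∘ proj₂)
  length-allRows []       = refl
  length-allRows (P ∷ Ps) = trans (length-append (proj₂ P) (allRows Ps)) (cong (length (proj₂ P) ℕ.+_) (length-allRows Ps))

  -- All multiplicities are 1, so `Z` is at most the product of the numbers of rows, and a table of
  -- k rows contributes a factor of at most 2 ^ k. The exponent is thus a number of rows, matching
  -- the supply of powers in `copies`.
  Z-small : ∀ ps Ps φ → (∀ v → φ v ℕ.≤ 1) → Z ps (mapᶠ Ps annotate) φ ℕ.≤ 2 ℕ.^ Σℕ.∑ Ps (length ∘ proj₂)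
  Z-small ps []       φ h = h 0#
  Z-small ps (P ∷ Ps) φ h = ℕ.≤-trans
    (ℕ.≤-reflexive (Σℕ.∑-mapᶠ (proj₂ P) (λ r → proj₁ r , (proj₁ (proj₂ r) , 1) ∷ []) _))
    (ℕ.≤-trans (∑-mono (proj₂ P) λ r _ → bound r (agree (proj₁ r) ps))
      (ℕ.≤-trans (ℕ.≤-reflexive (∑-const (proj₂ P) (2 ℕ.^ s)))
        (ℕ.≤-trans (ℕ.*-monoˡ-≤ (2 ℕ.^ s) (ℕ.<⇒≤ (n<2^n (length (proj₂ P)))))
          (ℕ.≤-reflexive (sym (ℕ.^-distribˡ-+-* 2 (length (proj₂ P)) s))))))
    where
    s = Σℕ.∑ Ps (length ∘ proj₂)
    bound : ∀ r b → (if b then 1 ℕ.* Z (proj₁ r ∷ ps) (mapᶠ Ps annotate) (λ w → φ (proj₁ (proj₂ r) + w)) ℕ.+ 0 else 0) ℕ.≤ 2 ℕ.^ s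
    bound r true  = ℕ.≤-trans (ℕ.≤-reflexive (trans (ℕ.+-identityʳ _) (ℕ.+-identityʳ _)))
      (Z-small (proj₁ r ∷ ps) Ps (λ w → φ (proj₁ (proj₂ r) + w)) λ v → h _)
    bound r false = z≤n

  keyed-row : ∀ (a : Marked) r {k} → k ∈ keysOf (columns (proj₂ a)) ⇔ (∃[ v ] (k , v) ∈ rowOf (columns (proj₂ a)) r)
  keyed-row (s , i) r = mk⇔
    (λ k∈ → let c , c∈ , eq = ∈-keysOf⁻ {C = columns i} k∈ ; v , v∈ = ∈-rowOf⁺ (columns i) r c∈ in
            v , subst (λ k → (k , v) ∈ rowOf (columns i) r) (sym eq) v∈)
    (λ (v , v∈) → let c , c∈ , eq = ∈-rowOf⁻ (columns i) r v∈ in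
            subst (_∈ keysOf (columns i)) (sym eq) (∈-keysOf⁺ c∈))

  keyed-sketched : ∀ as → AllKeyed (sketched as)
  keyed-sketched as T∈ e∈ with ∈-mapᶠ⁻ (mapᶠ as prepared) annotate T∈
  ... | _ , P∈ , refl with ∈-mapᶠ⁻ as prepared P∈
  ...   | a , _ , refl with ∈-mapᶠ⁻ (mapᶠ (rows (proj₂ a)) (preparedRow a)) (λ r → proj₁ r , (proj₁ (proj₂ r) , 1) ∷ []) e∈
  ...     | _ , p∈ , refl with ∈-mapᶠ⁻ (rows (proj₂ a)) (preparedRow a) p∈
  ...       | r , _ , refl = keyed-row a r

  state : Marked → List Marked → (Row × (ℝ × ∃ R)) → List SketchedTable
  state a as r = restricted ((prepared a , mapᶠ as prepared) , r)

  keyed-restricted : ∀ (a : Marked) as r → AllKeyed (state a as (preparedRow a r))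
  keyed-restricted a as r (here refl) (here refl) = keyed-row a r
  keyed-restricted a as r (there T∈)  e∈          = keyed-sketched as T∈ e∈

  length-restricted : ∀ {a as r} → (a , as) ∈ selections allMarks → length (state a as r) ≡ m
  length-restricted {a} {as} sel = trans (cong suc (trans (length-mapᶠ (mapᶠ as prepared) annotate) (length-mapᶠ as prepared)))
    (trans (length-selection allMarks sel) length-allMarks)

  module _ (ε : ℝ) (0≤ε : 0# ≤ ε) (e : ℕ) (1≤εe : 1# ≤ ε * fromℕ e) where

    N : ℕ
    N = m ℕ.* suc e

    counted : Marked → List Marked → (Row × (ℝ × ∃ R)) → ℕ
    counted a as r = tally (N , (L , state a as r))

    -- `≈[ ε ]` is not reflexive at negative reals. At the unit it is, by repeatability applied to
    -- zero copies.
    I₀≈I₀ : proj₁ I₀ ≈[ ε ] proj₁ I₀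
    I₀≈I₀ = repeatable 0 0 ε 0≤ε (≈-refl-nonneg 0≤ε (fromℕ-nonneg 0)) I₀

    -- Both arguments of each ⊕ carry the same error, and `ε ⊔ ε` is `ε`, so the error does not
    -- depend on the number of summands.
    ∑-error : {A : Set} (xs : List A) {f f′ : A → ∃ R} → (∀ x → x ∈ xs → proj₁ (f x) ≈[ ε ] proj₁ (f′ x)) →
              proj₁ (∑ xs f) ≈[ ε ] proj₁ (∑ xs f′)
    ∑-error []       h = I₀≈I₀
    ∑-error (x ∷ xs) {f} {f′} h = subst (λ δ → proj₁ (∑ (x ∷ xs) f) ≈[ δ ] proj₁ (∑ (x ∷ xs) f′))
      (Maximum.⊔-idem (DecTotalOrder.totalOrder decTotalOrder) ε)
      (no-error (f x) (f′ x) (∑ xs f) (∑ xs f′) ε ε 0≤ε 0≤ε (h x (here refl)) (∑-error xs λ y y∈ → h y (there y∈)))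

    module _ {a as} (sel : (a , as) ∈ selections allMarks) {r} (r∈ : r ∈ rows (proj₂ a)) where

      1≤m : 1 ℕ.≤ m
      1≤m = subst (1 ℕ.≤_) (length-restricted {r = preparedRow a r} sel) (s≤s z≤n)

      tallied : Approx N m (counted a as (preparedRow a r)) (multiplicity a r)
      tallied = subst₂ (λ j z → Approx N j (counted a as (preparedRow a r)) z) (length-restricted {r = preparedRow a r} sel)
        (Z-restricted sel r∈ (upTo L))
        (tally-approx N L (state a as (preparedRow a r)) (keyed-restricted a as r) (s≤s z≤n))

      -- The table of `r` is cut to one row and leaves the exponent of `Z-small`, while it still
      -- counts in `allRows Ps`. As it has at least one row, the inequality is strict, as
      -- `copies-correct` requires.
      multiplicity-small : multiplicity a r ℕ.< 2 ℕ.^ length (allRows Ps)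
      multiplicity-small = ℕ.≤-<-trans
        (subst (ℕ._≤ 2 ℕ.^ Σℕ.∑ (mapᶠ as prepared) (length ∘ proj₂))
          (trans (sym (trans (ℕ.+-identityʳ _) (trans (ℕ.+-identityʳ _) (ℕ.+-identityʳ _)))) (Z-restricted sel r∈ (upTo L)))
          (Z-small (rowOf (columns (proj₂ a)) r ∷ []) (mapᶠ as prepared) _ λ v → indicator _))
        (ℕ.^-monoʳ-< 2 (s≤s (s≤s z≤n)) (subst (Σℕ.∑ (mapᶠ as prepared) (length ∘ proj₂) ℕ.<_) (sym total-length)
          (ℕ.+-monoˡ-≤ _ (subst (1 ℕ.≤_) (sym (length-mapᶠ (rows (proj₂ a)) (preparedRow a))) (nonempty r∈)))))
        where
        indicator : ∀ b → (if b then 1 else 0) ℕ.≤ 1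
        indicator true  = s≤s z≤n
        indicator false = z≤n

        nonempty : {A : Set} {x : A} {xs : List A} → x ∈ xs → 1 ℕ.≤ length xs
        nonempty (here _)  = s≤s z≤n
        nonempty (there _) = s≤s z≤n

        total-length : length (allRows Ps) ≡ length (proj₂ (prepared a)) ℕ.+ Σℕ.∑ (mapᶠ as prepared) (length ∘ proj₂)
        total-length = trans (length-allRows Ps) (trans (Σℕ.∑-mapᶠ allMarks prepared (length ∘ proj₂))
          (trans (sym (Σℕ.∑-↭ (length ∘ proj₂ ∘ prepared) (selections-↭ allMarks sel)))
            (cong (length (proj₂ (prepared a)) ℕ.+_) (sym (Σℕ.∑-mapᶠ as prepared (length ∘ proj₂))))))

      copied : proj₁ (multiplicity a r copiesOf share a r) ≈[ ε ]
               proj₁ (copies (counted a as (preparedRow a r) , (share a r , allRows Ps)))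
      copied = subst (λ z → proj₁ (multiplicity a r copiesOf share a r) ≈[ ε ] z)
        (sym (plain (copies-correct (counted a as (preparedRow a r)) (share a r) (allRows Ps)
          (ℕ.≤-<-trans (proj₁ tallied) multiplicity-small))))
        (repeatable (multiplicity a r) (counted a as (preparedRow a r)) ε 0≤ε
          (fromℕ-≈ {ε} {e} {multiplicity a r} {counted a as (preparedRow a r)} 0≤ε 1≤εe (proj₁ tallied)
          (approx-total m e {counted a as (preparedRow a r)} {multiplicity a r} 1≤m tallied)) (share a r))

    selections-mapᶠ : {A C : Set} (xs : List A) (f : A → C) →
                      selections (mapᶠ xs f) ≡ mapᶠ (selections xs) (λ s → f (proj₁ s) , mapᶠ (proj₂ s) f)
    selections-mapᶠ []       f = refl
    selections-mapᶠ (x ∷ xs) f = trans (selections-∷ (f x) (mapᶠ xs f)) (trans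
      (cong ((f x , mapᶠ xs f) ∷_) (trans (cong (λ l → mapᶠ l (λ p → proj₁ p , f x ∷ proj₂ p)) (selections-mapᶠ xs f))
        (fusion (selections xs))))
      (sym (cong (λ l → mapᶠ l (λ s → f (proj₁ s) , mapᶠ (proj₂ s) f)) (selections-∷ x xs))))
      where
      fusion : ∀ l → mapᶠ (mapᶠ l (λ s → f (proj₁ s) , mapᶠ (proj₂ s) f)) (λ p → proj₁ p , f x ∷ proj₂ p) ≡
               mapᶠ (mapᶠ l (λ p → proj₁ p , x ∷ proj₂ p)) (λ s → f (proj₁ s) , mapᶠ (proj₂ s) f)
      fusion []      = refl
      fusion (p ∷ l) = cong (_ ∷_) (fusion l)

    summand : Marked → List Marked → (Row × (ℝ × ∃ R)) → ∃ R
    summand a as r = copies (counted a as r , (proj₂ (proj₂ r) , allRows Ps))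

    total-∑ : total (N , (L , Ps)) ≈ ∑ (selections allMarks) λ s →
              ∑ (rows (proj₂ (proj₁ s))) λ r → summand (proj₁ s) (proj₂ s) (preparedRow (proj₁ s) r)
    total-∑ = ≈-trans (reflexive (cong (λ l → ∑ l outer) (selections-mapᶠ allMarks prepared)))
      (≈-trans (∑-mapᶠ (selections allMarks) (λ s → prepared (proj₁ s) , mapᶠ (proj₂ s) prepared) outer)
        (∑-cong (selections allMarks) λ s _ →
          ∑-mapᶠ (rows (proj₂ (proj₁ s))) (preparedRow (proj₁ s)) (summand (proj₁ s) (proj₂ s))))
      where
      outer : PreparedTable × List PreparedTable → ∃ R
      outer s = ∑ (proj₂ (proj₁ s)) λ r → copies (tally (N , (L , restricted (s , r))) , (proj₂ (proj₂ r) , allRows Ps))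

    total-correct : proj₁ (sumSum M q) ≈[ ε ] proj₁ (total (N , (L , Ps)))
    total-correct = subst₂ (λ y z → y ≈[ ε ] z)
      (plain (≈-trans (∑-selections allMarks (λ a → ∑ (rows (proj₂ a)) λ r → multiplicity a r copiesOf share a r)) ∑-multiplicity))
      (plain (≈-sym total-∑))
      (∑-error (selections allMarks) λ s s∈ → ∑-error (rows (proj₂ (proj₁ s))) λ r r∈ → copied s∈ r∈)

    answer-correct : proj₁ (sumSum M q) ≈[ ε ] proj₁ (answer (suc e) arguments)
    answer-correct = subst (λ y → proj₁ (sumSum M q) ≈[ ε ] proj₁ y)
      (sym (cong (λ (k , Qs) → total (k , (L , Qs))) (prepare-arguments (suc e)))) total-correct

-- Acyclic joins

AllPairs-resp-↭ : {A : Set} {R : Rel A 0ℓ} → (∀ {x y} → R x y → R y x) → {xs ys : List A} → xs ↭ ys → AllPairs R xs → AllPairs R ys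
AllPairs-resp-↭ s reflᵖ        h = h
AllPairs-resp-↭ s (prep x p)   (a ∷ h) = Perm.All-resp-↭ p a ∷ AllPairs-resp-↭ s p h
AllPairs-resp-↭ s (swap x y p) ((xy ∷ a) ∷ b ∷ h) =
  (s xy ∷ Perm.All-resp-↭ p b) ∷ Perm.All-resp-↭ p a ∷ AllPairs-resp-↭ s p h
AllPairs-resp-↭ s (transᵖ p q) h = AllPairs-resp-↭ s q (AllPairs-resp-↭ s p h)

∈⇒↭ : {A : Set} {x : A} {xs : List A} → x ∈ xs → ∃[ ys ] xs ↭ x ∷ ys
∈⇒↭ {x = x} x∈ with ∈-∃++ x∈
... | as , bs , refl = as ++ bs , Perm.shift x as bs

unique-↭ : {A : Set} {xs ys : List A} → Unique xs → Unique ys → (∀ {x} → x ∈ xs → x ∈ ys) → (∀ {x} → x ∈ ys → x ∈ xs) → xs ↭ ys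
unique-↭ {xs = []}     {[]}     u v f g = ↭-refl
unique-↭ {xs = []}     {y ∷ ys} u v f g = contradiction (g (here refl)) λ ()
unique-↭ {xs = x ∷ xs} {ys} (x∉ ∷ u) v f g with ∈⇒↭ (f (here refl))
... | zs , p with AllPairs-resp-↭ (λ n e → n (sym e)) p v
...   | x∉′ ∷ w = ↭-trans (prep x (unique-↭ u w to from)) (↭-sym p)
  where
  to : ∀ {y} → y ∈ xs → y ∈ zs
  to y∈ with Perm.∈-resp-↭ p (f (there y∈))
  ... | here refl = contradiction refl (All.lookup x∉ y∈)
  ... | there q   = q
  from : ∀ {y} → y ∈ zs → y ∈ xs
  from y∈ with g (Perm.∈-resp-↭ (↭-sym p) (there y∈))
  ... | here refl = contradiction refl (All.lookup x∉′ y∈)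
  ... | there q   = q

module RunningIntersection where

  Keys : Set
  Keys = List ℕ

  EarOf : Keys → Keys → List Keys → Set
  EarOf x y zs = ∀ {z} → z ∈ zs → ∀ {k} → k ∈ x → k ∈ z → k ∈ y

  Ear : Keys → List Keys → Set
  Ear x zs = ∃[ y ] y ∈ zs × EarOf x y zs

  -- The running intersection property of acyclic hypergraphs. The list is an elimination order:
  -- each member is an ear of those after it.
  RIP : List Keys → Set
  RIP []       = ⊤
  RIP (x ∷ xs) = (xs ≡ [] ⊎ Ear x xs) × RIP xs

  Acyclicˡ : List Keys → Set
  Acyclicˡ xs = ∃[ ys ] ys ↭ xs × RIP ys

  ear-↭ : ∀ {x xs ys} → xs ↭ ys → xs ≡ [] ⊎ Ear x xs → ys ≡ [] ⊎ Ear x ys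
  ear-↭ p (inj₁ refl)         = inj₁ (Perm.↭-empty-inv (↭-sym p))
  ear-↭ p (inj₂ (y , y∈ , h)) = inj₂ (y , Perm.∈-resp-↭ p y∈ , λ z∈ → h (Perm.∈-resp-↭ (↭-sym p) z∈))

  ∈-replace : ∀ {x y z : Keys} as {bs} → z ∈ as ++ x ∷ bs → z ≡ x ⊎ z ∈ as ++ bs
  ∈-replace as z∈ with ∈-++⁻ as z∈
  ... | inj₁ p           = inj₂ (∈-++⁺ˡ p)
  ... | inj₂ (here refl) = inj₁ refl
  ... | inj₂ (there p)   = inj₂ (∈-++⁺ʳ as p)

  ∈-keep : ∀ {x z : Keys} as {bs} → z ∈ as ++ bs → z ∈ as ++ x ∷ bs
  ∈-keep as z∈ with ∈-++⁻ as z∈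
  ... | inj₁ p = ∈-++⁺ˡ p
  ... | inj₂ p = ∈-++⁺ʳ as (there p)

  ∈-middle : ∀ {x : Keys} as {bs} → x ∈ as ++ x ∷ bs
  ∈-middle as = ∈-++⁺ʳ as (here refl)

  -- The property depends only on the keys that a member shares with the others, and on these `x`
  -- and `h` coincide.
  replace : ∀ {x h} as {bs} → (∀ {z} → z ∈ as ++ bs → ∀ {k} → k ∈ z → k ∈ x ⇔ k ∈ h) →
            RIP (as ++ x ∷ bs) → RIP (as ++ h ∷ bs)
  replace []       same (inj₁ eq , r)            = inj₁ eq , r
  replace []       same (inj₂ (w , w∈ , ear) , r) =
    inj₂ (w , w∈ , λ z∈ k∈h k∈z → ear z∈ (Equivalence.from (same z∈ k∈z) k∈h) k∈z) , r
  replace {x} {h} (a ∷ as) {bs} same (e , r) = inj₂ (ear e) , replace as (λ z∈ → same (there z∈)) r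
    where
    ear : as ++ x ∷ bs ≡ [] ⊎ Ear a (as ++ x ∷ bs) → Ear a (as ++ h ∷ bs)
    ear (inj₁ eq) = contradiction (subst (x ∈_) eq (∈-middle as)) λ ()
    ear (inj₂ (w , w∈ , ear)) with ∈-replace {y = x} as w∈
    ... | inj₁ refl = h , ∈-middle as , λ z∈ k∈a k∈z → case ∈-replace {y = x} as z∈ of λ
      { (inj₁ refl) → k∈z
      ; (inj₂ p)    → Equivalence.to (same (here refl) k∈a) (ear (∈-keep as p) k∈a k∈z) }
    ... | inj₂ w∈′  = w , ∈-keep as w∈′ , λ z∈ k∈a k∈z → case ∈-replace {y = x} as z∈ of λ
      { (inj₁ refl) → ear (∈-middle as) k∈a (Equivalence.from (same (here refl) k∈a) k∈z)
      ; (inj₂ p)    → ear (∈-keep as p) k∈a k∈z }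

  extend : ∀ {h xs ys} → xs ≡ [] ⊎ Ear h xs → ys ↭ xs → RIP ys → RIP (h ∷ ys)
  extend e p r = ear-↭ (↭-sym p) e , r

  -- If h hangs on x while x is an ear that hangs on h, then h takes the place of x.
  module _ (h : Keys) (as : List Keys) {x : Keys} (bs : List Keys) (r : RIP (as ++ x ∷ bs))
           (smaller : ∀ {xs} → as ++ x ∷ bs ↭ x ∷ xs → xs ≡ [] ⊎ Ear x xs → Acyclicˡ xs) where

    remove-ear-after : ∀ {xs} → as ++ x ∷ bs ≡ [] ⊎ Ear h (as ++ x ∷ bs) → h ∷ as ++ x ∷ bs ↭ x ∷ xs →
                       xs ≡ [] ⊎ Ear x xs → Acyclicˡ xs
    remove-ear-after {xs} eh p e = go eh e′
      where
      rest = as ++ bs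
      split : as ++ x ∷ bs ↭ x ∷ rest
      split = Perm.shift x as bs
      xs↭ : h ∷ rest ↭ xs
      xs↭ = Perm.drop-∷ (↭-trans (swap x h ↭-refl) (↭-trans (prep h (↭-sym split)) p))
      e′ : h ∷ rest ≡ [] ⊎ Ear x (h ∷ rest)
      e′ = ear-↭ (↭-sym xs↭) e
      finish : rest ≡ [] ⊎ Ear x rest → rest ≡ [] ⊎ Ear h rest → Acyclicˡ xs
      finish ex eh′ with smaller split ex
      ... | ds , q , r′ = h ∷ ds , ↭-trans (prep h q) xs↭ , extend eh′ q r′
      empty : ∀ {l : List Keys} {w} → w ∈ l → l ≡ [] → ⊥
      empty () refl
      go : as ++ x ∷ bs ≡ [] ⊎ Ear h (as ++ x ∷ bs) → h ∷ rest ≡ [] ⊎ Ear x (h ∷ rest) → Acyclicˡ xs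
      go (inj₁ eq) _ = ⊥-elim (empty (∈-middle as) eq)
      go _ (inj₁ ())
      go (inj₂ (w , w∈ , hw)) (inj₂ (j , j∈ , xj)) with ∈-replace {y = x} as w∈ | j∈
      ... | inj₂ w∈′ | there j∈′ = finish (inj₂ (j , j∈′ , λ z∈ → xj (there z∈)))
                                          (inj₂ (w , w∈′ , λ z∈ → hw (∈-keep as z∈)))
      -- In the two mixed cases attachments compose: if `x` hangs on `h` and `h` on `w`, then `x`
      -- hangs on `w`; likewise with the roles of `x` and `h` exchanged.
      ... | inj₂ w∈′ | here refl = finish (inj₂ (w , w∈′ , λ z∈ k∈x k∈z → hw (∈-keep as z∈) (xj (there z∈) k∈x k∈z) k∈z))
                                          (inj₂ (w , w∈′ , λ z∈ → hw (∈-keep as z∈)))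
      ... | inj₁ refl | there j∈′ = finish (inj₂ (j , j∈′ , λ z∈ → xj (there z∈)))
                                           (inj₂ (j , j∈′ , λ z∈ k∈h k∈z → xj (there z∈) (hw (∈-keep as z∈) k∈h k∈z) k∈z))
      ... | inj₁ refl | here refl = as ++ h ∷ bs , ↭-trans (Perm.shift h as bs) xs↭ ,
        replace as (λ z∈ k∈z → mk⇔ (λ k∈x → xj (there z∈) k∈x k∈z) (λ k∈h → hw (∈-keep as z∈) k∈h k∈z)) r

  -- The algorithm takes whichever ear it finds, not the next one of the order `cs`. Induction walks
  -- down the order to that ear and puts each member passed on the way back in front.
  remove-ear : ∀ cs {x xs} → RIP cs → cs ↭ x ∷ xs → xs ≡ [] ⊎ Ear x xs → Acyclicˡ xs
  remove-ear []      r        p e = contradiction (Perm.↭-length p) λ ()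
  remove-ear (h ∷ t) (eh , r) p e with Perm.∈-resp-↭ (↭-sym p) (here refl)
  ... | here refl = t , Perm.drop-∷ p , r
  ... | there x∈t with ∈-∃++ x∈t | (λ {xs} → remove-ear t {_} {xs} r)
  ...   | as , bs , refl | smaller = remove-ear-after h as bs r smaller eh p e

-- Elimination orders from trees

module TreeOrder {m : ℕ} (Adj : Rel (Fin m) 0ℓ) (tree : IsTree Adj) where
  open IsTree tree

  -- Subtrees built by attaching leaves. The newest vertex stands first, so the list is already an
  -- elimination order.
  data Grown : List (Fin m) → Set where
    root : ∀ v → Grown (v ∷ [])
    grow : ∀ {v p V} → Grown V → v ∉ V → p ∈ V → Adj v p → Grown (v ∷ V)

  linked-∷ʳ : ∀ us {v w} → Linked Adj (us ∷ʳ v) → Adj v w → Linked Adj ((us ∷ʳ v) ∷ʳ w)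
  linked-∷ʳ []           [-]     a = a ∷ [-]
  linked-∷ʳ (u ∷ [])     (b ∷ l) a = b ∷ linked-∷ʳ [] l a
  linked-∷ʳ (u ∷ t ∷ us) (b ∷ l) a = b ∷ linked-∷ʳ (t ∷ us) l a

  unique-∷ʳ : ∀ {us : List (Fin m)} {w} → Unique us → w ∉ us → Unique (us ∷ʳ w)
  unique-∷ʳ []      w∉ = [] ∷ []
  unique-∷ʳ (n ∷ u) w∉ = All.∷ʳ⁺ n (λ e → w∉ (here (sym e))) ∷ unique-∷ʳ u (w∉ ∘ there)

  record Path (V : List (Fin m)) (u w : Fin m) : Set where
    constructor path
    field
      inner  : List (Fin m)
      unique : Unique (u ∷ (inner ∷ʳ w))
      linked : Linked Adj (u ∷ (inner ∷ʳ w))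
      contained : All (_∈ V) (u ∷ (inner ∷ʳ w))

  ∉-all : ∀ {V us : List (Fin m)} {v} → v ∉ V → All (_∈ V) us → v ∉ us
  ∉-all v∉ a p = v∉ (All.lookup a p)

  distinct : ∀ {V us : List (Fin m)} {v} → v ∉ V → All (_∈ V) us → All (v ≢_) us
  distinct v∉ a = All.map (λ u∈ → λ { refl → v∉ u∈ }) a

  paths : ∀ {V u w} → Grown V → u ∈ V → w ∈ V → u ≢ w → Path V u w
  paths (root v) (here refl) (here refl) u≢w = contradiction refl u≢w
  paths (grow G v∉ p∈ a) (here refl) (here refl) u≢w = contradiction refl u≢w
  paths (grow G v∉ p∈ a) (there u∈) (there w∈) u≢w with paths G u∈ w∈ u≢w
  ... | path us un li al = path us un li (All.map there al)
  paths {w = w} (grow {p = p} G v∉ p∈ a) (here refl) (there w∈) u≢w with p Fin.≟ w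
  ... | yes refl = path [] ((u≢w ∷ []) ∷ [] ∷ []) (a ∷ [-]) (here refl ∷ there w∈ ∷ [])
  ... | no p≢w with paths G p∈ w∈ p≢w
  ...   | path us un li al = path (p ∷ us) (distinct v∉ al ∷ un) (a ∷ li) (here refl ∷ All.map there al)
  paths {u = u} (grow {p = p} G v∉ p∈ a) (there u∈) (here refl) u≢w with u Fin.≟ p
  ... | yes refl = path [] ((u≢w ∷ []) ∷ [] ∷ []) (symmetric a ∷ [-]) (there u∈ ∷ here refl ∷ [])
  ... | no u≢p with paths G u∈ p∈ u≢p
  ...   | path us un li al = path (us ∷ʳ p) (unique-∷ʳ un (∉-all v∉ al)) (linked-∷ʳ (u ∷ us) li (symmetric a))
                                  (All.∷ʳ⁺ (All.map there al) (here refl))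

  -- Two distinct neighbours of `v` in `V` would be joined by a simple path inside `V`, and `v`
  -- would close it to a cycle.
  only-neighbour : ∀ {v p V} → Grown V → v ∉ V → p ∈ V → Adj v p → ∀ {w} → w ∈ V → Adj v w → w ≡ p
  only-neighbour {v} {p} G v∉ p∈ a {w} w∈ b with w Fin.≟ p
  ... | yes eq = eq
  ... | no w≢p with paths G p∈ w∈ (w≢p ∘ sym)
  ...   | path us un li al = ⊥-elim (acyclic (v ∷ ((p ∷ us) ∷ʳ w))
    (v , p ∷ us , w , refl , (λ ()) , distinct v∉ al ∷ un , a ∷ li , symmetric b))

  grown-unique : ∀ {V} → Grown V → Unique V
  grown-unique (root v)         = [] ∷ []
  grown-unique (grow G v∉ p∈ a) = distinct v∉ (All.tabulate id) ∷ grown-unique G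

  -- The walk is added from its far end: a vertex not yet present attaches to its successor on the
  -- walk.
  reach : ∀ {V i r} → Grown V → Star Adj i r → r ∈ V → ∃[ W ] Grown W × (∀ {v} → v ∈ V → v ∈ W) × i ∈ W
  reach {V} G stay r∈ = V , G , id , r∈
  reach {i = i} G (a ◅ s) r∈ with reach G s r∈
  ... | W , H , kept , j∈ with Any.any? (i Fin.≟_) W
  ...   | yes i∈ = W , H , kept , i∈
  ...   | no i∉  = i ∷ W , grow H i∉ j∈ a , there ∘ kept , here refl

  span : ∀ is {V r} → Grown V → r ∈ V → ∃[ W ] Grown W × (∀ {v} → v ∈ V → v ∈ W) × (∀ {i} → i ∈ is → i ∈ W)
  span []       {V} G r∈ = V , G , id , λ ()
  span (i ∷ is) {V} {r} G r∈ with reach G (connected i r) r∈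
  ... | W , H , kept , i∈ with span is H (kept r∈)
  ...   | X , K , kept′ , all = X , K , kept′ ∘ kept , λ { (here refl) → kept′ i∈ ; (there p) → all p }

  module _ (K : Fin m → List ℕ) where
    open RunningIntersection

    Within : List (Fin m) → ℕ → Rel (Fin m) 0ℓ
    Within V k u v = u ∈ V × v ∈ V × k ∈ K u × k ∈ K v × Adj u v

    Connected : List (Fin m) → Set
    Connected V = ∀ k {i j} → i ∈ V → j ∈ V → k ∈ K i → k ∈ K j → Star (Within V k) i j

    -- A path that visits the leaf v enters and leaves it through its only neighbour p.
    bypass : ∀ {v p V k} → Grown V → v ∉ V → p ∈ V → Adj v p → ∀ {i j} → Star (Within (v ∷ V) k) i j → j ∈ V →
             (i ∈ V → Star (Within V k) i j) × (i ≡ v → k ∈ K p × Star (Within V k) p j)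
    bypass G v∉ p∈ a stay j∈ = (λ _ → stay) , λ { refl → contradiction j∈ v∉ }
    bypass G v∉ p∈ a ((_ , here refl , k∈i , k∈j , b) ◅ s) j∈ with bypass G v∉ p∈ a s j∈
    ... | _ , h = (λ i∈ → subst (λ u → Star _ u _) (sym (only-neighbour G v∉ p∈ a i∈ (symmetric b))) (proj₂ (h refl))) ,
                  λ { refl → contradiction b (irreflexive refl) }
    bypass {p = p} {k = k} G v∉ p∈ a ((_ , there u∈ , k∈i , k∈u , b) ◅ s) j∈ with bypass G v∉ p∈ a s j∈
    ... | h , _ = (λ i∈ → (i∈ , u∈ , k∈i , k∈u , b) ◅ h u∈) ,
                  λ { refl → case only-neighbour G v∉ p∈ a u∈ b of λ { refl → k∈u , h u∈ } }

    -- A column that the newest leaf shares with another vertex occurs along a walk out of the leaf,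
    -- hence also at its only neighbour `p`; so the leaf is an ear. Bypassing it keeps the remaining
    -- vertices connected for every column.
    grown-RIP : ∀ {V} → Grown V → Connected V → RIP (map K V)
    grown-RIP (root v) c = inj₁ refl , tt
    grown-RIP (grow {v} {p} {V} G v∉ p∈ a) c = inj₂ (K p , ∈-map⁺ K p∈ , ear) ,
      grown-RIP G λ k i∈ j∈ k∈i k∈j → proj₁ (bypass G v∉ p∈ a (c k (there i∈) (there j∈) k∈i k∈j) j∈) i∈
      where
      ear : EarOf (K v) (K p) (map K V)
      ear z∈ {k} k∈v k∈z with ∈-map⁻ K z∈
      ... | w , w∈ , refl = proj₁ (proj₂ (bypass G v∉ p∈ a (c k (here refl) (there w∈) k∈v k∈z) w∈) refl)

    tree-acyclic : (∀ k {i j} → k ∈ K i → k ∈ K j → Star (λ u v → k ∈ K u × k ∈ K v × Adj u v) i j) →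
                   Acyclicˡ (map K (allFin m))
    tree-acyclic conn = order (allFin m) refl
      where
      order : ∀ is → is ≡ allFin m → Acyclicˡ (map K (allFin m))
      order []       eq = [] , subst (λ l → [] ↭ map K l) eq ↭-refl , tt
      order (i ∷ is) eq with span (allFin m) (root i) (here refl)
      ... | W , G , _ , all = map K W , Perm.map⁺ K (unique-↭ (grown-unique G) (Unique.allFin⁺ m) (λ {v} _ → ∈-tabulate⁺ v) all) ,
        grown-RIP G λ k {i} {j} _ _ k∈i k∈j → weaken (conn k k∈i k∈j)
        where
        weaken : ∀ {k i j} → Star (λ u v → k ∈ K u × k ∈ K v × Adj u v) i j → Star (Within W k) i j
        weaken stay            = stay
        weaken ((p , q , a) ◅ s) = (all (∈-tabulate⁺ _) , all (∈-tabulate⁺ _) , p , q , a) ◅ weaken s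

-- Sizes and running time

-- Bernoulli's inequality `1 + k/N ≤ (1 + 1/N) ^ k` with denominators cleared.
bernoulli : ∀ N k → N ℕ.^ k ℕ.* (N ℕ.+ k) ℕ.≤ N ℕ.* suc N ℕ.^ k
bernoulli N zero    = ℕ.≤-reflexive (one N)
  where
  one : ∀ N → 1 ℕ.* (N ℕ.+ 0) ≡ N ℕ.* 1
  one = solve-∀
bernoulli N (suc k) = begin
  N ℕ.^ suc k ℕ.* (N ℕ.+ suc k)             ≡⟨ regroup N (N ℕ.^ k) k ⟩
  N ℕ.^ k ℕ.* (N ℕ.+ N ℕ.* (N ℕ.+ k))       ≤⟨ ℕ.*-monoʳ-≤ (N ℕ.^ k) (ℕ.+-monoˡ-≤ _ (ℕ.m≤m+n N k)) ⟩
  N ℕ.^ k ℕ.* (suc N ℕ.* (N ℕ.+ k))         ≡⟨ *-exchange (N ℕ.^ k) (suc N) (N ℕ.+ k) ⟩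
  suc N ℕ.* (N ℕ.^ k ℕ.* (N ℕ.+ k))         ≤⟨ ℕ.*-monoʳ-≤ (suc N) (bernoulli N k) ⟩
  suc N ℕ.* (N ℕ.* suc N ℕ.^ k)             ≡⟨ *-exchange (suc N) N (suc N ℕ.^ k) ⟩
  N ℕ.* suc N ℕ.^ suc k                     ∎
  where
  open ℕ.≤-Reasoning
  regroup : ∀ N p k → N ℕ.* p ℕ.* (N ℕ.+ suc k) ≡ p ℕ.* (N ℕ.+ N ℕ.* (N ℕ.+ k))
  regroup = solve-∀

-- The case k = N: growing N times by 1 + 1/N at least doubles. Hence the factor `N` in the lengths
-- of thinned sketches.
doubling : ∀ N → 1 ℕ.≤ N → 2 ℕ.* N ℕ.^ N ℕ.≤ suc N ℕ.^ N
doubling N@(suc _) _ = ℕ.*-cancelˡ-≤ N (ℕ.≤-trans (ℕ.≤-reflexive (regroup N (N ℕ.^ N))) (bernoulli N N))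
  where
  regroup : ∀ N p → N ℕ.* (2 ℕ.* p) ≡ p ℕ.* (N ℕ.+ N)
  regroup = solve-∀

^-distribˡ-* : ∀ a b q → (a ℕ.* b) ℕ.^ q ≡ a ℕ.^ q ℕ.* b ℕ.^ q
^-distribˡ-* a b zero    = refl
^-distribˡ-* a b (suc q) = trans (cong (a ℕ.* b ℕ.*_) (^-distribˡ-* a b q)) (interchange a b (a ℕ.^ q) (b ℕ.^ q))
  where
  interchange : ∀ a b c d → a ℕ.* b ℕ.* (c ℕ.* d) ≡ a ℕ.* c ℕ.* (b ℕ.* d)
  interchange = solve-∀

geometric : ∀ N q r → 1 ℕ.≤ N → 2 ℕ.^ q ℕ.* N ℕ.^ (N ℕ.* q ℕ.+ r) ℕ.≤ suc N ℕ.^ (N ℕ.* q ℕ.+ r)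
geometric N q r 1≤N = begin
  2 ℕ.^ q ℕ.* N ℕ.^ (N ℕ.* q ℕ.+ r)             ≡⟨ cong (2 ℕ.^ q ℕ.*_) (powers N) ⟩
  2 ℕ.^ q ℕ.* ((N ℕ.^ N) ℕ.^ q ℕ.* N ℕ.^ r)     ≡⟨ ℕ.*-assoc (2 ℕ.^ q) _ _ ⟨
  2 ℕ.^ q ℕ.* (N ℕ.^ N) ℕ.^ q ℕ.* N ℕ.^ r       ≡⟨ cong (ℕ._* N ℕ.^ r) (^-distribˡ-* 2 (N ℕ.^ N) q) ⟨
  (2 ℕ.* N ℕ.^ N) ℕ.^ q ℕ.* N ℕ.^ r             ≤⟨ ℕ.*-mono-≤ (ℕ.^-monoˡ-≤ q (doubling N 1≤N)) (ℕ.^-monoˡ-≤ r (ℕ.n≤1+n N)) ⟩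
  (suc N ℕ.^ N) ℕ.^ q ℕ.* suc N ℕ.^ r           ≡⟨ powers (suc N) ⟨
  suc N ℕ.^ (N ℕ.* q ℕ.+ r)                     ∎
  where
  open ℕ.≤-Reasoning
  powers : ∀ a → a ℕ.^ (N ℕ.* q ℕ.+ r) ≡ (a ℕ.^ N) ℕ.^ q ℕ.* a ℕ.^ r
  powers a = trans (ℕ.^-distribˡ-+-* a (N ℕ.* q) r) (cong (ℕ._* a ℕ.^ r) (sym (ℕ.^-*-assoc a N q)))

module CompressedLength {ℜ : CompleteOrderedField} (M : RealCommutativeMonoid ℜ) where
  open CompleteOrderedField ℜ
  open Algorithm M
  open Integration M

  -- Each entry emitted after the first multiplies the emitted multiplicity by at least 1 + 1/N.
  growth : ∀ N S → let c , (a , out) = foldr (λ e → thin (N , e)) (0 , (0 , [])) S ; l = length out in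
           (l ≡ 0 × a ≡ 0) ⊎ (suc N ℕ.^ l ℕ.≤ N ℕ.^ l ℕ.* (2 ℕ.* a))
  growth N []      = inj₁ (refl , refl)
  growth N (e ∷ S) with foldr (λ e → thin (N , e)) (0 , (0 , [])) S | growth N S
  ... | c , (a , out) | ih with N ℕ.* (c ℕ.+ proj₂ e) ℕ.≤ᵇ N ℕ.* a ℕ.+ a in eq
  ...   | true  = ih
  ...   | false = inj₂ (step ih)
    where
    c′ = c ℕ.+ proj₂ e
    l  = length out
    above : N ℕ.* a ℕ.+ a ℕ.< N ℕ.* c′
    above = ℕ.≰⇒> λ h → subst T eq (ℕ.≤⇒≤ᵇ h)
    open ℕ.≤-Reasoning
    exchange : ∀ N p a → (a ℕ.+ N ℕ.* a) ℕ.* (2 ℕ.* p) ≡ suc N ℕ.* (p ℕ.* (2 ℕ.* a))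
    exchange = solve-∀
    swap′ : ∀ N p c → N ℕ.* c ℕ.* (2 ℕ.* p) ≡ N ℕ.* p ℕ.* (2 ℕ.* c)
    swap′ = solve-∀
    step : (l ≡ 0 × a ≡ 0) ⊎ (suc N ℕ.^ l ℕ.≤ N ℕ.^ l ℕ.* (2 ℕ.* a)) → suc N ℕ.^ suc l ℕ.≤ N ℕ.^ suc l ℕ.* (2 ℕ.* c′)
    -- The first entry has no predecessor to grow from; the spare factor 2 in the claim pays for it,
    -- as both `N` and `c′` are positive.
    step (inj₁ (eq₁ , eq₂)) rewrite eq₁ = begin
      suc N ℕ.* 1                 ≡⟨ ℕ.*-identityʳ (suc N) ⟩
      suc N                       ≤⟨ ℕ.+-mono-≤ 1≤ N≤ ⟩
      N ℕ.* c′ ℕ.+ N ℕ.* c′       ≡⟨ twice N c′ ⟩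
      N ℕ.* 1 ℕ.* (2 ℕ.* c′)      ∎
      where
      1≤ : 1 ℕ.≤ N ℕ.* c′
      1≤ = ℕ.≤-trans (s≤s z≤n) above
      N≤ : N ℕ.≤ N ℕ.* c′
      N≤ = go c′ 1≤
        where
        go : ∀ c → 1 ℕ.≤ N ℕ.* c → N ℕ.≤ N ℕ.* c
        go zero    h = contradiction (subst (1 ℕ.≤_) (ℕ.*-zeroʳ N) h) λ ()
        go (suc c) h = ℕ.m≤m*n N (suc c)
      twice : ∀ N c → N ℕ.* c ℕ.+ N ℕ.* c ≡ N ℕ.* 1 ℕ.* (2 ℕ.* c)
      twice = solve-∀
    step (inj₂ h) = begin
      suc N ℕ.* suc N ℕ.^ l                         ≤⟨ ℕ.*-monoʳ-≤ (suc N) h ⟩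
      suc N ℕ.* (N ℕ.^ l ℕ.* (2 ℕ.* a))             ≡⟨ exchange N (N ℕ.^ l) a ⟨
      (a ℕ.+ N ℕ.* a) ℕ.* (2 ℕ.* N ℕ.^ l)           ≤⟨ ℕ.*-monoˡ-≤ (2 ℕ.* N ℕ.^ l) (ℕ.≤-trans (ℕ.≤-reflexive (ℕ.+-comm a _)) (ℕ.<⇒≤ above)) ⟩
      N ℕ.* c′ ℕ.* (2 ℕ.* N ℕ.^ l)                  ≡⟨ swap′ N (N ℕ.^ l) c′ ⟩
      N ℕ.* N ℕ.^ l ℕ.* (2 ℕ.* c′)                  ∎

  compress-mass : ∀ N S → mass (compress (N , S)) ℕ.≤ mass S
  compress-mass N S = ℕ.≤-trans (ℕ.≤-reflexive (sym emitted)) (ℕ.≤-trans (proj₁ close)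
    (ℕ.≤-reflexive (trans read (∫-↭ (λ _ → 1) (sort-↭ S)))))
    where open Thinned (thinned N (sort S) (sort-descending S))

  -- Every N entries double the emitted mass, which stays below 2 ^ X. Of the two extra doublings,
  -- one covers the factor 2 in `growth` and the other makes the contradiction strict.
  length-compress : ∀ N S X → 1 ℕ.≤ N → mass S ℕ.≤ 2 ℕ.^ X → length (compress (N , S)) ℕ.≤ N ℕ.* (X ℕ.+ 2)
  length-compress N@(suc _) S X 1≤N small with growth N (sort S)
  ... | inj₁ (eq , _) = ℕ.≤-trans (ℕ.≤-reflexive eq) z≤n
  ... | inj₂ h with ℕ.≤-total (length (compress (N , S))) (N ℕ.* (X ℕ.+ 2))
  ...   | inj₁ l≤ = l≤
  ...   | inj₂ ≤l = contradiction absurd (ℕ.<⇒≱ (ℕ.^-monoʳ-< 2 (s≤s (s≤s z≤n)) (ℕ.≤-reflexive (sym (ℕ.+-suc X 1)))))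
    where
    l = length (compress (N , S))
    r = l ℕ.∸ N ℕ.* (X ℕ.+ 2)
    a = proj₁ (proj₂ (foldr (λ e → thin (N , e)) (0 , (0 , [])) (sort S)))
    eq : N ℕ.* (X ℕ.+ 2) ℕ.+ r ≡ l
    eq = ℕ.m+[n∸m]≡n ≤l
    open Thinned (thinned N (sort S) (sort-descending S))
    emitted≤ : mass (compress (N , S)) ℕ.≤ 2 ℕ.^ X
    emitted≤ = ℕ.≤-trans (compress-mass N S) small
    absurd : 2 ℕ.^ (X ℕ.+ 2) ℕ.≤ 2 ℕ.^ (X ℕ.+ 1)
    absurd = ℕ.*-cancelʳ-≤ _ _ (N ℕ.^ l) {{ℕ.m^n≢0 N l}} (begin
      2 ℕ.^ (X ℕ.+ 2) ℕ.* N ℕ.^ l       ≤⟨ subst (λ l → 2 ℕ.^ (X ℕ.+ 2) ℕ.* N ℕ.^ l ℕ.≤ suc N ℕ.^ l) eq (geometric N (X ℕ.+ 2) r 1≤N) ⟩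
      suc N ℕ.^ l                       ≤⟨ h ⟩
      N ℕ.^ l ℕ.* (2 ℕ.* a)             ≤⟨ ℕ.*-monoʳ-≤ (N ℕ.^ l) (ℕ.*-monoʳ-≤ 2 (ℕ.≤-trans (ℕ.≤-reflexive emitted) emitted≤)) ⟩
      N ℕ.^ l ℕ.* (2 ℕ.* 2 ℕ.^ X)       ≡⟨ ℕ.*-comm (N ℕ.^ l) _ ⟩
      2 ℕ.* 2 ℕ.^ X ℕ.* N ℕ.^ l         ≡⟨ cong (λ k → 2 ℕ.^ k ℕ.* N ℕ.^ l) (ℕ.+-comm 1 X) ⟩
      2 ℕ.^ (X ℕ.+ 1) ℕ.* N ℕ.^ l       ∎)
      where open ℕ.≤-Reasoning

-- Bounds preserved during elimination

module Resources {ℜ : CompleteOrderedField} (B : BasicFunctions ℜ) (M : RealCommutativeMonoid ℜ)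
                 (⊕-program : PolynomialTimeOperator B M) where
  open CompleteOrderedField ℜ
  open Language B M
  open Algorithm M
  open Lengths M
  open Integration M
  open Elimination M
  open CompressedLength M
  open Implementation B M ⊕-program
  open Routine using (Fits)
  open RunningIntersection
  open BigSum ℕ.+-0-commutativeMonoid
  module Π = BigSum ℕ.*-1-commutativeMonoid

  ∈-pairs : ∀ {A : Set} {xs : List A} {x y ys zs} → (x , ys) ∈ selections xs → (y , zs) ∈ selections ys → (x , (y , zs)) ∈ pairs xs
  ∈-pairs {xs = xs} {x} {y} {ys} p q = ∈->>=⁺ (selections xs) (λ p → mapᶠ (selections (proj₂ p)) λ q → proj₁ p , q) p
    (∈-mapᶠ⁺ (selections ys) (λ q → x , q) q)

  -- The head of an elimination order is an ear, and the search runs through all pairs, so it cannot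
  -- come back empty.
  ear-exists : ∀ Ts → Acyclicˡ (map proj₁ Ts) → 2 ℕ.≤ length Ts → select (pairs Ts) isEar ≢ []
  ear-exists Ts ([] , p , r) 2≤ eq = contradiction (subst (2 ℕ.≤_) (trans (sym (List.length-map proj₁ Ts)) (sym (Perm.↭-length p))) 2≤) λ ()
  ear-exists Ts (h ∷ hs , p , (e , r)) 2≤ eq with Perm.↭-map-inv proj₁ (↭-sym p)
  ... | x ∷ xs , refl , q with e
  ...   | inj₁ none = contradiction (subst (2 ℕ.≤_) (trans (Perm.↭-length q) (cong suc (trans (sym (List.length-map proj₁ xs)) (cong length none)))) 2≤)
                        λ { (s≤s ()) }
  ...   | inj₂ (k , k∈ , ear) with ∈-map⁻ proj₁ k∈ | ∈-selections Ts (Perm.∈-resp-↭ (↭-sym q) (here refl))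
  ...     | y , y∈ , refl | ys , sel with Perm.drop-∷ (↭-trans (selections-↭ Ts sel) q)
  ...       | ys↭xs with ∈-selections ys (Perm.∈-resp-↭ (↭-sym ys↭xs) y∈)
  ...         | zs , sel′ = contradiction (subst ((x , (y , zs)) ∈_) eq (∈-select⁺ (pairs Ts) isEar (∈-pairs {xs = Ts} {x} {y} {ys} {zs} sel sel′) (isEar⁺ {x} {y} {zs} λ z∈ →
                  ear (∈-map⁺ proj₁ (Perm.∈-resp-↭ ys↭xs (Perm.∈-resp-↭ (selections-↭ ys sel′) (there z∈))))))) λ ()

  tableMass : SketchedTable → ℕ
  tableMass T = ∑ (proj₂ T) (mass ∘ proj₂)

  -- The total mass of the combined sketches, with each factor increased by one to keep it positive.
  potential : List SketchedTable → ℕ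
  potential Ts = Π.∑ Ts (suc ∘ tableMass)

  1≤potential : ∀ Ts → 1 ℕ.≤ potential Ts
  1≤potential []       = ℕ.≤-refl
  1≤potential (T ∷ Ts) = ℕ.*-mono-≤ {1} {suc (tableMass T)} (s≤s z≤n) (1≤potential Ts)

  mass-const : ∀ S k → ∫ S (λ _ → k) ≡ mass S ℕ.* k
  mass-const S k = trans (∫-cong S λ _ → sym (ℕ.*-identityʳ k)) (trans (∫-* S k (λ _ → 1)) (ℕ.*-comm k (mass S)))

  mass-times : ∀ S S′ → mass (times (S , S′)) ≡ mass S ℕ.* mass S′
  mass-times S S′ = trans (∫-times S S′ (λ _ → 1)) (mass-const S (mass S′))

  mass-matching : ∀ x r → mass (matching (x , r)) ℕ.≤ tableMass x
  mass-matching x r = ℕ.≤-trans (ℕ.≤-reflexive (∫-matching x r (λ _ → 1)))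
    (∑-mono (proj₂ x) λ e _ → drop (consistent (proj₁ e , r)))
    where
    drop : ∀ b {n} → (if b then n else 0) ℕ.≤ n
    drop true  = ℕ.≤-refl
    drop false = z≤n

  mass-product : ∀ (x y : SketchedTable) {e} → e ∈ proj₂ y → mass (times (proj₂ e , matching (x , proj₁ e))) ℕ.≤ mass (proj₂ e) ℕ.* tableMass x
  mass-product x y {e} _ = ℕ.≤-trans (ℕ.≤-reflexive (mass-times (proj₂ e) (matching (x , proj₁ e)))) (ℕ.*-monoʳ-≤ (mass (proj₂ e)) (mass-matching x (proj₁ e)))

  tableMass-absorb : ∀ N x y → tableMass (absorb (N , (x , y))) ℕ.≤ tableMass y ℕ.* tableMass x
  tableMass-absorb N x y = begin
    tableMass (absorb (N , (x , y)))
      ≡⟨ ∑-mapᶠ (proj₂ y) (λ e → proj₁ e , compress (N , times (proj₂ e , matching (x , proj₁ e)))) (mass ∘ proj₂) ⟩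
    ∑ (proj₂ y) (λ e → mass (compress (N , times (proj₂ e , matching (x , proj₁ e)))))
      ≤⟨ ∑-mono (proj₂ y) (λ e e∈ → ℕ.≤-trans (compress-mass N (times (proj₂ e , matching (x , proj₁ e)))) (ℕ.≤-trans (mass-product x y e∈)
           (ℕ.≤-reflexive (ℕ.*-comm (mass (proj₂ e)) (tableMass x))))) ⟩
    ∑ (proj₂ y) (λ e → tableMass x ℕ.* mass (proj₂ e))
      ≡⟨ *-∑ (tableMass x) (proj₂ y) (mass ∘ proj₂) ⟨
    tableMass x ℕ.* tableMass y
      ≡⟨ ℕ.*-comm (tableMass x) (tableMass y) ⟩
    tableMass y ℕ.* tableMass x ∎
    where open ℕ.≤-Reasoning

  -- `b` bounds the lists that survive a round. Within a round a matching may reach `b * b` entries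
  -- and its product with a sketch `b * b * b`, which is what `s` must cover.
  module _ (N X b s : ℕ) (1≤N : 1 ℕ.≤ N) (1≤b : 1 ℕ.≤ b) (b-large : N ℕ.* (X ℕ.+ 2) ℕ.≤ b) (s-large : b ℕ.* b ℕ.* b ℕ.≤ s) where

    b≤b² : b ℕ.≤ b ℕ.* b
    b≤b² = ℕ.≤-trans (ℕ.≤-reflexive (sym (ℕ.*-identityʳ b))) (ℕ.*-monoʳ-≤ b 1≤b)

    b²≤s : b ℕ.* b ℕ.≤ s
    b²≤s = ℕ.≤-trans (ℕ.≤-trans (ℕ.≤-reflexive (sym (ℕ.*-identityʳ (b ℕ.* b)))) (ℕ.*-monoʳ-≤ (b ℕ.* b) 1≤b)) s-large

    b≤s : b ℕ.≤ s
    b≤s = ℕ.≤-trans b≤b² b²≤s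

    1≤s : 1 ℕ.≤ s
    1≤s = ℕ.≤-trans 1≤b b≤s

    record Small (T : SketchedTable) : Set where
      field
        keys≤   : length (proj₁ T) ℕ.≤ b
        rows≤   : length (proj₂ T) ℕ.≤ b
        row≤    : ∀ {e} → e ∈ proj₂ T → length (proj₁ e) ℕ.≤ b
        sketch≤ : ∀ {e} → e ∈ proj₂ T → length (proj₂ e) ℕ.≤ b
    open Small

    -- `acyclic` guarantees the next ear. Absorption multiplies masses, so `light` bounds a product
    -- over all tables; through `length-compress` it controls the new sketches.
    record Controlled (Ts : List SketchedTable) : Set where
      field
        acyclic : Acyclicˡ (map proj₁ Ts)
        light   : potential Ts ℕ.≤ 2 ℕ.^ X
        small   : ∀ {T} → T ∈ Ts → Small T
        few     : length Ts ℕ.≤ b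
    open Controlled

    length-matching : ∀ x r → Small x → length (matching (x , r)) ℕ.≤ b ℕ.* b
    length-matching x r k = ℕ.≤-trans (length->>= (proj₂ x) (λ e → if consistent (proj₁ e , r) then proj₂ e else []) b
      λ e e∈ → drop (consistent (proj₁ e , r)) (sketch≤ k e∈)) (ℕ.*-monoˡ-≤ b (rows≤ k))
      where
      drop : ∀ c {S : Sketch} → length S ℕ.≤ b → length (if c then S else []) ℕ.≤ b
      drop true  h = h
      drop false h = z≤n

    length-times : ∀ S S′ → length (times (S , S′)) ℕ.≤ length S ℕ.* length S′
    length-times S S′ = length->>= S (λ a → mapᶠ S′ λ e → proj₁ a + proj₁ e , proj₂ a ℕ.* proj₂ e) (length S′)
      λ a _ → ℕ.≤-reflexive (length-mapᶠ S′ _)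

    fits-absorb : ∀ x y → Small x → Small y → Fits absorbᴿ s (N , (x , y))
    fits-absorb x y kx ky = ℕ.≤-trans (rows≤ ky) b≤s , λ e e∈ →
      ℕ.≤-trans (sketch≤ ky e∈) b≤s ,
      (ℕ.≤-trans (row≤ ky e∈) b≤s , ℕ.≤-trans (rows≤ kx) b≤s , λ f f∈ →
        ℕ.≤-trans (row≤ kx f∈) b≤s , ℕ.≤-trans (sketch≤ kx f∈) b≤s) ,
      ℕ.≤-trans (length-matching x (proj₁ e) kx) b²≤s ,
      ℕ.≤-trans (length-times (proj₂ e) (matching (x , proj₁ e))) (ℕ.≤-trans (ℕ.*-mono-≤ (sketch≤ ky e∈) (length-matching x (proj₁ e) kx))
        (ℕ.≤-trans (ℕ.≤-reflexive (sym (ℕ.*-assoc b b b))) s-large))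

    fits-reduce : ∀ Ts → Controlled Ts → Fits reduceᴿ s (N , Ts)
    fits-reduce Ts c = 1≤s , ℕ.≤-trans (few c) b≤s ,
      ℕ.≤-trans (length-pairs Ts) (ℕ.≤-trans (ℕ.*-mono-≤ (few c) (few c)) b²≤s) ,
      (λ T T∈ → ℕ.≤-trans (keys≤ (small c T∈)) b≤s) ,
      (λ x y zs p → fits-absorb x y (small c (Perm.∈-resp-↭ (pairs-↭ Ts p) (here refl)))
                                    (small c (Perm.∈-resp-↭ (pairs-↭ Ts p) (there (here refl))))) ,
      ear-exists Ts (acyclic c)

    controlled-reduce : ∀ Ts → Controlled Ts → Controlled (reduce (N , Ts))
    controlled-reduce []       c = c
    controlled-reduce (x ∷ []) c = c
    controlled-reduce Ts@(_ ∷ _ ∷ _) c with select (pairs Ts) isEar in eq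
    ... | [] = contradiction eq (ear-exists Ts (acyclic c) (s≤s (s≤s z≤n)))
    ... | (x , (y , zs)) ∷ _ with ∈-select⁻ (pairs Ts) isEar (subst ((x , (y , zs)) ∈_) (sym eq) (here refl))
    ...   | p , ear = record
      { acyclic = let ds , q , r = acyclic c in
          remove-ear ds r (↭-trans q (Perm.map⁺ proj₁ (↭-sym perm))) (inj₂ (proj₁ y , here refl , λ z∈ k∈x k∈z → witness z∈ k∈x k∈z))
      ; light   = ℕ.≤-trans lighter (light c)
      ; small   = λ { (here refl) → small-absorb ; (there z∈) → small c (Perm.∈-resp-↭ perm (there (there z∈))) }
      ; few     = ℕ.≤-trans (ℕ.n≤1+n _) (ℕ.≤-trans (ℕ.≤-reflexive (Perm.↭-length perm)) (few c))
      }
      where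
      perm : x ∷ y ∷ zs ↭ Ts
      perm = pairs-↭ Ts p

      witness : EarOf (proj₁ x) (proj₁ y) (map proj₁ (y ∷ zs))
      witness (here refl) k∈x k∈z = k∈z
      witness (there z∈)  k∈x k∈z with ∈-map⁻ proj₁ z∈
      ... | z , z∈′ , refl = isEar⁻ {x} {y} {zs} ear z∈′ k∈x k∈z

      split-potential : potential Ts ≡ suc (tableMass x) ℕ.* (suc (tableMass y) ℕ.* potential zs)
      split-potential = sym (Π.∑-↭ (suc ∘ tableMass) perm)

      product≤ : ∀ a c r → suc (a ℕ.* c) ℕ.* r ℕ.≤ suc c ℕ.* (suc a ℕ.* r)
      product≤ a c r = ℕ.≤-trans (ℕ.m≤m+n _ ((a ℕ.+ c) ℕ.* r)) (ℕ.≤-reflexive (identity a c r))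
        where
        identity : ∀ a c r → suc (a ℕ.* c) ℕ.* r ℕ.+ (a ℕ.+ c) ℕ.* r ≡ suc c ℕ.* (suc a ℕ.* r)
        identity = solve-∀

      lighter : potential (absorb (N , (x , y)) ∷ zs) ℕ.≤ potential Ts
      lighter = ℕ.≤-trans (ℕ.*-monoˡ-≤ (potential zs) (s≤s (tableMass-absorb N x y)))
        (ℕ.≤-trans (product≤ (tableMass y) (tableMass x) (potential zs)) (ℕ.≤-reflexive (sym split-potential)))

      mass≤ : ∀ {e} → e ∈ proj₂ y → mass (times (proj₂ e , matching (x , proj₁ e))) ℕ.≤ 2 ℕ.^ X
      mass≤ {e} e∈ = begin
        mass (times (proj₂ e , matching (x , proj₁ e)))     ≤⟨ mass-product x y e∈ ⟩
        mass (proj₂ e) ℕ.* tableMass x                     ≤⟨ ℕ.*-monoˡ-≤ (tableMass x) (∑-∈ (proj₂ y) (mass ∘ proj₂) e∈) ⟩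
        tableMass y ℕ.* tableMass x                        ≤⟨ ℕ.n≤1+n _ ⟩
        suc (tableMass y ℕ.* tableMass x)                  ≡⟨ ℕ.*-identityʳ _ ⟨
        suc (tableMass y ℕ.* tableMass x) ℕ.* 1            ≤⟨ ℕ.*-monoʳ-≤ (suc (tableMass y ℕ.* tableMass x)) (1≤potential zs) ⟩
        suc (tableMass y ℕ.* tableMass x) ℕ.* potential zs ≤⟨ product≤ (tableMass y) (tableMass x) (potential zs) ⟩
        suc (tableMass x) ℕ.* (suc (tableMass y) ℕ.* potential zs) ≡⟨ split-potential ⟨
        potential Ts                                       ≤⟨ light c ⟩
        2 ℕ.^ X                                            ∎
        where open ℕ.≤-Reasoning

      ky : Small y
      ky = small c (Perm.∈-resp-↭ perm (there (here refl)))

      f : Row × Sketch → Row × Sketch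
      f e = proj₁ e , compress (N , times (proj₂ e , matching (x , proj₁ e)))

      small-absorb : Small (absorb (N , (x , y)))
      small-absorb = record
        { keys≤   = keys≤ ky
        ; rows≤   = ℕ.≤-trans (ℕ.≤-reflexive (length-mapᶠ (proj₂ y) f)) (rows≤ ky)
        ; row≤    = λ e∈ → case ∈-mapᶠ⁻ (proj₂ y) f e∈ of λ { (e , e∈′ , refl) → row≤ ky e∈′ }
        ; sketch≤ = λ e∈ → case ∈-mapᶠ⁻ (proj₂ y) f e∈ of λ { (e , e∈′ , refl) →
            ℕ.≤-trans (length-compress N (times (proj₂ e , matching (x , proj₁ e))) X 1≤N (mass≤ e∈′)) b-large }
        }

    controlled-steps : ∀ Ts (Us : List SketchedTable) → Controlled Ts →
      Stepʳ (λ _ Vs → reduce (N , Vs)) (λ _ Vs → Fits reduceᴿ s (N , Vs)) Ts Us ×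
      Controlled (foldr (λ _ Vs → reduce (N , Vs)) Ts Us)
    controlled-steps Ts []       c = tt , c
    controlled-steps Ts (U ∷ Us) c = let h , c′ = controlled-steps Ts Us c in
      (fits-reduce _ c′ , h) , controlled-reduce _ c′

    fits-tally : ∀ L Ts → Controlled Ts → Fits tallyᴿ s (N , (L , Ts))
    fits-tally L Ts c = let h , c′ = controlled-steps Ts Ts c in
      (ℕ.≤-trans (few c) b≤s , h) , λ T Us eq → let k = small c′ (subst (T ∈_) (sym eq) (here refl)) in
        ℕ.≤-trans (rows≤ k) b≤s , λ e e∈ → ℕ.≤-trans (sketch≤ k e∈) b≤s

infixl 8 _[_]

_[_] : ∀ {k} → Polynomial 1 → Polynomial k → Polynomial k
con c    [ σ ] = con c
var zero [ σ ] = σ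
(p :+ q) [ σ ] = p [ σ ] :+ q [ σ ]
(p :* q) [ σ ] = p [ σ ] :* q [ σ ]

evaluate-[] : ∀ {k} p (σ : Polynomial k) ρ → evaluate (p [ σ ]) ρ ≡ evaluate p (evaluate σ ρ ∷ [])
evaluate-[] (con c)    σ ρ = refl
evaluate-[] (var zero) σ ρ = refl
evaluate-[] (p :+ q)   σ ρ = cong₂ ℕ._+_ (evaluate-[] p σ ρ) (evaluate-[] q σ ρ)
evaluate-[] (p :* q)   σ ρ = cong₂ ℕ._*_ (evaluate-[] p σ ρ) (evaluate-[] q σ ρ)

module AcyclicQueries {ℜ : CompleteOrderedField} (B : BasicFunctions ℜ) (M : RealCommutativeMonoid ℜ)
                      (⊕-program : PolynomialTimeOperator B M) (q : Query M) (acyclic : Acyclic (Query.database q))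
                      (n : ℕ) (few-rows : ∀ i → length (Table.rows (Query.table q i)) ℕ.≤ n) (e : ℕ) where
  open CompleteOrderedField ℜ
  open RealCommutativeMonoid M using (R)
  open Query q
  open Language B M
  open Algorithm M
  open Lengths M
  open Integration M
  open Columns M
  open Joins M q
  open Implementation B M ⊕-program
  open FullImplementation B M ⊕-program hiding (functions)
  open Resources B M ⊕-program
  open Routine using (Fits)
  open RunningIntersection
  open BigSum ℕ.+-0-commutativeMonoid using (∑-mapᶠ)

  N X b s : ℕ
  N = m ℕ.* suc e
  X = n ℕ.* m
  -- Dominates the sizes in the input and the bound on thinned sketches, and is never zero.
  b = 1 ℕ.+ n ℕ.+ m ℕ.+ d ℕ.+ N ℕ.* (X ℕ.+ 2)
  s = b ℕ.* b ℕ.* b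

  1≤b : 1 ℕ.≤ b
  1≤b = s≤s z≤n

  n≤b : n ℕ.≤ b
  n≤b = ℕ.≤-trans (ℕ.n≤1+n n) (ℕ.≤-trans (ℕ.m≤m+n (1 ℕ.+ n) m) (ℕ.≤-trans (ℕ.m≤m+n _ d) (ℕ.m≤m+n _ (N ℕ.* (X ℕ.+ 2)))))

  m≤b : m ℕ.≤ b
  m≤b = ℕ.≤-trans (ℕ.m≤n+m m (1 ℕ.+ n)) (ℕ.≤-trans (ℕ.m≤m+n _ d) (ℕ.m≤m+n _ (N ℕ.* (X ℕ.+ 2))))

  d≤b : d ℕ.≤ b
  d≤b = ℕ.≤-trans (ℕ.m≤n+m d (1 ℕ.+ n ℕ.+ m)) (ℕ.m≤m+n _ (N ℕ.* (X ℕ.+ 2)))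

  b-large : N ℕ.* (X ℕ.+ 2) ℕ.≤ b
  b-large = ℕ.m≤n+m _ (1 ℕ.+ n ℕ.+ m ℕ.+ d)

  b²≤s′ : b ℕ.* b ℕ.≤ s
  b²≤s′ = ℕ.m≤m*n (b ℕ.* b) b

  b≤s′ : b ℕ.≤ s
  b≤s′ = ℕ.≤-trans (ℕ.m≤m*n b b) b²≤s′

  K : Fin m → List ℕ
  K i = keysOf (columns i)

  keys-acyclic : Acyclicˡ (map K (allFin m))
  keys-acyclic = let Adj , tree , conn = acyclic in TreeOrder.tree-acyclic Adj tree K λ k {i} {j} k∈i k∈j →
    let c , c∈ , eq = ∈-keysOf⁻ {C = columns i} k∈i ; c′ , c∈′ , eq′ = ∈-keysOf⁻ {C = columns j} k∈j in
    convert eq (conn c i j c∈ (subst (_∈ˢ columns j) (keyOf-injective (trans (sym eq′) eq)) c∈′))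
    where
    convert : ∀ {Adj : Rel (Fin m) 0ℓ} {c k i j} → k ≡ keyOf c →
              Star (λ u v → c ∈ˢ columns u × c ∈ˢ columns v × Adj u v) i j → Star (λ u v → k ∈ K u × k ∈ K v × Adj u v) i j
    convert eq   stay              = stay
    convert refl ((p , q , a) ◅ s) = (∈-keysOf⁺ p , ∈-keysOf⁺ q , a) ◅ convert refl s

  length-keysOf : ∀ {k} (C : Subset k) → length (keysOf C) ℕ.≤ k
  length-keysOf []            = z≤n
  length-keysOf (inside ∷ C)  = s≤s (length-keysOf C)
  length-keysOf (outside ∷ C) = ℕ.m≤n⇒m≤1+n (length-keysOf C)

  length-rowOf : ∀ {k} (C : Subset k) r → length (rowOf C r) ℕ.≤ k
  length-rowOf []            []      = z≤n
  length-rowOf (inside ∷ C)  (x ∷ r) = s≤s (length-rowOf C r)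
  length-rowOf (outside ∷ C) r       = ℕ.m≤n⇒m≤1+n (length-rowOf C r)

  record Modest (P : PreparedTable) : Set where
    field
      keys≤ : length (proj₁ P) ℕ.≤ d
      rows≤ : length (proj₂ P) ℕ.≤ n
      row≤  : ∀ {r} → r ∈ proj₂ P → length (proj₁ r) ℕ.≤ d

  modest-prepared : ∀ a → Modest (prepared a)
  modest-prepared a = record
    { keys≤ = length-keysOf (columns (proj₂ a))
    ; rows≤ = ℕ.≤-trans (ℕ.≤-reflexive (length-mapᶠ (rows (proj₂ a)) (preparedRow a))) (few-rows (proj₂ a))
    ; row≤  = λ r∈ → case ∈-mapᶠ⁻ (rows (proj₂ a)) (preparedRow a) r∈ of λ { (r , _ , refl) → length-rowOf (columns (proj₂ a)) r }
    }

  single : Row × (ℝ × ∃ R) → Row × Sketch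
  single r = proj₁ r , (proj₁ (proj₂ r) , 1) ∷ []

  tableMass-annotate : ∀ P → tableMass (annotate P) ≡ length (proj₂ P)
  tableMass-annotate P = trans (∑-mapᶠ (proj₂ P) single (mass ∘ proj₂)) (trans (∑-const (proj₂ P) 1) (ℕ.*-identityʳ _))

  -- Initially a table has mass at most n, and n + 1 is at most 2 ^ n. Crude as it is, this keeps
  -- the logarithm of the masses polynomial.
  potential-annotate : ∀ Ps → (∀ {P} → P ∈ Ps → Modest P) → potential (mapᶠ Ps annotate) ℕ.≤ 2 ℕ.^ (n ℕ.* length Ps)
  potential-annotate []       h = ℕ.≤-reflexive (cong (2 ℕ.^_) (sym (ℕ.*-zeroʳ n)))
  potential-annotate (P ∷ Ps) h = ℕ.≤-trans
    (ℕ.*-mono-≤ (ℕ.≤-trans (s≤s (ℕ.≤-trans (ℕ.≤-reflexive (tableMass-annotate P)) (Modest.rows≤ (h (here refl))))) (n<2^n n))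
      (potential-annotate Ps (h ∘ there)))
    (ℕ.≤-reflexive (trans (sym (ℕ.^-distribˡ-+-* 2 n (n ℕ.* length Ps))) (cong (2 ℕ.^_) (sym (ℕ.*-suc n (length Ps))))))

  module _ (1≤m : 1 ℕ.≤ m) where

    1≤N : 1 ℕ.≤ N
    1≤N = ℕ.*-mono-≤ {1} {m} {1} {suc e} 1≤m (s≤s z≤n)

    controlled : ∀ Ps → (∀ {P} → P ∈ Ps → Modest P) → length Ps ≡ m → Acyclicˡ (map proj₁ Ps) →
                 Controlled N X b s 1≤N 1≤b b-large ℕ.≤-refl (mapᶠ Ps annotate)
    controlled Ps h len (ds , p , r) = record
      { acyclic = ds , ↭-trans p (↭-reflexive (sym (keys Ps))) , r
      ; light   = ℕ.≤-trans (potential-annotate Ps h) (ℕ.≤-reflexive (cong (λ l → 2 ℕ.^ (n ℕ.* l)) len))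
      ; small   = λ T∈ → case ∈-mapᶠ⁻ Ps annotate T∈ of λ { (P , P∈ , refl) → record
        { keys≤   = ℕ.≤-trans (Modest.keys≤ (h P∈)) d≤b
        ; rows≤   = ℕ.≤-trans (ℕ.≤-reflexive (length-mapᶠ (proj₂ P) single)) (ℕ.≤-trans (Modest.rows≤ (h P∈)) n≤b)
        ; row≤    = λ e∈ → case ∈-mapᶠ⁻ (proj₂ P) single e∈ of λ { (r , r∈ , refl) → ℕ.≤-trans (Modest.row≤ (h P∈) r∈) d≤b }
        ; sketch≤ = λ e∈ → case ∈-mapᶠ⁻ (proj₂ P) single e∈ of λ { (r , r∈ , refl) → 1≤b }
        } }
      ; few     = ℕ.≤-trans (ℕ.≤-reflexive (trans (length-mapᶠ Ps annotate) len)) m≤b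
      }
      where
      keys : ∀ Ps → map proj₁ (mapᶠ Ps annotate) ≡ map proj₁ Ps
      keys []       = refl
      keys (P ∷ Ps) = cong (proj₁ P ∷_) (keys Ps)

  modest : ∀ {P} → P ∈ Ps → Modest P
  modest P∈ = case ∈-mapᶠ⁻ allMarks prepared P∈ of λ { (a , _ , refl) → modest-prepared a }

  keys-Ps : ∀ is → map proj₁ (mapᶠ (marks is) prepared) ≡ map K is
  keys-Ps []       = refl
  keys-Ps (i ∷ is) = cong (K i ∷_) (keys-Ps is)

  -- Cutting a table to one of its rows changes no columns and enlarges nothing, so each restricted
  -- join inherits acyclicity and the size bounds.
  fits-selection : ∀ x → x ∈ selections Ps → ∀ r → r ∈ proj₂ (proj₁ x) → Fits tallyᴿ s (N , (L , restricted (x , r)))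
  fits-selection (P , Qs) x∈ r r∈ = fits-tally N X b s (1≤N 1≤m) 1≤b b-large ℕ.≤-refl L (restricted ((P , Qs) , r))
    (controlled 1≤m ((proj₁ P , r ∷ []) ∷ Qs) modest′ length′
      (let ds , p , h = keys-acyclic in ds ,
        ↭-trans p (↭-trans (↭-reflexive (sym (keys-Ps (allFin m)))) (Perm.map⁺ proj₁ (↭-sym perm))) , h))
    where
    perm : P ∷ Qs ↭ Ps
    perm = selections-↭ Ps x∈

    length′ : suc (length Qs) ≡ m
    length′ = trans (Perm.↭-length perm) length-Ps

    1≤m : 1 ℕ.≤ m
    1≤m = ℕ.≤-trans (s≤s z≤n) (ℕ.≤-reflexive length′)

    nonempty : ∀ {A : Set} {y : A} {ys} → y ∈ ys → 1 ℕ.≤ length ys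
    nonempty (here _)  = s≤s z≤n
    nonempty (there _) = s≤s z≤n

    modest-P : Modest P
    modest-P = modest (Perm.∈-resp-↭ perm (here refl))

    modest′ : ∀ {Q} → Q ∈ (proj₁ P , r ∷ []) ∷ Qs → Modest Q
    modest′ (here refl) = record
      { keys≤ = Modest.keys≤ modest-P
      ; rows≤ = ℕ.≤-trans (nonempty r∈) (Modest.rows≤ modest-P)
      ; row≤  = λ { (here refl) → Modest.row≤ modest-P r∈ }
      }
    modest′ (there Q∈)  = modest (Perm.∈-resp-↭ perm (there Q∈))

  fits-answer : Fits (answerᴿ (suc e)) s arguments
  fits-answer = subst (ℕ._≤ s) (sym length-columns) d≤s , fits-prepare , fits-total
    where
    d≤s : d ℕ.≤ s
    d≤s = ℕ.≤-trans d≤b b≤s′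

    m≤s : m ℕ.≤ s
    m≤s = ℕ.≤-trans m≤b b≤s′

    n≤s : n ℕ.≤ s
    n≤s = ℕ.≤-trans n≤b b≤s′

    1≤s′ : 1 ℕ.≤ s
    1≤s′ = ℕ.≤-trans 1≤b b≤s′

    length-columns : length (map functions (allFin d)) ≡ d
    length-columns = trans (List.length-map functions (allFin d)) (List.length-tabulate {n = d} id)

    length-inputs : length (map input (allFin m)) ≡ m
    length-inputs = trans (List.length-map input (allFin m)) (List.length-tabulate {n = m} id)

    length-described : length (describe (map functions (allFin d))) ≡ d
    length-described = trans (length-describe (map functions (allFin d))) length-columns

    length-toList : ∀ {A : Set} {k} (v : Vec A k) → length (toList v) ≡ k
    length-toList []      = refl
    length-toList (x ∷ v) = cong suc (length-toList v)

    fits-prepare : Fits prepareᴿ s (describe (map functions (allFin d)) , map input (allFin m))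
    fits-prepare = 1≤s′ , subst (ℕ._≤ s) (sym length-described) d≤s , subst (ℕ._≤ s) (sym length-inputs) m≤s ,
      subst₂ (λ k l → k ℕ.* l ℕ.≤ s) (sym length-inputs) (sym length-described) (ℕ.≤-trans (ℕ.*-mono-≤ m≤b d≤b) b²≤s′) ,
      λ t t∈ → case ∈-map⁻ input t∈ of λ { (i , _ , refl) →
        ℕ.≤-trans (ℕ.≤-reflexive (length-toList (columns i))) d≤s ,
        ℕ.≤-trans (ℕ.≤-reflexive (List.length-map toList (rows i))) (ℕ.≤-trans (few-rows i) n≤s) }

    length-all : length (allRows Ps) ℕ.≤ s
    length-all = ℕ.≤-trans (length->>= Ps proj₂ n λ P P∈ → Modest.rows≤ (modest P∈))
      (subst (λ k → k ℕ.* n ℕ.≤ s) (sym length-Ps) (ℕ.≤-trans (ℕ.*-mono-≤ m≤b n≤b) b²≤s′))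

    fits-total : let Qs = prepare (describe (map functions (allFin d)) , map input (allFin m)) in
                 Fits totalᴿ s (precision (suc e) Qs , (L , Qs))
    fits-total = subst (λ (k , Qs) → Fits totalᴿ s (k , (L , Qs))) (sym (prepare-arguments (suc e)))
      (1≤s′ , subst (ℕ._≤ s) (sym length-Ps) m≤s , (λ P P∈ → ℕ.≤-trans (Modest.rows≤ (modest P∈)) n≤s) , length-all , fits-selection)

-- The approximation scheme

module Scheme {ℜ : CompleteOrderedField} (B : BasicFunctions ℜ) (M : RealCommutativeMonoid ℜ)
              (⊕-program : PolynomialTimeOperator B M) where
  open CompleteOrderedField ℜ
  open Language B M
  open Algorithm M
  open FullImplementation B M ⊕-program

  encodeList-map : ∀ {A C : Set} (f : A → C) (h : C → Value B) xs →
                   encodeList B M h (map f xs) ≡ encodeList B M (h ∘ f) xs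
  encodeList-map f h []       = refl
  encodeList-map f h (x ∷ xs) = cong (pair (h (f x))) (encodeList-map f h xs)

  module _ (q : Query M) where
    open Query q hiding (table)
    open Joins M q using (input; arguments) renaming (functions to columnFunctions)

    encode-arguments : encode B M q ≡ enc (real ⊗ list functions ⊗ list table) arguments
    encode-arguments = cong (pair (num L)) (cong₂ pair
      (sym (encodeList-map columnFunctions (enc functions) (allFin d)))
      (trans (cong (encodeList B M (encodeTable B M)) (sym (List.map-tabulate id (Query.table q))))
        (trans (encodeList-map (Query.table q) (encodeTable B M) (allFin m))
          (trans (encodeList-cong (allFin m)) (sym (encodeList-map input (enc table) (allFin m)))))))
      where
      encodeList-cong : ∀ is → encodeList B M (encodeTable B M ∘ Query.table q) is ≡ encodeList B M (enc table ∘ input) is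
      encodeList-cong []       = refl
      encodeList-cong (i ∷ is) = cong₂ pair
        (cong (pair (enc (list bool) (toList (Table.columns (Query.table q i)))))
          (sym (encodeList-map toList (enc (list real)) (Table.rows (Query.table q i)))))
        (encodeList-cong is)

    answer-runs : ∀ E → Runs (Routine.program (answerᴿ E)) (encode B M q) (num (proj₁ (answer E arguments)))
                  (λ s → Routine.Fits (answerᴿ E) s arguments) (Routine.time (answerᴿ E))
    answer-runs E = subst (λ v → Runs (Routine.program (answerᴿ E)) v (num (proj₁ (answer E arguments)))
        (λ s → Routine.Fits (answerᴿ E) s arguments) (Routine.time (answerᴿ E)))
      (sym encode-arguments) (Routine.correct (answerᴿ E) arguments)

  -- Shaped so that its evaluation reduces to the `s` of `AcyclicQueries` by computation alone.
  size-bound : ℕ → Polynomial 3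
  size-bound e = b :* b :* b
    where
    n m d b : Polynomial 3
    n = var zero
    m = var (suc zero)
    d = var (suc (suc zero))
    b = con 1 :+ n :+ m :+ d :+ m :* con (suc e) :* (n :* m :+ con 2)

  relational : ∀ e → IsRelational B M (Routine.program (answerᴿ (suc e)))
  relational e = Routine.time (answerᴿ (suc e)) [ size-bound e ] , λ q acyclic n few-rows →
    let open Query q
        open Runs (answer-runs q (suc e))
        open AcyclicQueries B M ⊕-program q acyclic n few-rows e
    in _ , _ , halts ,
       subst (steps ℕ.≤_) (sym (evaluate-[] (Routine.time (answerᴿ (suc e))) (size-bound e) (n ∷ m ∷ d ∷ [])))
         (bound s fits-answer)

theorem2 : (ℜ : CompleteOrderedField)
    (B : BasicFunctions ℜ)
    (M : RealCommutativeMonoid ℜ) →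
    PolynomialTimeOperator B M →
    IntroducesNoError M →
    Repeatable M →
    SumSumRAS B M
theorem2 ℜ B M ⊕-program no-error repeatable ε 0<ε =
  -- The tolerance enters only through the integer `e`: in the program as the constant `suc e`, and
  -- in the time bound through `size-bound e`.
  Language.Routine.program (FullImplementation.answerᴿ B M ⊕-program (suc e)) , relational e , λ q →
    let open Language.Runs (answer-runs q (suc e))
    in _ , steps , halts , Correctness.answer-correct M no-error repeatable q ε (≰⇒≥ 0<ε) e 1≤εe
  where
  open CompleteOrderedField ℜ
  open RealArithmetic ℜ
  open Scheme B M ⊕-program

  e : ℕ
  e = proj₁ (scale 0<ε)

  1≤εe : 1# ≤ ε * fromℕ e
  1≤εe = proj₂ (scale 0<ε)
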